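{- Let $\mathcal{P}_1,\dots,\mathcal{P}_r$ be vertex problems, and for each $i\in[r]$ let $(\mathfrak{C}_i,\rho_i)$ be a pair consisting of a monotone dynamic programming core and a $\mathfrak{C}_i$-vertex-membership function that solves $\mathcal{P}_i$. Let $f:\{0,1\}^r\to\mathbb{N}$, let $Div$ be the Venn $f$-diversity measure, and let $d\in\mathbb{N}$. Then the problem $Div^d(\mathcal{P}_1,\dots,\mathcal{P}_r)$ on a graph $G$ with a given cliquewidth decomposition $\mathcal{D}$ (i.e., deciding whether there exist $S_1,\dots,S_r\subseteq V(G)$ with $(G,S_i)\in\mathcal{P}_i$ for all $i$ and $Div(S_1,\dots,S_r)\ge d$) can be solved in time \[\mathcal{O}\left(\sum_{i=1}^r\tau(\mathfrak{C}_i,\mathcal{D}) + |V(\mathcal{D})|\cdot\prod_{i=1}^r Size_{\mathfrak{C}_i,\mathcal{D}}\right).\]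
   Context: All graphs are finite, simple and undirected; $[r]=\{1,\dots,r\}$. A vertex problem is a set of pairs $(G,S)$ with $G$ a graph and $S\subseteq V(G)$. For vertex problems $\mathcal{P}_1,\dots,\mathcal{P}_r$, a diversity measure $Div$ and $d\in\mathbb{N}$, $Div^d(\mathcal{P}_1,\dots,\mathcal{P}_r)=\{(G,S_1,\dots,S_r): (G,S_i)\in\mathcal{P}_i \text{ for all } i,\ Div(S_1,\dots,S_r)\ge d\}$. Venn $f$-diversity: for $v\in V$ and $S_1,\dots,S_r\subseteq V$, the membership vector $m(S_1,\dots,S_r,v)\in\{0,1\}^r$ has $i$-th entry $1$ iff $v\in S_i$. For $f:\{0,1\}^r\to\mathbb{N}$, $Div_f(S_1,\dots,S_r)=\sum_{v\in V} f(m(S_1,\dots,S_r,v))$, where $V=V(G)$. Cliquewidth decomposition: a rooted tree $\mathcal{D}$ of width $\omega$ in which every node $t$ is $intro(v,a)$ with $a\in[\omega]$ (a leaf; builds the one-vertex graph with vertex $v$ of color $a$; we write $t=Leaf_{\mathcal{D}}(v)$), $t_1\oplus t_2$ (disjoint union of the colored graphs of the two children), $recolor(t',a\to b)$ (recolor color $a$ to $b$) or $addEdges(t',a,b)$ (add all edges between colors $a$ and $b$). $G_t$ is the colored graph built by the subtree at $t$, $\delta(t)$ the number of children of $t$; $\mathcal{D}$ is a decomposition of $G$ if $G$ is isomorphic to the graph built at the root. Each vertex of $G$ has exactly one introducing leaf. A dynamic programming core is an algorithm $\mathfrak{C}$ that, given a cliquewidth decomposition $\mathcal{D}$ of $G$,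 produces a finite set $Accept_{\mathfrak{C},\mathcal{D}}\subseteq\{0,1\}^*$ and for each node $t$ a finite set $Process_{\mathfrak{C},\mathcal{D}}(t)\subseteq(\{0,1\}^*)^{\delta(t)+1}$; $\tau(\mathfrak{C},\mathcal{D})$ is the time to construct these data and $Size_{\mathfrak{C},\mathcal{D}}=\max_t|Process_{\mathfrak{C},\mathcal{D}}(t)|$. A $(\mathfrak{C},\mathcal{D},w)$-witness is a map $\alpha:V(\mathcal{D})\to\{0,1\}^*$ with $(\alpha(t),\alpha(t_1),\dots,\alpha(t_{\delta(t)}))\in Process_{\mathfrak{C},\mathcal{D}}(t)$ for every node $t$ with children $t_1,\dots,t_{\delta(t)}$, and $\alpha(\text{root})=w$; it is a $(\mathfrak{C},\mathcal{D})$-witness if additionally $w\in Accept_{\mathfrak{C},\mathcal{D}}$. Monotonicity: a core $\mathfrak{C}$ is monotone (for vertex problem $\mathcal{P}$) if there is a function $\rho:\{0,1\}^*\to\{0,1\}$ such that for every graph $G$, every cliquewidth decomposition $\mathcal{D}$ of $G$ and every $S\subseteq V(G)$: $(G,S)\in\mathcal{P}$ iff there is a $(\mathfrak{C},\mathcal{D})$-witness $\alpha$ with $S=\{v\in V(G):\rho(\alpha(Leaf_{\mathcal{D}}(v)))=1\}$. Such $\rho$ is a $\mathfrak{C}$-vertex-membership function and the pair $(\mathfrak{C},\rho)$ is said to solve $\mathcal{P}$.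
   Formalization: Each vertex-membership function ρ_i is additionally assumed computable in time linear in the length of its argument; for arbitrary (e.g. uncomputable) ρ_i the problem can be undecidable, so the claim fails as stated. Time is measured on a unit-cost RAM. -}

module Defs where

open import Data.Bool.Base using (Bool; true; false; if_then_else_)
open import Data.Empty using (⊥)
open import Data.Fin.Base using (Fin; toℕ)
open import Data.Fin.Subset using (Subset)
open import Data.List.Base using (List; []; _∷_; _++_; [_]; _∷ʳ_; map; concatMap; length; tabulate)
open import Data.List.Extrema.Nat using (max)
open import Data.List.Membership.Propositional using (_∈_)
open import Data.List.Relation.Unary.Unique.Propositional using (Unique)
open import Data.Nat.Base using (ℕ; zero; suc; _+_; _*_; _∸_; _≤_; _≥_)
open import Data.Nat.ListAction using (sum; product)
open import Data.Nat.Properties using (_≟_)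
open import Data.Product.Base using (Σ; ∃; ∃-syntax; _×_; _,_)
open import Data.Sum.Base using (_⊎_; inj₁; inj₂)
open import Data.Unit.Base using (⊤)
open import Data.Vec.Base as Vec using (Vec; []; _∷_)
open import Function.Base using (_∘_)
open import Function.Bundles using (_⇔_)
open import Function.Definitions using (Injective)
open import Relation.Binary.PropositionalEquality.Core using (_≡_; _≢_)
open import Relation.Nullary.Decidable.Core using (does)
open import Relation.Nullary.Negation.Core using (¬_)

-- A unit-cost random access machine with addition
-- and truncated subtraction, a sequential input and a write-only output.
-- Programs are structured rather than built from jumps, and use finitely
-- many named registers and arrays rather than one address space; either
-- choice affects running times by at most a constant factor.

Register : Set
Register = ℕ

Array : Set
Array = ℕ

infixr 5 _⨾_

data Program : Set where
  skip   : Program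
  const  : (x : Register) (k : ℕ) → Program
  add    : (x y z : Register) → Program
  sub    : (x y z : Register) → Program
  load   : (x : Register) (a : Array) (y : Register) → Program
  store  : (a : Array) (x y : Register) → Program
  read   : (x : Register) → Program
  write  : (x : Register) → Program
  _⨾_    : Program → Program → Program
  ifnz   : (x : Register) → Program → Program → Program
  whilenz : (x : Register) → Program → Program

record State : Set where
  constructor state
  field
    reg    : Register → ℕ
    arr    : Array → ℕ → ℕ
    input  : List ℕ
    output : List ℕ

open State public

infixl 6 _[_↦_]

_[_↦_] : {A : Set} → (ℕ → A) → ℕ → A → ℕ → A
(g [ x ↦ k ]) y = if does (x ≟ y) then k else g y

setReg : State → Register → ℕ → State
setReg σ x k = record σ { reg = reg σ [ x ↦ k ] }

setArr : State → Array → ℕ → ℕ → State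
setArr σ a j k = record σ { arr = arr σ [ a ↦ arr σ a [ j ↦ k ] ] }

infix 4 ⟨_,_⟩⇓[_]_

data ⟨_,_⟩⇓[_]_ : Program → State → ℕ → State → Set where
  ⇓skip   : ∀ {σ} → ⟨ skip , σ ⟩⇓[ 1 ] σ
  ⇓const  : ∀ {σ x k} → ⟨ const x k , σ ⟩⇓[ 1 ] setReg σ x k
  ⇓add    : ∀ {σ x y z} → ⟨ add x y z , σ ⟩⇓[ 1 ] setReg σ x (reg σ y + reg σ z)
  ⇓sub    : ∀ {σ x y z} → ⟨ sub x y z , σ ⟩⇓[ 1 ] setReg σ x (reg σ y ∸ reg σ z)
  ⇓load   : ∀ {σ x a y} → ⟨ load x a y , σ ⟩⇓[ 1 ] setReg σ x (arr σ a (reg σ y))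
  ⇓store  : ∀ {σ a x y} → ⟨ store a x y , σ ⟩⇓[ 1 ] setArr σ a (reg σ x) (reg σ y)
  -- Reading past the end of the input yields 0.
  ⇓read[] : ∀ {ρ m out x} →
            ⟨ read x , state ρ m [] out ⟩⇓[ 1 ] setReg (state ρ m [] out) x 0
  ⇓read∷  : ∀ {ρ m k ks out x} →
            ⟨ read x , state ρ m (k ∷ ks) out ⟩⇓[ 1 ] setReg (state ρ m ks out) x k
  ⇓write  : ∀ {σ x} → ⟨ write x , σ ⟩⇓[ 1 ] record σ { output = output σ ∷ʳ reg σ x }
  ⇓⨾      : ∀ {p q σ σ′ σ″ s t} →
            ⟨ p , σ ⟩⇓[ s ] σ′ → ⟨ q , σ′ ⟩⇓[ t ] σ″ → ⟨ p ⨾ q , σ ⟩⇓[ s + t ] σ″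
  ⇓if≢0   : ∀ {x p q σ σ′ t} → reg σ x ≢ 0 →
            ⟨ p , σ ⟩⇓[ t ] σ′ → ⟨ ifnz x p q , σ ⟩⇓[ suc t ] σ′
  ⇓if≡0   : ∀ {x p q σ σ′ t} → reg σ x ≡ 0 →
            ⟨ q , σ ⟩⇓[ t ] σ′ → ⟨ ifnz x p q , σ ⟩⇓[ suc t ] σ′
  ⇓while≢0 : ∀ {x p σ σ′ σ″ s t} → reg σ x ≢ 0 →
            ⟨ p , σ ⟩⇓[ s ] σ′ → ⟨ whilenz x p , σ′ ⟩⇓[ t ] σ″ →
            ⟨ whilenz x p , σ ⟩⇓[ suc (s + t) ] σ″
  ⇓while≡0 : ∀ {x p σ} → reg σ x ≡ 0 → ⟨ whilenz x p , σ ⟩⇓[ 1 ] σ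

initial : List ℕ → State
initial xs = state (λ _ → 0) (λ _ _ → 0) xs []

Computes : Program → (input output : List ℕ) (time : ℕ) → Set
Computes p xs ys t = ∃[ σ ] ⟨ p , initial xs ⟩⇓[ t ] σ × output σ ≡ ys

record Graph : Set where
  field
    order  : ℕ
    adj    : Fin order → Fin order → Bool
    sym    : ∀ u v → adj u v ≡ adj v u
    irrefl : ∀ v → adj v v ≡ false

open Graph public using (order; adj)

VertexProblem : Set₁
VertexProblem = (G : Graph) → Subset (order G) → Set

DiversityMeasure : ℕ → Set
DiversityMeasure r = (n : ℕ) → (Fin r → Subset n) → ℕ

membershipVector : ∀ {r n} → (Fin r → Subset n) → Fin n → Vec Bool r
membershipVector S v = Vec.tabulate λ i → Vec.lookup (S i) v

venn : ∀ {r} → (Vec Bool r → ℕ) → DiversityMeasure r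
venn f n S = sum (tabulate λ v → f (membershipVector S v))

DiverseProblem : ∀ {r} → DiversityMeasure r → ℕ → (Fin r → VertexProblem) →
                 (G : Graph) → (Fin r → Subset (order G)) → Set
DiverseProblem Div d P G S = (∀ i → P i G (S i)) × Div (order G) S ≥ d

infixl 6 _⊕_

-- Vertices introduced by a decomposition are named by natural numbers.
data CW (ω : ℕ) : Set where
  intro    : (v : ℕ) (a : Fin ω) → CW ω
  _⊕_      : CW ω → CW ω → CW ω
  recolor  : CW ω → (a b : Fin ω) → CW ω
  addEdges : CW ω → (a b : Fin ω) → CW ω

-- Vertex, Colour and Edge together describe the coloured graph built by D.
Vertex : ∀ {ω} → CW ω → ℕ → Set
Vertex (intro u a)      v = v ≡ u
Vertex (D₁ ⊕ D₂)        v = Vertex D₁ v ⊎ Vertex D₂ v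
Vertex (recolor D a b)  v = Vertex D v
Vertex (addEdges D a b) v = Vertex D v

Colour : ∀ {ω} → CW ω → ℕ → Fin ω → Set
Colour (intro u a)      v c = v ≡ u × c ≡ a
Colour (D₁ ⊕ D₂)        v c = Colour D₁ v c ⊎ Colour D₂ v c
Colour (recolor D a b)  v c = (Colour D v c × c ≢ a) ⊎ (Colour D v a × c ≡ b)
Colour (addEdges D a b) v c = Colour D v c

Edge : ∀ {ω} → CW ω → ℕ → ℕ → Set
Edge (intro _ _)      u v = ⊥
Edge (D₁ ⊕ D₂)        u v = Edge D₁ u v ⊎ Edge D₂ u v
Edge (recolor D a b)  u v = Edge D u v
Edge (addEdges D a b) u v =
  Edge D u v ⊎
  (u ≢ v × ((Colour D u a × Colour D v b) ⊎ (Colour D u b × Colour D v a)))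

-- Every ⊕ is a disjoint union, so each vertex has one introducing leaf.
WellFormed : ∀ {ω} → CW ω → Set
WellFormed (intro _ _)      = ⊤
WellFormed (D₁ ⊕ D₂)        =
  WellFormed D₁ × WellFormed D₂ × (∀ v → Vertex D₁ v → ¬ Vertex D₂ v)
WellFormed (recolor D _ _)  = WellFormed D
WellFormed (addEdges D _ _) = WellFormed D

record _DecompositionOf_ {ω} (D : CW ω) (G : Graph) : Set where
  field
    wellFormed : WellFormed D
    name       : Fin (order G) → ℕ
    injective  : Injective _≡_ _≡_ name
    introduced : ∀ v → Vertex D (name v)
    surjective : ∀ x → Vertex D x → ∃[ v ] name v ≡ x
    edges      : ∀ u v → (adj G u v ≡ true) ⇔ Edge D (name u) (name v)

data Node {ω} : CW ω → Set where
  root      : ∀ {D} → Node D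
  inˡ       : ∀ {D₁ D₂} → Node D₁ → Node (D₁ ⊕ D₂)
  inʳ       : ∀ {D₁ D₂} → Node D₂ → Node (D₁ ⊕ D₂)
  inRecolor : ∀ {D a b} → Node D → Node (recolor D a b)
  inAdd     : ∀ {D a b} → Node D → Node (addEdges D a b)

subtree : ∀ {ω} {D : CW ω} → Node D → CW ω
subtree {D = D} root  = D
subtree (inˡ t)       = subtree t
subtree (inʳ t)       = subtree t
subtree (inRecolor t) = subtree t
subtree (inAdd t)     = subtree t

arity : ∀ {ω} → CW ω → ℕ
arity (intro _ _)      = 0
arity (_ ⊕ _)          = 2
arity (recolor _ _ _)  = 1
arity (addEdges _ _ _) = 1

δ : ∀ {ω} {D : CW ω} → Node D → ℕ
δ t = arity (subtree t)

rootChildren : ∀ {ω} (D : CW ω) → Vec (Node D) (arity D)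
rootChildren (intro _ _)      = []
rootChildren (_ ⊕ _)          = inˡ root ∷ inʳ root ∷ []
rootChildren (recolor _ _ _)  = inRecolor root ∷ []
rootChildren (addEdges _ _ _) = inAdd root ∷ []

children : ∀ {ω} {D : CW ω} (t : Node D) → Vec (Node D) (δ t)
children {D = D} root  = rootChildren D
children (inˡ t)       = Vec.map inˡ (children t)
children (inʳ t)       = Vec.map inʳ (children t)
children (inRecolor t) = Vec.map inRecolor (children t)
children (inAdd t)     = Vec.map inAdd (children t)

postorder : ∀ {ω} (D : CW ω) → List (Node D)
postorder (intro _ _)      = [ root ]
postorder (D₁ ⊕ D₂)        = map inˡ (postorder D₁) ++ map inʳ (postorder D₂) ++ [ root ]
postorder (recolor D _ _)  = map inRecolor (postorder D) ++ [ root ]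
postorder (addEdges D _ _) = map inAdd (postorder D) ++ [ root ]

∣V_∣ : ∀ {ω} → CW ω → ℕ
∣V D ∣ = length (postorder D)

leaf : ∀ {ω} (D : CW ω) {v} → Vertex D v → Node D
leaf (intro _ _)      _        = root
leaf (D₁ ⊕ D₂)        (inj₁ p) = inˡ (leaf D₁ p)
leaf (D₁ ⊕ D₂)        (inj₂ p) = inʳ (leaf D₂ p)
leaf (recolor D _ _)  p        = inRecolor (leaf D p)
leaf (addEdges D _ _) p        = inAdd (leaf D p)

leafOf : ∀ {ω} {D : CW ω} {G} → D DecompositionOf G → Fin (order G) → Node D
leafOf {D = D} iso v = leaf D (_DecompositionOf_.introduced iso v)

BitString : Set
BitString = List Bool

bit : Bool → ℕ
bit false = 0
bit true  = 1

-- A string ends with 2 and a set of tuples with 3; the length of the tuples is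
-- known from the node they belong to, so tuples need no delimiter.
encodeString : BitString → List ℕ
encodeString w = map bit w ∷ʳ 2

encodeOp : ∀ {ω} → CW ω → List ℕ
encodeOp (intro v a)      = 0 ∷ v ∷ toℕ a ∷ []
encodeOp (_ ⊕ _)          = 1 ∷ 0 ∷ 0 ∷ []
encodeOp (recolor _ a b)  = 2 ∷ toℕ a ∷ toℕ b ∷ []
encodeOp (addEdges _ a b) = 3 ∷ toℕ a ∷ toℕ b ∷ []

encodeCW : ∀ {ω} → CW ω → List ℕ
encodeCW {ω} D = ∣V D ∣ ∷ ω ∷ concatMap (encodeOp ∘ subtree) (postorder D)

encodeTuples : ∀ {k} → List (Vec BitString k) → List ℕ
encodeTuples ts = concatMap (concatMap encodeString ∘ Vec.toList) ts ∷ʳ 3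

-- The finite sets Accept and Process(t) are listed without repetition, so
-- that their cardinalities are the lengths of the lists. Every element has
-- to be written out, so τ is at least the total length of the data.
record Core : Set where
  field
    program : Program
    Accept  : ∀ {ω} → CW ω → List BitString
    Process : ∀ {ω} (D : CW ω) (t : Node D) → List (Vec BitString (suc (δ t)))
    τ       : ∀ {ω} → CW ω → ℕ
    Accept-unique  : ∀ {ω} (D : CW ω) → WellFormed D → Unique (Accept D)
    Process-unique : ∀ {ω} (D : CW ω) → WellFormed D → ∀ t → Unique (Process D t)
    computes : ∀ {ω} (D : CW ω) → WellFormed D →
      Computes program (encodeCW D)
        (encodeTuples (map Vec.[_] (Accept D)) ++
         concatMap (λ t → encodeTuples (Process D t)) (postorder D))
        (τ D)

open Core public using (Accept; Process; τ)

Size : Core → ∀ {ω} → CW ω → ℕ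
Size C D = max 0 (map (λ t → length (Process C D t)) (postorder D))

record Witness (C : Core) {ω} (D : CW ω) : Set where
  field
    α         : Node D → BitString
    processed : ∀ t → (α t ∷ Vec.map α (children t)) ∈ Process C D t
    accepted  : α root ∈ Accept C D

-- C is monotone for P when some ρ satisfies this.
Solves : Core → (BitString → Bool) → VertexProblem → Set
Solves C ρ P =
  ∀ (G : Graph) {ω} (D : CW ω) (iso : D DecompositionOf G) (S : Subset (order G)) →
  P G S ⇔ (Σ (Witness C D) λ w → ∀ v →
             Vec.lookup S v ≡ ρ (Witness.α w (leafOf iso v)))

-- Deciding a diverse problem involves evaluating ρ on the states of leaves.
-- For an uncomputable ρ the problem can be undecidable, so a running time
-- for ρ has to be assumed.  Linear time keeps all evaluations within O(τ).
LinearTime : (BitString → Bool) → Set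
LinearTime ρ = ∃[ p ] ∃[ c ] ∀ w → ∃[ t ]
  Computes p (encodeString w) [ bit (ρ w) ] t × t ≤ c * suc (length w)

Decides : Program → ∀ {ω} → CW ω → Set → (time : ℕ) → Set
Decides p D A T = ∃[ b ] ∃[ t ]
  Computes p (encodeCW D) [ bit b ] t × t ≤ T × ((b ≡ true) ⇔ A)

timeBound : ∀ {r} → (Fin r → Core) → ∀ {ω} → CW ω → ℕ
timeBound C D =
  sum (tabulate λ i → τ (C i) D) + ∣V D ∣ * product (tabulate λ i → Size (C i) D)

{-# OPTIONS --safe #-}
-- The r cores act like a single core whose tuples are r-tuples of tuples, and
-- every family of witnesses splits at each node into families for the children.
-- So the largest diversity for given states at a node is found bottom up, as the
-- maximum over the combinations of tuples with these states; the diversity is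
-- the sum of f over the leaves because each vertex has exactly one leaf.
--
-- A combination is handled in constant time because a string is turned into a
-- number, and the states of all cores together with the node into a single
-- mixed-radix number that serves as an address. The combinations are formed by
-- adding one core at a time. The partial products met on the way are bounded by
-- the full product only if no set of tuples is empty, so this is tested first; an
-- empty set rules out a witness anyway. Cores and membership functions are run
-- by a simulation with a constant overhead, always on memory not written before.

module Submission where

open import Defs
open import Data.Bool.Base using (Bool; T; _∧_; _∨_; false; if_then_else_; true)
open import Data.Bool.Properties as Bool using ()
open import Data.Fin.Base using (Fin; suc; zero)
open import Data.List.Base using (List; []; [_]; _++_; _∷_; _∷ʳ_; concatMap; length; map; tabulate)
open import Data.List.Extrema.Nat using (xs≤max)
open import Data.List.Membership.Propositional using (_∈_; find; lose)
open import Data.List.Membership.Propositional.Properties using (∈-++⁺ʳ; ∈-++⁺ˡ; ∈-++⁻; ∈-concatMap⁺; ∈-concatMap⁻; ∈-map⁺; ∈-map⁻; ∈-tabulate⁺; ∈-tabulate⁻)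
open import Data.List.Membership.Propositional.Properties.WithK using (unique∧set⇒bag)
open import Data.List.Properties using (++-assoc; ++-identityʳ; concatMap-++; concatMap-map; length-++; length-map; map-++; map-cong; map-tabulate; map-∘; tabulate-cong; ≡-dec)
open import Data.List.Relation.Binary.BagAndSetEquality using (∼bag⇒↭)
open import Data.List.Relation.Binary.Permutation.Propositional using (_↭_)
open import Data.List.Relation.Unary.All as All using (All; []; _∷_)
open import Data.List.Relation.Unary.All.Properties using (map⁺)
open import Data.List.Relation.Unary.AllPairs using ([]; _∷_)
open import Data.List.Relation.Unary.Any using (here; there)
open import Data.List.Relation.Unary.Unique.Propositional using (Unique)
open import Data.Nat.Base
open import Data.Nat.DivMod using ([m+kn]%n≡m%n; _%_; m<n⇒m%n≡m)
open import Data.Nat.ListAction using (product; sum)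
open import Data.Nat.ListAction.Properties using (sum-++; sum-↭)
open import Data.Nat.Properties
open import Data.Nat.Tactic.RingSolver using (solve-∀)
open import Data.Product.Base using (_,_; _×_; proj₁; proj₂; Σ; Σ-syntax; ∃-syntax)
open import Data.Sum.Base using (_⊎_; inj₁; inj₂)
open import Data.Unit.Base using (tt; ⊤)
open import Data.Vec.Base as Vec using (Vec; []; _∷_)
open import Function.Base using (_∘_; case_of_)
open import Function.Bundles using (Equivalence; mk⇔)
open import Relation.Binary.PropositionalEquality hiding ([_])
open import Relation.Nullary using (Dec; contradiction; does; no; yes; ¬_)
open import Relation.Nullary.Decidable using (dec-false; dec-true)
import Data.List.Membership.DecPropositional
import Data.List.Relation.Binary.Permutation.Propositional.Properties as ↭
import Data.List.Relation.Unary.Unique.Propositional.Properties as Unique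
import Data.Vec.Properties as Vec

-- Timed runs

-- The obstacle is to find the cell of a combination of states in constant time on a machine that
-- only adds and subtracts. Address space is spent instead of time: cells have unbounded indices,
-- cost one step and are initially 0, so a sparse table of exponential extent needs no
-- initialisation, and 0 can mean an unreachable value. A digit has to hold the code of any string
-- of the cores. All these strings occur in the outputs, of total length `L`, so `2 ^ L` is a
-- sufficient radix, and `L` doublings per core produce it within the time that writing the outputs
-- took. Since the share of each core in an address is additive, combining tuples is addition of
-- entries, and a string is never looked at again once it has been parsed. Nodes are numbered from
-- 1, which leaves cell 0 for missing children; it is preset to 1, the table value of diversity 0,
-- so that leaves, unary nodes and unions pass through the same instructions. Proofs about the
-- machine stay short because the frame of a program is computed from its text, which makes most
-- preservation claims `refl`.

record Run (p : Program) (σ : State) (T : ℕ) (Q : State → Set) : Set where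
  constructor ran
  field
    {final} : State
    {time}  : ℕ
    exec    : ⟨ p , σ ⟩⇓[ time ] final
    within  : time ≤ T
    post    : Q final

weaken : ∀ {p σ S T Q} → S ≤ T → Run p σ S Q → Run p σ T Q
weaken S≤T (ran e t q) = ran e (≤-trans t S≤T) q

infixl 4 _⟫_

_⟫_ : ∀ {p σ T} {Q R : State → Set} → Run p σ T Q → (∀ {σ′} → Q σ′ → R σ′) → Run p σ T R
ran e t q ⟫ f = ran e t (f q)

infixr 3 _▷_

_▷_ : ∀ {p q σ S T} {Q R : State → Set} →
      Run p σ S Q → (∀ {σ′} → Q σ′ → Run q σ′ T R) → Run (p ⨾ q) σ (S + T) R
ran e s x ▷ k with k x
... | ran e′ t y = ran (⇓⨾ e e′) (+-mono-≤ s t) y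

ifNonzero : ∀ {x p q σ T Q} → reg σ x ≢ 0 → Run p σ T Q → Run (ifnz x p q) σ (suc T) Q
ifNonzero ≢0 (ran e t q) = ran (⇓if≢0 ≢0 e) (s≤s t) q

ifZero : ∀ {x p q σ T Q} → reg σ x ≡ 0 → Run q σ T Q → Run (ifnz x p q) σ (suc T) Q
ifZero ≡0 (ran e t q) = ran (⇓if≡0 ≡0 e) (s≤s t) q

whileEnd : ∀ {x p σ} {Q : State → Set} → reg σ x ≡ 0 → Q σ → Run (whilenz x p) σ 1 Q
whileEnd ≡0 q = ran (⇓while≡0 ≡0) ≤-refl q

whileStep : ∀ {x p σ S T} {Q R : State → Set} → reg σ x ≢ 0 → Run p σ S Q →
            (∀ {σ′} → Q σ′ → Run (whilenz x p) σ′ T R) → Run (whilenz x p) σ (suc (S + T)) R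
whileStep ≢0 (ran e s x) k with k x
... | ran e′ t y = ran (⇓while≢0 ≢0 e e′) (s≤s (+-mono-≤ s t)) y

-- A Boolean, so that the side condition for a concrete program is `refl` and its final state is
-- found by evaluation. `read` is excluded because its effect depends on the form of the input list.
straight : Program → Bool
straight (read x)      = false
straight (p ⨾ q)       = straight p ∧ straight q
straight (ifnz _ _ _)  = false
straight (whilenz _ _) = false
straight _             = true

-- Meaningful for straight-line programs only.
⟦_⟧ : Program → State → State
⟦ const x k ⟧ σ   = setReg σ x k
⟦ add x y z ⟧ σ   = setReg σ x (reg σ y + reg σ z)
⟦ sub x y z ⟧ σ   = setReg σ x (reg σ y ∸ reg σ z)
⟦ load x a y ⟧ σ  = setReg σ x (arr σ a (reg σ y))
⟦ store a x y ⟧ σ = setArr σ a (reg σ x) (reg σ y)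
⟦ write x ⟧ σ     = record σ { output = output σ ∷ʳ reg σ x }
⟦ p ⨾ q ⟧ σ       = ⟦ q ⟧ (⟦ p ⟧ σ)
⟦ _ ⟧ σ           = σ

steps : Program → ℕ
steps (p ⨾ q) = steps p + steps q
steps _       = 1

straight-⇓ : ∀ p {σ} → straight p ≡ true → ⟨ p , σ ⟩⇓[ steps p ] ⟦ p ⟧ σ
straight-⇓ skip          _ = ⇓skip
straight-⇓ (const x k)   _ = ⇓const
straight-⇓ (add x y z)   _ = ⇓add
straight-⇓ (sub x y z)   _ = ⇓sub
straight-⇓ (load x a y)  _ = ⇓load
straight-⇓ (store a x y) _ = ⇓store
straight-⇓ (write x)     _ = ⇓write
straight-⇓ (p ⨾ q)       s with straight p in eq
... | true = ⇓⨾ (straight-⇓ p eq) (straight-⇓ q s)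

block : ∀ p {σ} {Q : State → Set} → straight p ≡ true → Q (⟦ p ⟧ σ) → Run p σ (steps p) Q
block p s q = ran (straight-⇓ p s) ≤-refl q

infixr 3 _,_▸_

_,_▸_ : ∀ p {q σ T R} → straight p ≡ true → Run q (⟦ p ⟧ σ) T R → Run (p ⨾ q) σ (steps p + T) R
p , s ▸ ran e t y = ran (⇓⨾ (straight-⇓ p s) e) (+-monoʳ-≤ (steps p) t) y

-- Frames

-- A syntactic over-approximation of the changes. It evaluates on concrete programs, and `frame`
-- turns it into facts about runs, so loop invariants need not list what stays fixed.
writesReg : Program → Register → Bool
writesReg (const y _)   x = does (y ≟ x)
writesReg (add y _ _)   x = does (y ≟ x)
writesReg (sub y _ _)   x = does (y ≟ x)
writesReg (load y _ _)  x = does (y ≟ x)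
writesReg (read y)      x = does (y ≟ x)
writesReg (p ⨾ q)       x = writesReg p x ∨ writesReg q x
writesReg (ifnz _ p q)  x = writesReg p x ∨ writesReg q x
writesReg (whilenz _ p) x = writesReg p x
writesReg _             x = false

writesArr : Program → Array → Bool
writesArr (store b _ _) a = does (b ≟ a)
writesArr (p ⨾ q)       a = writesArr p a ∨ writesArr q a
writesArr (ifnz _ p q)  a = writesArr p a ∨ writesArr q a
writesArr (whilenz _ p) a = writesArr p a
writesArr _             a = false

writes : Program → Bool
writes (write _)     = true
writes (p ⨾ q)       = writes p ∨ writes q
writes (ifnz _ p q)  = writes p ∨ writes q
writes (whilenz _ p) = writes p
writes _             = false

record Frame (p : Program) (σ σ′ : State) : Set where
  field
    regs : ∀ x → writesReg p x ≡ false → reg σ′ x ≡ reg σ x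
    arrs : ∀ a → writesArr p a ≡ false → arr σ′ a ≡ arr σ a
    out  : writes p ≡ false → output σ′ ≡ output σ

open Frame public

∨-false : ∀ {a b} → a ∨ b ≡ false → a ≡ false × b ≡ false
∨-false {false} eq = refl , eq

update-unread : ∀ {A : Set} (g : ℕ → A) x {y k} → does (x ≟ y) ≡ false → (g [ x ↦ k ]) y ≡ g y
update-unread g x eq rewrite eq = refl

frame : ∀ {p σ t σ′} → ⟨ p , σ ⟩⇓[ t ] σ′ → Frame p σ σ′
frame {σ = σ} e = record { regs = λ x → r e {x} ; arrs = λ a → m e {a} ; out = o e }
  where
  r : ∀ {p σ t σ′} → ⟨ p , σ ⟩⇓[ t ] σ′ → ∀ {x} → writesReg p x ≡ false → reg σ′ x ≡ reg σ x
  r ⇓skip _ = refl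
  r (⇓const {σ} {x}) n = update-unread (reg σ) x n
  r (⇓add {σ} {x}) n = update-unread (reg σ) x n
  r (⇓sub {σ} {x}) n = update-unread (reg σ) x n
  r (⇓load {σ} {x}) n = update-unread (reg σ) x n
  r ⇓store _ = refl
  r (⇓read[] {ρ} {x = x}) n = update-unread ρ x n
  r (⇓read∷ {ρ} {x = x}) n = update-unread ρ x n
  r ⇓write _ = refl
  r (⇓⨾ e f) n = trans (r f (proj₂ (∨-false n))) (r e (proj₁ (∨-false n)))
  r (⇓if≢0 _ e) n = r e (proj₁ (∨-false n))
  r (⇓if≡0 {p = p} _ e) {x} n = r e (proj₂ (∨-false {writesReg p x} n))
  r (⇓while≢0 _ e f) n = trans (r f n) (r e n)
  r (⇓while≡0 _) _ = refl

  m : ∀ {p σ t σ′} → ⟨ p , σ ⟩⇓[ t ] σ′ → ∀ {a} → writesArr p a ≡ false → arr σ′ a ≡ arr σ a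
  m ⇓skip _ = refl
  m ⇓const _ = refl
  m ⇓add _ = refl
  m ⇓sub _ = refl
  m ⇓load _ = refl
  m (⇓store {σ} {a}) n = update-unread (arr σ) a n
  m ⇓read[] _ = refl
  m ⇓read∷ _ = refl
  m ⇓write _ = refl
  m (⇓⨾ e f) n = trans (m f (proj₂ (∨-false n))) (m e (proj₁ (∨-false n)))
  m (⇓if≢0 _ e) n = m e (proj₁ (∨-false n))
  m (⇓if≡0 {p = p} _ e) {x} n = m e (proj₂ (∨-false {writesArr p x} n))
  m (⇓while≢0 _ e f) n = trans (m f n) (m e n)
  m (⇓while≡0 _) _ = refl

  o : ∀ {p σ t σ′} → ⟨ p , σ ⟩⇓[ t ] σ′ → writes p ≡ false → output σ′ ≡ output σ
  o ⇓skip _ = refl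
  o ⇓const _ = refl
  o ⇓add _ = refl
  o ⇓sub _ = refl
  o ⇓load _ = refl
  o ⇓store _ = refl
  o ⇓read[] _ = refl
  o ⇓read∷ _ = refl
  o (⇓⨾ e f) n = trans (o f (proj₂ (∨-false n))) (o e (proj₁ (∨-false n)))
  o (⇓if≢0 _ e) n = o e (proj₁ (∨-false n))
  o (⇓if≡0 {p = p} _ e) n = o e (proj₂ (∨-false {writes p} n))
  o (⇓while≢0 _ e f) n = trans (o f n) (o e n)
  o (⇓while≡0 _) _ = refl

framed : ∀ {p σ T Q} → Run p σ T Q → Run p σ T (λ σ′ → Q σ′ × Frame p σ σ′)
framed (ran e t q) = ran e t (q , frame e)

update-same : ∀ {A : Set} (g : ℕ → A) x {k} → (g [ x ↦ k ]) x ≡ k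
update-same g x rewrite dec-true (x ≟ x) refl = refl

update-other : ∀ {A : Set} (g : ℕ → A) {x y k} → x ≢ y → (g [ x ↦ k ]) y ≡ g y
update-other g {x} {y} x≢y = update-unread g x (dec-false (x ≟ y) x≢y)

-- Segments of memory

Seg : (ℕ → ℕ) → ℕ → List ℕ → Set
Seg f p []       = ⊤
Seg f p (x ∷ xs) = f p ≡ x × Seg f (suc p) xs

infix 4 _≈[_]_

-- With `w` the end of the log, this relation says that the log has at most been appended to.
_≈[_]_ : (ℕ → ℕ) → ℕ → (ℕ → ℕ) → Set
f ≈[ w ] g = ∀ j → j < w → g j ≡ f j

≈-trans : ∀ {f g h w w′} → f ≈[ w ] g → g ≈[ w′ ] h → w ≤ w′ → f ≈[ w ] h
≈-trans p q w≤w′ j j<w = trans (q j (<-≤-trans j<w w≤w′)) (p j j<w)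

≈-update : ∀ {f w j k} → w ≤ j → f ≈[ w ] f [ j ↦ k ]
≈-update {f} w≤j i i<w = update-other f (>⇒≢ (<-≤-trans i<w w≤j))

Seg-cong : ∀ {f g} xs {p} → (∀ j → j < p + length xs → p ≤ j → g j ≡ f j) → Seg f p xs → Seg g p xs
Seg-cong []       _ _ = tt
Seg-cong (x ∷ xs) {p} eq (h , s) =
  trans (eq p (m<m+n p (s≤s z≤n)) ≤-refl) h ,
  Seg-cong xs (λ j lt le → eq j (subst (j <_) (sym (+-suc p (length xs))) lt) (<⇒≤ le)) s

Seg-≈ : ∀ {f g w} xs {p} → f ≈[ w ] g → p + length xs ≤ w → Seg f p xs → Seg g p xs
Seg-≈ xs eq le = Seg-cong xs (λ j lt _ → eq j (<-≤-trans lt le))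

Seg-++⁺ : ∀ {f} xs {ys p} → Seg f p xs → Seg f (p + length xs) ys → Seg f p (xs ++ ys)
Seg-++⁺ {f} [] {ys} {p} _ t = subst (λ q → Seg f q ys) (+-identityʳ p) t
Seg-++⁺ {f} (x ∷ xs) {ys} {p} (h , s) t =
  h , Seg-++⁺ xs s (subst (λ q → Seg f q ys) (+-suc p (length xs)) t)

Seg-++ˡ : ∀ {f} xs {ys p} → Seg f p (xs ++ ys) → Seg f p xs
Seg-++ˡ []       _       = tt
Seg-++ˡ (x ∷ xs) (h , s) = h , Seg-++ˡ xs s

Seg-++ʳ : ∀ {f} xs {ys p} → Seg f p (xs ++ ys) → Seg f (p + length xs) ys
Seg-++ʳ {f} [] {ys} {p} s = subst (λ q → Seg f q ys) (sym (+-identityʳ p)) s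
Seg-++ʳ {f} (x ∷ xs) {ys} {p} (_ , s) =
  subst (λ q → Seg f q ys) (sym (+-suc p (length xs))) (Seg-++ʳ xs s)

Seg-snoc : ∀ {f w} xs {p k} → p + length xs ≡ w → Seg f p xs → Seg (f [ w ↦ k ]) p (xs ∷ʳ k)
Seg-snoc {f} {w} xs {p} {k} eq s =
  Seg-++⁺ xs (Seg-≈ xs (≈-update ≤-refl) (≤-reflexive eq) s)
             (trans (cong (f [ w ↦ k ]) eq) (update-same f w) , tt)

-- Simulation of arbitrary programs

module Reg where
  t v u rp rem wp off lim : Register
  t = 0
  v = 1
  u = 2
  rp = 3
  rem = 4
  wp = 5
  off = 6
  lim = 7

open Reg

inc : Register → Program
inc x = const Reg.t 1 ⨾ add x Reg.t x

dec : Register → Program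
dec x = const Reg.t 1 ⨾ sub x x Reg.t

move : Register → Register → Program
move x y = const x 0 ⨾ add x x y

-- Memory cell j of a simulated program lives at address j + off, and no
-- address from lim on has been written: setting off to lim gives blank memory.
-- The simulated registers are array 8, the simulated array a is array 9 + a.
fetch : Register → Register → Program
fetch y x = const t x ⨾ add t t off ⨾ load y 8 t

-- The sum of `lim` and the address in `t` serves instead of their maximum: one addition and one
-- increment give a limit above both.
reserve : Program
reserve = add lim lim t ⨾ inc lim

putV : Register → Program
putV x = const t x ⨾ add t t off ⨾ store 8 t v ⨾ reserve

sim : Program → Program
sim skip          = skip
sim (const x k)   = const v k ⨾ putV x
sim (add x y z)   = (fetch v y ⨾ fetch u z ⨾ add v v u) ⨾ putV x
sim (sub x y z)   = (fetch v y ⨾ fetch u z ⨾ sub v v u) ⨾ putV x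
sim (load x a y)  = (fetch v y ⨾ add v v off ⨾ load v (9 + a) v) ⨾ putV x
sim (store a x y) = fetch u x ⨾ fetch v y ⨾ add t u off ⨾ store (9 + a) t v ⨾ reserve
sim (read x)      = ifnz rem (load v 0 rp ⨾ inc rp ⨾ dec rem) (const v 0) ⨾ putV x
sim (write x)     = fetch v x ⨾ store 0 wp v ⨾ inc wp
sim (p ⨾ q)       = sim p ⨾ sim q
sim (ifnz x p q)  = fetch v x ⨾ ifnz v (sim p) (sim q)
sim (whilenz x p) = fetch v x ⨾ whilenz v (sim p ⨾ fetch v x)

-- Treats the registers as array 0, so that one invariant covers simulated registers and simulated
-- arrays.
memory : State → ℕ → ℕ → ℕ
memory τ zero    = reg τ
memory τ (suc a) = arr τ a

-- `f₀` and `w₀` are the log and its end at the start of the simulated run. The input lies below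
-- `w₀` and the output grows from `w₀` on, so writing never destroys input that is still to be read.
record Sim (f₀ : ℕ → ℕ) (w₀ : ℕ) (τ σ : State) : Set where
  constructor mkSim
  field
    mem    : ∀ a j → arr σ (8 + a) (j + reg σ off) ≡ memory τ a j
    clean  : ∀ a j → reg σ lim ≤ j → arr σ (8 + a) j ≡ 0
    inSeg  : Seg f₀ (reg σ rp) (input τ)
    inLen  : reg σ rem ≡ length (input τ)
    inOld  : reg σ rp + length (input τ) ≤ w₀
    old    : f₀ ≈[ w₀ ] arr σ 0
    outSeg : Seg (arr σ 0) w₀ (output τ)
    outLen : w₀ + length (output τ) ≡ reg σ wp

memory-put : (M : ℕ → ℕ → ℕ) (o A j k : ℕ) {V : ℕ → ℕ → ℕ} →
             (∀ a i → M (8 + a) (i + o) ≡ V a i) →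
             ∀ a i → (M [ 8 + A ↦ M (8 + A) [ j + o ↦ k ] ]) (8 + a) (i + o) ≡ (V [ A ↦ V A [ j ↦ k ] ]) a i
memory-put M o A j k {V} h a i with A ≟ a
... | no A≢a rewrite dec-false (8 + A ≟ 8 + a) (A≢a ∘ +-cancelˡ-≡ 8 A a) = h a i
... | yes refl rewrite dec-true (8 + A ≟ 8 + A) refl with j ≟ i
...   | yes refl rewrite dec-true (j + o ≟ j + o) refl | dec-true (j ≟ j) refl = refl
...   | no j≢i rewrite dec-false (j + o ≟ i + o) (j≢i ∘ +-cancelʳ-≡ o j i) | dec-false (j ≟ i) j≢i = h A i

clean-put : (M : ℕ → ℕ → ℕ) (L A j k : ℕ) → (∀ a i → L ≤ i → M (8 + a) i ≡ 0) →
            ∀ a i → suc (L + j) ≤ i → (M [ 8 + A ↦ M (8 + A) [ j ↦ k ] ]) (8 + a) i ≡ 0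
clean-put M L A j k h a i le with A ≟ a
... | no A≢a rewrite dec-false (8 + A ≟ 8 + a) (A≢a ∘ +-cancelˡ-≡ 8 A a) = h a i (≤-trans (m≤n⇒m≤1+n (m≤m+n L j)) le)
... | yes refl rewrite dec-true (8 + A ≟ 8 + A) refl
                     | dec-false (j ≟ i) (<⇒≢ (≤-trans (s≤s (m≤n+m j L)) le)) =
  h A i (≤-trans (m≤n⇒m≤1+n (m≤m+n L j)) le)

module _ {f₀ : ℕ → ℕ} {w₀ : ℕ} where

  private
    Rel = Sim f₀ w₀

  Sim-fetchV : ∀ {τ σ} x → Rel τ σ →
               Rel τ (⟦ fetch v x ⟧ σ) × reg (⟦ fetch v x ⟧ σ) v ≡ reg τ x
  Sim-fetchV {τ} {σ} x s = mkSim mem clean inSeg inLen inOld old outSeg outLen , mem 0 x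
    where open Sim s

  Sim-putV : ∀ {τ σ} x → Rel τ σ → Rel (setReg τ x (reg σ v)) (⟦ putV x ⟧ σ)
  Sim-putV {τ} {σ} x s = mkSim mem′
      (clean-put (arr σ) (reg σ lim) 0 (x + reg σ off) (reg σ v) clean)
      inSeg inLen inOld old outSeg outLen
    where
    open Sim s
    mem′ : ∀ a j → arr (⟦ putV x ⟧ σ) (8 + a) (j + reg σ off) ≡ memory (setReg τ x (reg σ v)) a j
    mem′ zero    j = memory-put (arr σ) (reg σ off) 0 x (reg σ v) {memory τ} mem 0 j
    mem′ (suc a) j = mem (suc a) j

  putV-run : ∀ {τ σ} x {k} → Rel τ σ × reg σ v ≡ k → Run (putV x) σ 6 (Rel (setReg τ x k))
  putV-run x (s , refl) = block (putV x) refl (Sim-putV x s)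

  Sim-setV : ∀ {τ σ} p → straight p ≡ true →
             reg (⟦ p ⟧ σ) off ≡ reg σ off → reg (⟦ p ⟧ σ) lim ≡ reg σ lim →
             reg (⟦ p ⟧ σ) rp ≡ reg σ rp → reg (⟦ p ⟧ σ) rem ≡ reg σ rem →
             reg (⟦ p ⟧ σ) wp ≡ reg σ wp → arr (⟦ p ⟧ σ) ≡ arr σ →
             Rel τ σ → ∀ x {k} → reg (⟦ p ⟧ σ) v ≡ k →
             Run (p ⨾ putV x) σ (steps p + 6) (Rel (setReg τ x k))
  Sim-setV {τ} {σ} p st o l r m w a s x {k} refl =
    p , st ▸ block (putV x) refl (Sim-putV x (keep a o l r m w))
    where
    open Sim s
    σ′ = ⟦ p ⟧ σ
    keep : arr σ′ ≡ arr σ → reg σ′ off ≡ reg σ off → reg σ′ lim ≡ reg σ lim → reg σ′ rp ≡ reg σ rp →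
           reg σ′ rem ≡ reg σ rem → reg σ′ wp ≡ reg σ wp → Rel τ σ′
    keep a o l r m w = mkSim
      (λ b j → trans (cong₂ (λ g i → g (8 + b) (j + i)) a o) (mem b j))
      (λ b j le → trans (cong (λ g → g (8 + b) j) a) (clean b j (subst (_≤ j) l le)))
      (subst (λ i → Seg f₀ i (input τ)) (sym r) inSeg)
      (trans m inLen)
      (subst (λ i → i + length (input τ) ≤ w₀) (sym r) inOld)
      (λ j lt → trans (cong (λ g → g 0 j) a) (old j lt))
      (subst (λ g → Seg (g 0) w₀ (output τ)) (sym a) outSeg)
      (trans outLen (sym w))

  -- A simulated loop tests the register that its body ends by fetching.
  sim-correct : ∀ {p τ t τ′} → ⟨ p , τ ⟩⇓[ t ] τ′ → ∀ {σ} → Rel τ σ → Run (sim p) σ (20 * t) (Rel τ′)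
  -- The slack of 10 pays for the fetch in front of the loop. The factor 20 leaves room for it: the
  -- costliest single instruction is simulated in 13 steps.
  sim-loop : ∀ {x p τ t τ′} → ⟨ whilenz x p , τ ⟩⇓[ t ] τ′ → ∀ {σ} → Rel τ σ → reg σ v ≡ reg τ x →
             ∃[ T ] Run (whilenz v (sim p ⨾ fetch v x)) σ T (Rel τ′) × T + 10 ≤ 20 * t

  sim-correct ⇓skip s = weaken (s≤s z≤n) (block skip refl s)
  sim-correct (⇓const {x = x} {k}) s =
    weaken (m≤m+n _ 13) (Sim-setV (const v k) refl refl refl refl refl refl refl s x refl)
  sim-correct (⇓add {x = x} {y} {z}) s =
    weaken (m≤m+n _ 7) (Sim-setV (fetch v y ⨾ fetch u z ⨾ add v v u) refl refl refl refl refl refl refl s x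
      (cong₂ _+_ (mem 0 y) (mem 0 z)))
    where open Sim s
  sim-correct (⇓sub {x = x} {y} {z}) s =
    weaken (m≤m+n _ 7) (Sim-setV (fetch v y ⨾ fetch u z ⨾ sub v v u) refl refl refl refl refl refl refl s x
      (cong₂ _∸_ (mem 0 y) (mem 0 z)))
    where open Sim s
  sim-correct (⇓load {σ = τ} {x = x} {a} {y}) {σ} s =
    weaken (m≤m+n _ 9) (Sim-setV (fetch v y ⨾ add v v off ⨾ load v (9 + a) v)
      refl refl refl refl refl refl refl s x
      (trans (cong (λ i → arr σ (9 + a) (i + reg σ off)) (mem 0 y)) (mem (suc a) (reg τ y))))
    where open Sim s
  sim-correct (⇓store {σ = τ} {a} {x} {y}) {σ} s =
    weaken (m≤m+n _ 9) (block (sim (store a x y)) refl (mkSim mem′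
      (clean-put (arr σ) (reg σ lim) (suc a) (X + reg σ off) Y clean)
      inSeg inLen inOld old outSeg outLen))
    where
    open Sim s
    X = arr σ 8 (x + reg σ off)
    Y = arr σ 8 (y + reg σ off)
    mem′ : ∀ b j → (arr σ [ 9 + a ↦ arr σ (9 + a) [ X + reg σ off ↦ Y ] ]) (8 + b) (j + reg σ off)
                   ≡ memory (setArr τ a (reg τ x) (reg τ y)) b j
    mem′ b j rewrite mem 0 x | mem 0 y with b
    ... | zero  = mem 0 j
    ... | suc b = memory-put (arr σ) (reg σ off) (suc a) (reg τ x) (reg τ y) {memory τ} mem (suc b) j
  sim-correct (⇓read[] {ρ} {m} {o} {x}) {σ} s =
    weaken (m≤m+n _ 12) (
      _▷_ {Q = λ σ′ → Rel (state ρ m [] o) σ′ × reg σ′ v ≡ 0}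
      (ifZero (Sim.inLen s) (block (const v 0) refl (mkSim mem clean inSeg inLen inOld old outSeg outLen , refl)))
      (putV-run x))
    where open Sim s
  sim-correct (⇓read∷ {ρ} {m} {k} {ks} {o} {x}) {σ} s =
    weaken (m≤m+n _ 8) (
      _▷_ {Q = λ σ′ → Rel (state ρ m ks o) σ′ × reg σ′ v ≡ k}
      (ifNonzero (λ z → case trans (sym z) inLen of λ ())
        (block (load v 0 rp ⨾ inc rp ⨾ dec rem) refl (mkSim (λ { zero → mem 0 ; (suc a) → mem (suc a) }) clean
          (proj₂ inSeg) (cong (_∸ 1) inLen) (subst (_≤ w₀) (+-suc (reg σ rp) (length ks)) inOld)
          old outSeg outLen , trans (old (reg σ rp) (<-≤-trans (m<m+n (reg σ rp) (s≤s z≤n)) inOld)) (proj₁ inSeg))))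
      (putV-run x))
    where open Sim s
  sim-correct (⇓write {τ} {x}) {σ} s =
    weaken (m≤m+n _ 14) (block (sim (write x)) refl
      (mkSim (λ { zero → mem 0 ; (suc a) → mem (suc a) }) clean inSeg inLen inOld
        (≈-trans {f₀} {arr σ 0} old (≈-update {arr σ 0} ≤-refl) (subst (w₀ ≤_) outLen (m≤m+n w₀ (length (output τ)))))
        (subst (λ k → Seg (arr σ 0 [ reg σ wp ↦ _ ]) w₀ (output τ ∷ʳ k)) (mem 0 x) (Seg-snoc (output τ) outLen outSeg))
        (trans (cong (w₀ +_) (trans (length-++ (output τ)) (+-comm (length (output τ)) 1)))
               (trans (+-suc w₀ _) (cong suc outLen)))))
    where open Sim s
  sim-correct (⇓⨾ {s = a} {b} e f) s =
    weaken (≤-reflexive (sym (*-distribˡ-+ 20 a b))) (sim-correct e s ▷ λ s′ → sim-correct f s′)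
  sim-correct (⇓if≢0 {x} {t = t} ≢0 e) s =
    weaken (≤-trans (m≤m+n _ 16) (≤-reflexive (lemma t))) (fetch v x , refl ▸
      ifNonzero (≢0 ∘ trans (sym (proj₂ (Sim-fetchV x s)))) (sim-correct e (proj₁ (Sim-fetchV x s))))
    where
    lemma : ∀ t → (3 + (1 + (20 * t))) + 16 ≡ 20 * (1 + t)
    lemma = solve-∀
  sim-correct (⇓if≡0 {x} {t = t} ≡0 e) s =
    weaken (≤-trans (m≤m+n _ 16) (≤-reflexive (lemma t))) (fetch v x , refl ▸
      ifZero (trans (proj₂ (Sim-fetchV x s)) ≡0) (sim-correct e (proj₁ (Sim-fetchV x s))))
    where
    lemma : ∀ t → (3 + (1 + (20 * t))) + 16 ≡ 20 * (1 + t)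
    lemma = solve-∀
  sim-correct {whilenz x p} {t = t} e@(⇓while≢0 _ _ _) s
    with T , r , le ← sim-loop e (proj₁ (Sim-fetchV x s)) (proj₂ (Sim-fetchV x s)) =
    weaken (≤-trans (+-monoˡ-≤ T {3} {10} (m≤m+n 3 7)) (≤-trans (≤-reflexive (+-comm 10 T)) le)) (fetch v x , refl ▸ r)
  sim-correct {whilenz x p} e@(⇓while≡0 _) s
    with T , r , le ← sim-loop e (proj₁ (Sim-fetchV x s)) (proj₂ (Sim-fetchV x s)) =
    weaken (≤-trans (+-monoˡ-≤ T {3} {10} (m≤m+n 3 7)) (≤-trans (≤-reflexive (+-comm 10 T)) le)) (fetch v x , refl ▸ r)

  sim-loop {x} (⇓while≢0 {s = a} {t = b} ≢0 e f) {σ} s eq with sim-correct e s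
  ... | ran {σ₁} {t₁} e₁ le₁ s₁ with sim-loop f (proj₁ (Sim-fetchV x s₁)) (proj₂ (Sim-fetchV x s₁))
  ...   | T , ran e₂ le₂ s₂ , le = _ ,
    ran (⇓while≢0 (≢0 ∘ trans (sym eq)) (⇓⨾ e₁ (straight-⇓ (fetch v x) refl)) e₂)
        (s≤s (+-mono-≤ (+-monoˡ-≤ 3 le₁) le₂)) s₂ ,
    (begin
      suc ((20 * a + 3) + T) + 10     ≡⟨ lemma₁ (20 * a) T ⟩
      suc ((20 * a + 3) + (T + 10))   ≤⟨ s≤s (+-monoʳ-≤ (20 * a + 3) le) ⟩
      suc ((20 * a + 3) + 20 * b)     ≤⟨ m≤m+n _ 16 ⟩
      suc ((20 * a + 3) + 20 * b) + 16 ≡⟨ lemma₂ a b ⟩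
      20 * suc (a + b)                ∎)
    where
    open ≤-Reasoning
    lemma₁ : ∀ A T → (1 + ((A + 3) + T)) + 10 ≡ (1 + ((A + 3) + (T + 10)))
    lemma₁ = solve-∀
    lemma₂ : ∀ a b → (1 + ((20 * a + 3) + 20 * b)) + 16 ≡ 20 * (1 + (a + b))
    lemma₂ = solve-∀
  sim-loop (⇓while≡0 ≡0) s eq = 1 , whileEnd (trans eq ≡0) s , m≤m+n 11 9

branch : ∀ {x p q σ T Q} → (reg σ x ≢ 0 → Run p σ T Q) → (reg σ x ≡ 0 → Run q σ T Q) →
         Run (ifnz x p q) σ (suc T) Q
branch {x} {σ = σ} f g with reg σ x in eq
... | zero  = ifZero eq (g refl)
... | suc _ = ifNonzero (λ z → 1+n≢0 (trans (sym eq) z)) (f λ ())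

-- Blank memory and the append-only log

Clean : State → Set
Clean σ = ∀ a j → reg σ lim ≤ j → arr σ (8 + a) j ≡ 0

Clean-frame : ∀ {p σ σ′} → Frame p σ σ′ → writesReg p lim ≡ false → (∀ a → writesArr p (8 + a) ≡ false) →
              Clean σ → Clean σ′
Clean-frame fr l a c b j le =
  trans (cong (λ g → g j) (arrs fr (8 + b) (a b))) (c b j (subst (_≤ j) (regs fr lim l) le))

io : State → ℕ → ℕ
io σ = arr σ 0

-- The contract of everything that appends to the log. As the old part is kept, segments located
-- earlier remain readable at their addresses.
record Grew (xs : List ℕ) (σ σ′ : State) : Set where
  constructor grew
  field
    kept : io σ ≈[ reg σ wp ] io σ′
    new  : Seg (io σ′) (reg σ wp) xs
    end  : reg σ′ wp ≡ reg σ wp + length xs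

Grew-trans : ∀ {xs ys σ σ₁ σ₂} → Grew xs σ σ₁ → Grew ys σ₁ σ₂ → Grew (xs ++ ys) σ σ₂
Grew-trans {xs} {ys} {σ} {σ₁} {σ₂} (grew k n e) (grew k′ n′ e′) = grew
  (≈-trans {io σ} {io σ₁} k k′ (subst (reg σ wp ≤_) (sym e) (m≤m+n _ _)))
  (Seg-++⁺ xs (Seg-≈ xs k′ (≤-reflexive (sym e)) n) (subst (λ w → Seg (io σ₂) w ys) e n′))
  (trans e′ (trans (cong (_+ length ys) e)
    (trans (+-assoc (reg σ wp) _ _) (cong (reg σ wp +_) (sym (length-++ xs))))))

Grew-seg : ∀ {xs σ σ′} → Grew xs σ σ′ → ∀ ys {p} → p + length ys ≤ reg σ wp → Seg (io σ) p ys → Seg (io σ′) p ys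
Grew-seg (grew k _ _) ys le = Seg-≈ ys k le

Grew-≤ : ∀ {xs σ σ′} → Grew xs σ σ′ → reg σ wp ≤ reg σ′ wp
Grew-≤ (grew _ _ e) = subst (_ ≤_) (sym e) (m≤m+n _ _)

-- Unfolds to the nested updates that a block of `push` instructions evaluates to, so the effect of
-- such a block on the log is a `refl`.
put : (ℕ → ℕ) → ℕ → List ℕ → ℕ → ℕ
put f w []       = f
put f w (x ∷ xs) = put (f [ w ↦ x ]) (suc w) xs

put-≈ : ∀ xs {f} w {w′} → w′ ≤ w → f ≈[ w′ ] put f w xs
put-≈ []       w le = λ _ _ → refl
put-≈ (x ∷ xs) {f} w le = ≈-trans {f} {f [ w ↦ x ]} (≈-update le) (put-≈ xs (suc w) (m≤n⇒m≤1+n le)) ≤-refl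

put-Seg : ∀ xs {f} w → Seg (put f w xs) w xs
put-Seg []       w = tt
put-Seg (x ∷ xs) {f} w =
  trans (put-≈ xs {f [ w ↦ x ]} (suc w) ≤-refl w ≤-refl) (update-same f w) , put-Seg xs (suc w)

-- Calls of simulated programs

-- The simulation works in the registers 0 to 7 whatever the program, so everything kept from
-- register 8 on survives a call.
sim-reg : ∀ p x → writesReg (sim p) (8 + x) ≡ false
sim-reg skip           x = refl
sim-reg (const _ _)    x = refl
sim-reg (add _ _ _)    x = refl
sim-reg (sub _ _ _)    x = refl
sim-reg (load _ _ _)   x = refl
sim-reg (store _ _ _)  x = refl
sim-reg (read _)       x = refl
sim-reg (write _)      x = refl
sim-reg (p ⨾ q)        x rewrite sim-reg p x = sim-reg q x
sim-reg (ifnz _ p q)   x rewrite sim-reg p x = sim-reg q x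
sim-reg (whilenz _ p)  x rewrite sim-reg p x = refl

-- A simulated program touches only the log, which is array 0, and arrays from 8 on. With a variable
-- index the comparison does not evaluate, hence the enumeration of the seven cases.
sim-arr : ∀ p a → (a <ᵇ 7) ≡ true → writesArr (sim p) (suc a) ≡ false
sim-arr skip           a _ = refl
sim-arr (const _ _)    a h = own a h
  where
  own : ∀ a → (a <ᵇ 7) ≡ true → writesArr (sim (const 0 0)) (suc a) ≡ false
  own 0 _ = refl
  own 1 _ = refl
  own 2 _ = refl
  own 3 _ = refl
  own 4 _ = refl
  own 5 _ = refl
  own 6 _ = refl
sim-arr (add _ _ _)    a h = sim-arr (const 0 0) a h
sim-arr (sub _ _ _)    a h = sim-arr (const 0 0) a h
sim-arr (load _ _ _)   a h = sim-arr (const 0 0) a h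
sim-arr (store b _ _)  a h = own a h
  where
  own : ∀ a → (a <ᵇ 7) ≡ true → writesArr (sim (store b 0 0)) (suc a) ≡ false
  own 0 _ = refl
  own 1 _ = refl
  own 2 _ = refl
  own 3 _ = refl
  own 4 _ = refl
  own 5 _ = refl
  own 6 _ = refl
sim-arr (read _)       a h = sim-arr (const 0 0) a h
sim-arr (write _)      a h = refl
sim-arr (p ⨾ q)        a h rewrite sim-arr p a h = sim-arr q a h
sim-arr (ifnz _ p q)   a h rewrite sim-arr p a h = sim-arr q a h
sim-arr (whilenz _ p)  a h rewrite sim-arr p a h = refl

sim-writes : ∀ p → writes (sim p) ≡ false
sim-writes skip           = refl
sim-writes (const _ _)    = refl
sim-writes (add _ _ _)    = refl
sim-writes (sub _ _ _)    = refl
sim-writes (load _ _ _)   = refl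
sim-writes (store _ _ _)  = refl
sim-writes (read _)       = refl
sim-writes (write _)      = refl
sim-writes (p ⨾ q)        rewrite sim-writes p = sim-writes q
sim-writes (ifnz _ p q)   rewrite sim-writes p = sim-writes q
sim-writes (whilenz _ p)  rewrite sim-writes p = refl

call : Program → Program
call p = move off lim ⨾ p

call-run : ∀ {p xs ys T σ} → Computes p xs ys T → Clean σ →
           Seg (io σ) (reg σ rp) xs → reg σ rem ≡ length xs → reg σ rp + length xs ≤ reg σ wp →
           Run (call (sim p)) σ (2 + 20 * T) (λ σ′ → Clean σ′ × Grew ys σ σ′)
call-run {p} {xs} {σ = σ} (_ , e , refl) cl sg ln le =
  (move off lim) , refl ▸ (sim-correct e (mkSim
    (λ { zero j → cl 0 _ (m≤n+m _ j) ; (suc a) j → cl (suc a) _ (m≤n+m _ j) }) cl sg ln le (λ _ _ → refl) tt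
      (+-identityʳ _)) ⟫
    λ s → Sim.clean s , grew (Sim.old s) (Sim.outSeg s) (sym (Sim.outLen s)))

-- Array 0 is a log to which all data are appended at address wp: the input, the
-- outputs of the cores and the generations of entries. The other arrays hold
-- arities (1), a stack (2), f (3), stamps of accepting states (4) and the table (7).
module Reg₂ where
  n len bad prev s c cnt U g gg own c₁ c₂ bw fl st k ar code sv e₀ e₁ e₂ e₃ e₄ ng : Register
  n = 8
  len = 9
  bad = 10
  prev = 11
  s = 12
  c = 13
  cnt = 14
  U = 15
  g = 16
  gg = 17
  own = 18
  c₁ = 19
  c₂ = 20
  bw = 21
  fl = 22
  st = 23
  k = 24
  ar = 25
  code = 26
  sv = 27
  e₀ = 28
  e₁ = 29
  e₂ = 30
  e₃ = 31
  e₄ = 32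
  ng = 33

open Reg₂

-- Reading strings

-- The string w becomes u times the binary number 1w.

horner : ℕ → ℕ → BitString → ℕ
horner U acc []      = acc
horner U acc (b ∷ w) = horner U (acc + acc + (if b then U else 0)) w

-- The initial accumulator `U` supplies a leading 1. Without it, strings that differ only in leading
-- zeros would share a code.
codeOf : ℕ → BitString → ℕ
codeOf U = horner U U

-- The truncated difference in `c` is nonzero for the bits 0 and 1 and zero for the terminator 2, so
-- it can directly control the loop.
next : Program
next = load s 0 rp ⨾ inc rp ⨾ const c 2 ⨾ sub c c s

digit : Program
digit = add code code code ⨾ ifnz s (add code code U) skip ⨾ next

parseString : Program
parseString = move code U ⨾ next ⨾ whilenz c digit

-- The loop looks one symbol ahead: the first symbol is already in `s`, and `rp` points to the
-- others.
Ready : State → List ℕ → Set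
Ready σ []       = ⊤
Ready σ (x ∷ xs) = reg σ s ≡ x × reg σ c ≡ 2 ∸ x × Seg (io σ) (reg σ rp) xs

next-Ready : ∀ {σ} xs → Seg (io σ) (reg σ rp) xs → Ready (⟦ next ⟧ σ) xs
next-Ready []       _       = tt
next-Ready (x ∷ xs) (h , t) = h , cong (2 ∸_) h , t

parse-loop : ∀ w {σ} → Ready σ (encodeString w) →
             Run (whilenz c digit) σ (10 * suc (length w))
               (λ σ′ → reg σ′ code ≡ horner (reg σ U) (reg σ code) w × reg σ′ rp ≡ reg σ rp + length w)
parse-loop [] (_ , c0 , _) = weaken (s≤s z≤n) (whileEnd c0 (refl , sym (+-identityʳ _)))
parse-loop (b ∷ w) {σ} (sb , cb , sg) =
  weaken (≤-trans (m≤m+n _ 1) (≤-reflexive (lemma (length w))))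
  (whileStep {T = 10 * suc (length w)}
    {Q = λ σ′ → Ready σ′ (encodeString w) × reg σ′ code ≡ reg σ code + reg σ code + (if b then reg σ U else 0)
                × reg σ′ rp ≡ suc (reg σ rp) × reg σ′ U ≡ reg σ U}
    (λ z → nonzero b (trans (sym cb) z))
    (add code code code , refl ▸
      bits b sb ▷ λ { (cd , rp≡ , io≡ , U≡) → block next refl
        ( next-Ready (encodeString w) (subst₂ (λ f p → Seg f p (encodeString w)) (sym io≡) (sym rp≡) sg)
        , cd , cong suc rp≡ , U≡ ) })
    λ { {σ′} (rd , cd , rp≡ , U≡) → parse-loop w rd ⟫ λ { (p , q) →
        trans p (cong₂ (λ u a → horner u a w) U≡ cd) ,
        trans q (trans (cong (_+ length w) rp≡) (sym (+-suc (reg σ rp) (length w)))) } })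
  where
  nonzero : ∀ b {A : Set} → 2 ∸ bit b ≡ 0 → A
  nonzero false ()
  nonzero true ()
  bits : ∀ b → reg σ s ≡ bit b → Run (ifnz s (add code code U) skip) (⟦ add code code code ⟧ σ) 2
           (λ σ′ → reg σ′ code ≡ reg σ code + reg σ code + (if b then reg σ U else 0) × reg σ′ rp ≡ reg σ rp
                   × io σ′ ≡ io σ × reg σ′ U ≡ reg σ U)
  bits false sb = ifZero sb (block skip refl (sym (+-identityʳ _) , refl , refl , refl))
  bits true  sb = ifNonzero (λ z → case trans (sym sb) z of λ ()) (block (add code code U) refl (refl , refl , refl , refl))
  lemma : ∀ l → (1 + ((1 + (2 + 5)) + 10 * (1 + l))) + 1 ≡ 10 * (1 + ((1 + l)))
  lemma = solve-∀

encodeString-length : ∀ w → length (encodeString w) ≡ suc (length w)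
encodeString-length w = trans (length-++ (map bit w)) (trans (+-comm _ 1) (cong suc (length-map bit w)))

parseString-run : ∀ w {σ} → Seg (io σ) (reg σ rp) (encodeString w) →
                  Run parseString σ (17 * length (encodeString w))
                    (λ σ′ → reg σ′ code ≡ codeOf (reg σ U) w × reg σ′ rp ≡ reg σ rp + length (encodeString w))
parseString-run w {σ} sg rewrite encodeString-length w =
  weaken (≤-trans (+-monoʳ-≤ 7 (m≤m+n _ (7 * length w))) (≤-reflexive (lemma (length w))))
  (move code U , refl ▸ next , refl ▸
    (parse-loop w (next-Ready (encodeString w) sg) ⟫ λ { (p , q) → p , trans q (sym (+-suc (reg σ rp) (length w))) }))
  where
  lemma : ∀ l → 7 + (10 * (1 + l) + 7 * l) ≡ 17 * (1 + l)
  lemma = solve-∀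

-- Entries

-- The cells of a node and of its first and second child in the table (0 for a
-- missing child), the index of the membership vector, and the number of
-- rejected states. All of them are sums of contributions of the single cores,
-- so entries are combined by adding them. A node stands for the list of its
-- entries, written with a 1 before each entry and a 0 at the end.

record Entry : Set where
  constructor mkEntry
  field
    addr addr₁ addr₂ bits rejects : ℕ

open Entry public

Entry-≡ : ∀ {a b c d e a′ b′ c′ d′ e′} → a ≡ a′ → b ≡ b′ → c ≡ c′ → d ≡ d′ → e ≡ e′ →
          mkEntry a b c d e ≡ mkEntry a′ b′ c′ d′ e′
Entry-≡ refl refl refl refl refl = refl

infixl 6 _⊞_

_⊞_ : Entry → Entry → Entry
mkEntry a b c d e ⊞ mkEntry a′ b′ c′ d′ e′ = mkEntry (a + a′) (b + b′) (c + c′) (d + d′) (e + e′)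

encodeEntry : Entry → List ℕ
encodeEntry (mkEntry a b c d e) = 1 ∷ a ∷ b ∷ c ∷ d ∷ e ∷ []

encodeEntries : List Entry → List ℕ
encodeEntries es = concatMap encodeEntry es ∷ʳ 0

-- On entry `gg` points to the marker 1 in front of the entry. The last load fetches the marker
-- behind it, which decides whether the surrounding loop continues.
loadEntry : Program
loadEntry = inc gg ⨾ load e₀ 0 gg ⨾ inc gg ⨾ load e₁ 0 gg ⨾ inc gg ⨾ load e₂ 0 gg ⨾
            inc gg ⨾ load e₃ 0 gg ⨾ inc gg ⨾ load e₄ 0 gg ⨾ inc gg ⨾ load s 0 gg

push : Register → Program
push x = store 0 wp x ⨾ inc wp

shiftEntry : Program
shiftEntry = add e₀ e₀ own ⨾ add e₁ e₁ c₁ ⨾ add e₂ e₂ c₂ ⨾ add e₃ e₃ bw ⨾ add e₄ e₄ fl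

emit : Program
emit = loadEntry ⨾ shiftEntry ⨾ const t 1 ⨾ push t ⨾ push e₀ ⨾ push e₁ ⨾ push e₂ ⨾ push e₃ ⨾ push e₄

current : State → Entry
current σ = mkEntry (reg σ own) (reg σ c₁) (reg σ c₂) (reg σ bw) (reg σ fl)

-- The loop stops on the terminator 0 without stepping over it, hence the `suc` in the final
-- position of `gg`. The other parsing loops end in the same way.
emit-loop : ∀ es {σ} → Seg (io σ) (reg σ gg) (encodeEntries es) → reg σ s ≡ io σ (reg σ gg) →
            reg σ gg + length (encodeEntries es) ≤ reg σ wp →
            Run (whilenz s emit) σ (50 * suc (length es))
              (λ σ′ → suc (reg σ′ gg) ≡ reg σ gg + length (encodeEntries es)
                    × Grew (concatMap encodeEntry (map (_⊞ current σ) es)) σ σ′)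
emit-loop [] {σ} (z , _) s≡ le = weaken (s≤s z≤n)
  (whileEnd (trans s≡ z) (sym (+-comm (reg σ gg) 1) , grew (λ _ _ → refl) tt (sym (+-identityʳ _))))
emit-loop (e@(mkEntry a b c₀ d r) ∷ es) {σ} (h₁ , h₂ , h₃ , h₄ , h₅ , h₆ , sg) s≡ le =
  weaken (≤-trans (m≤m+n _ 7) (≤-reflexive (lemma (length es))))
  (whileStep {T = 50 * suc (length es)} (λ z → case trans (trans (sym h₁) (sym s≡)) z of λ ())
    (framed (block emit {Q = λ σ′ → reg σ′ gg ≡ 6 + reg σ gg × reg σ′ s ≡ io σ (6 + reg σ gg)
                                    × reg σ′ wp ≡ 6 + reg σ wp × io σ′ ≡ put (io σ) (reg σ wp) new}
      refl (refl , refl , refl , refl)))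
    λ { {σ′} ((gg≡ , s≡′ , wp≡ , io≡) , fr) →
      let G : Grew (encodeEntry (e ⊞ current σ)) σ σ′
          G = grew (subst (io σ ≈[ reg σ wp ]_) (sym io≡) (put-≈ new {io σ} (reg σ wp) ≤-refl))
                   (subst₂ (λ f ys → Seg f (reg σ wp) ys) (sym io≡) new≡ (put-Seg new {io σ} (reg σ wp)))
                   (trans wp≡ (+-comm 6 (reg σ wp)))
          le′ : reg σ gg + 6 + length (encodeEntries es) ≤ reg σ wp
          le′ = subst (_≤ reg σ wp) (sym (+-assoc (reg σ gg) 6 _)) le
          gg≡′ : reg σ′ gg ≡ reg σ gg + 6
          gg≡′ = trans gg≡ (+-comm 6 (reg σ gg))
          cur≡ : current σ′ ≡ current σ
          cur≡ = Entry-≡ (regs fr own refl) (regs fr c₁ refl) (regs fr c₂ refl) (regs fr bw refl) (regs fr fl refl)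
      in emit-loop es
           (subst (λ p → Seg (io σ′) p (encodeEntries es)) (sym gg≡)
             (Grew-seg G (encodeEntries es) (subst (λ p → p + length (encodeEntries es) ≤ reg σ wp) (+-comm (reg σ gg) 6) le′) sg))
           (trans s≡′ (trans (sym (Grew.kept G _ (<-≤-trans (m<m+n (6 + reg σ gg) (nonempty es))
               (subst (λ p → p + length (encodeEntries es) ≤ reg σ wp) (+-comm (reg σ gg) 6) le′))))
             (cong (io σ′) (sym gg≡))))
           (subst (λ p → p + length (encodeEntries es) ≤ reg σ′ wp) (sym gg≡′) (≤-trans le′ (Grew-≤ G)))
         ⟫ λ { (p , q) →
           trans p (trans (cong (_+ length (encodeEntries es)) gg≡′) (+-assoc (reg σ gg) 6 _)) ,
           Grew-trans G (subst (λ x → Grew (concatMap encodeEntry (map (_⊞ x) es)) σ′ _) cur≡ q) } })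
  where
  new : List ℕ
  new = 1 ∷ io σ (1 + reg σ gg) + reg σ own ∷ io σ (2 + reg σ gg) + reg σ c₁ ∷ io σ (3 + reg σ gg) + reg σ c₂
          ∷ io σ (4 + reg σ gg) + reg σ bw ∷ io σ (5 + reg σ gg) + reg σ fl ∷ []
  new≡ : new ≡ encodeEntry (e ⊞ current σ)
  new≡ rewrite h₂ | h₃ | h₄ | h₅ | h₆ = refl
  nonempty : ∀ es → 0 < length (encodeEntries es)
  nonempty []      = s≤s z≤n
  nonempty (_ ∷ _) = s≤s z≤n
  lemma : ∀ l → (1 + (42 + 50 * (1 + l))) + 7 ≡ 50 * (1 + ((1 + l)))
  lemma = solve-∀

-- Processing the tuples of one core

encodeTuple : ∀ {m} → Vec BitString m → List ℕ
encodeTuple = concatMap encodeString ∘ Vec.toList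

child₁ : ∀ {m} → ℕ → Vec BitString m → ℕ
child₁ u []      = 0
child₁ u (w ∷ _) = codeOf u w

child₂ : ∀ {m} → ℕ → Vec BitString m → ℕ
child₂ u []      = 0
child₂ u (_ ∷ v) = child₁ u v

clamp : ℕ → ℕ
clamp zero    = 0
clamp (suc _) = 1

-- The share of one core in a combined entry: `u` is the unit of its digit in addresses, `wgt` the
-- unit of its bit in the index of the membership vector.
tupleEntry : (BitString → Bool) → (BitString → ℕ) → ℕ → ℕ → ∀ {m} → Vec BitString (suc m) → Entry
tupleEntry ρ flag wgt u (w ∷ ws) =
  mkEntry (codeOf u w) (child₁ u ws) (child₂ u ws) (if ρ w then wgt else 0) (flag w)

extend : ∀ {m} → (Vec BitString m → Entry) → List (Vec BitString m) → List Entry → List Entry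
extend conv ts es = concatMap (λ v → map (_⊞ conv v) es) ts

-- The string is parsed before the membership function is run on it, because its length, needed as
-- `rem`, is known only at its end; `rp` is then rewound. The single output symbol is taken off the
-- log again.
stringState : Program → Program
stringState ρ = move st rp ⨾ parseString ⨾ (move own code ⨾ sub rem rp st ⨾ move sv rp ⨾ move rp st) ⨾
                call ρ ⨾ (move rp sv ⨾ dec wp ⨾ load bw 0 wp)

-- Stamps never exceed the number `j` of the current core, so the truncated difference vanishes
-- exactly for its accepting states.
flags : (j wgt : ℕ) → Program
flags j wgt = ifnz bw (const bw wgt) skip ⨾ (load fl 4 own ⨾ const t j ⨾ sub fl t fl) ⨾
              ifnz fl (const fl 1) skip

parseChildren : Program
parseChildren = (const c₁ 0 ⨾ const c₂ 0) ⨾ ifnz ar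
  (parseString ⨾ (move c₁ code ⨾ move e₀ ar ⨾ dec e₀) ⨾ ifnz e₀ (parseString ⨾ move c₂ code) skip)
  skip

tuple : Program → (j wgt : ℕ) → Program
tuple ρ j wgt = (stringState ρ ⨾ flags j wgt ⨾ parseChildren) ⨾ (move gg g ⨾ load s 0 gg) ⨾ whilenz s emit

-- A tuple contains at least one string and therefore starts with a symbol below 3, so `c` is zero
-- only at the end of the set.
peek : Program
peek = load s 0 rp ⨾ const c 3 ⨾ sub c c s

node : Program → (j wgt : ℕ) → Program
node ρ j wgt = (inc k ⨾ load ar 1 k ⨾ peek) ⨾ whilenz c (tuple ρ j wgt ⨾ peek) ⨾
               (inc rp ⨾ move g gg ⨾ inc g ⨾ const e₀ 0 ⨾ push e₀ ⨾ dec cnt)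

module _ (p : Program) where

  -- With `skip` in place of the simulated program the check evaluates, so callers pass `refl`; what
  -- the simulation itself may write is settled by `sim-reg`. The lemmas below follow the same
  -- pattern.
  stringState-reg : ∀ x → writesReg (stringState skip) (8 + x) ≡ false → writesReg (stringState (sim p)) (8 + x) ≡ false
  stringState-reg x h rewrite sim-reg p x = h

  stringState-arr : ∀ a → (a <ᵇ 7) ≡ true → writesArr (stringState (sim p)) (suc a) ≡ false
  stringState-arr a h rewrite sim-arr p a h = refl

  node-reg : ∀ j wgt x → writesReg (node skip j wgt) (8 + x) ≡ false → writesReg (node (sim p) j wgt) (8 + x) ≡ false
  node-reg j wgt x h rewrite sim-reg p x = h

  node-arr : ∀ j wgt a → (a <ᵇ 7) ≡ true → writesArr (node (sim p) j wgt) (suc a) ≡ false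
  node-arr j wgt a h rewrite sim-arr p a h = refl

  stringState-run : ∀ {b T} w {σ} → Computes p (encodeString w) [ bit b ] T → Clean σ →
    Seg (io σ) (reg σ rp) (encodeString w) → reg σ rp + length (encodeString w) ≤ reg σ wp →
    Run (stringState (sim p)) σ (2 + (17 * length (encodeString w) + (7 + (2 + 20 * T + 5)))) (λ σ′ →
      Clean σ′ × io σ ≈[ reg σ wp ] io σ′ × reg σ′ own ≡ codeOf (reg σ U) w ×
      reg σ′ rp ≡ reg σ rp + length (encodeString w) × reg σ′ bw ≡ bit b × reg σ′ wp ≡ reg σ wp)
  stringState-run {b} w {σ} cp cl sg le =
    move st rp , refl ▸ framed (parseString-run w sg) ▷ λ { {σ₁} ((code≡ , rp≡) , fr) →
    let ln = length (encodeString w)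
        st≡ : reg σ₁ st ≡ reg σ rp
        st≡ = regs fr st refl
        io≡ : io σ₁ ≡ io σ
        io≡ = arrs fr 0 refl
        wp≡ : reg σ₁ wp ≡ reg σ wp
        wp≡ = regs fr wp refl
    in (move own code ⨾ sub rem rp st ⨾ move sv rp ⨾ move rp st) , refl ▸
       framed (call-run cp (Clean-frame fr refl (λ _ → refl) cl)
         (subst₂ (λ f i → Seg f i (encodeString w)) (sym io≡) (sym st≡) sg)
         (trans (cong₂ _∸_ rp≡ st≡) (m+n∸m≡n (reg σ rp) ln))
         (subst₂ (λ a b → a + ln ≤ b) (sym st≡) (sym wp≡) le)) ▷
    λ { {σ₂} ((cl₂ , grew kp (h , _) wp₂) , fr₂) →
       let wp₂≡ : reg σ₂ wp ≡ suc (reg σ wp)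
           wp₂≡ = trans wp₂ (trans (+-comm (reg σ₁ wp) 1) (cong suc wp≡))
       in block (move rp sv ⨾ dec wp ⨾ load bw 0 wp) refl
         ( cl₂
         , (λ i i< → trans (kp i (subst (i <_) (sym wp≡) i<)) (cong (λ f → f i) io≡))
         , trans (regs fr₂ own (sim-reg p 10)) code≡
         , trans (regs fr₂ sv (sim-reg p 19)) rp≡
         , trans (cong (λ i → io σ₂ (i ∸ 1)) wp₂≡) (trans (cong (io σ₂) (sym wp≡)) h)
         , cong (_∸ 1) wp₂≡ ) } }

flags-run : ∀ j wgt {σ} b → reg σ bw ≡ bit b →
            Run (flags j wgt) σ 7 (λ σ′ → reg σ′ bw ≡ (if b then wgt else 0) ×
                                          reg σ′ fl ≡ clamp (j ∸ arr σ 4 (reg σ own)))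
flags-run j wgt {σ} b bw≡ =
  _▷_ {Q = λ σ′ → reg σ′ bw ≡ (if b then wgt else 0) × reg σ′ own ≡ reg σ own × arr σ′ 4 ≡ arr σ 4} (weight b bw≡)
  λ { {σ₁} (q , own≡ , a≡) → (load fl 4 own ⨾ const t j ⨾ sub fl t fl) , refl ▸
  branch (λ ≢0 → block (const fl 1) refl
           (q , trans (one ≢0) (cong clamp (cong₂ (λ f x → j ∸ f x) a≡ own≡))))
         (λ ≡0 → block skip refl
           (q , trans (zeroed ≡0) (cong clamp (cong₂ (λ f x → j ∸ f x) a≡ own≡)))) }
  where
  weight : ∀ b → reg σ bw ≡ bit b → Run (ifnz bw (const bw wgt) skip) σ 2
    (λ σ′ → reg σ′ bw ≡ (if b then wgt else 0) × reg σ′ own ≡ reg σ own × arr σ′ 4 ≡ arr σ 4)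
  weight false e = ifZero e (block skip refl (e , refl , refl))
  weight true  e = ifNonzero (λ z → case trans (sym e) z of λ ()) (block (const bw wgt) refl (refl , refl , refl))
  one : ∀ {m} → m ≢ 0 → 1 ≡ clamp m
  one {zero}  h = contradiction refl h
  one {suc m} h = refl
  zeroed : ∀ {m} → m ≡ 0 → m ≡ clamp m
  zeroed refl = refl

parseChildren-run : ∀ {m} (ws : Vec BitString m) {σ} → m ≤ 2 → reg σ ar ≡ m → Seg (io σ) (reg σ rp) (encodeTuple ws) →
  Run parseChildren σ (13 + 17 * length (encodeTuple ws)) (λ σ′ →
    reg σ′ c₁ ≡ child₁ (reg σ U) ws × reg σ′ c₂ ≡ child₂ (reg σ U) ws ×
    reg σ′ rp ≡ reg σ rp + length (encodeTuple ws))
parseChildren-run [] _ a≡ _ = weaken (m≤m+n _ 9)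
  ((const c₁ 0 ⨾ const c₂ 0) , refl ▸ ifZero a≡ (block skip refl (refl , refl , sym (+-identityʳ _))))
parseChildren-run (w ∷ []) {σ} _ a≡ sg =
  weaken (≤-trans (m≤m+n _ 2) (≤-reflexive (lemma (encodeString w) _ (length-++ (encodeString w)))))
  ((const c₁ 0 ⨾ const c₂ 0) , refl ▸ ifNonzero (λ z → case trans (sym a≡) z of λ ())
    (framed (parseString-run w (Seg-++ˡ (encodeString w) sg)) ▷ λ { {σ₁} ((code≡ , rp≡) , fr) →
      (move c₁ code ⨾ move e₀ ar ⨾ dec e₀) , refl ▸
      ifZero (cong (_∸ 1) (trans (regs fr ar refl) a≡))
        (block skip refl (code≡ , regs fr c₂ refl ,
          trans rp≡ (cong (reg σ rp +_) (trans (sym (+-identityʳ _)) (sym (length-++ (encodeString w))))))) }))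
  where
  lemma : ∀ (xs : List ℕ) l → l ≡ length xs + 0 → 2 + suc (17 * length xs + (6 + 2)) + 2 ≡ 13 + 17 * l
  lemma xs l refl = eq (length xs)
    where
    eq : ∀ l → 2 + (1 + (17 * l + (6 + 2))) + 2 ≡ 13 + 17 * (l + 0)
    eq = solve-∀
parseChildren-run (w ∷ w′ ∷ []) {σ} _ a≡ sg =
  weaken (≤-trans (m≤m+n _ 1) (≤-reflexive (lemma (length (encodeString w)) (length (encodeString w′)) _ len≡)))
  ((const c₁ 0 ⨾ const c₂ 0) , refl ▸ ifNonzero (λ z → case trans (sym a≡) z of λ ())
    (framed (parseString-run w (Seg-++ˡ (encodeString w) sg)) ▷ λ { {σ₁} ((code≡ , rp≡) , fr) →
      (move c₁ code ⨾ move e₀ ar ⨾ dec e₀) , refl ▸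
      ifNonzero (λ z → case trans (sym (cong (_∸ 1) (trans (regs fr ar refl) a≡))) z of λ ())
        (framed (parseString-run w′ (subst₂ (λ f i → Seg f i (encodeString w′)) (sym (arrs fr 0 refl)) (sym rp≡)
            (Seg-++ˡ (encodeString w′) (Seg-++ʳ (encodeString w) sg)))) ▷ λ { {σ₂} ((code≡₂ , rp≡₂) , fr₂) →
         block (move c₂ code) refl
          ( trans (regs fr₂ c₁ refl) code≡
          , trans code≡₂ (cong (λ u → codeOf u w′) (regs fr U refl))
          , trans rp≡₂ (trans (cong (_+ length (encodeString w′)) rp≡)
              (trans (+-assoc (reg σ rp) _ _) (cong (reg σ rp +_) (sym len≡)))) ) }) }))
  where
  len≡ : length (encodeString w ++ encodeString w′ ++ []) ≡ length (encodeString w) + length (encodeString w′)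
  len≡ = trans (length-++ (encodeString w)) (cong (length (encodeString w) +_)
           (trans (length-++ (encodeString w′)) (+-identityʳ _)))
  lemma : ∀ a b l → l ≡ a + b → 2 + suc (17 * a + (6 + suc (17 * b + 2))) + 1 ≡ 13 + 17 * l
  lemma a b l refl = eq a b
    where
    eq : ∀ a b → 2 + (1 + (17 * a + (6 + (1 + (17 * b + 2))))) + 1 ≡ 13 + 17 * (a + b)
    eq = solve-∀
parseChildren-run (_ ∷ _ ∷ _ ∷ _) (s≤s (s≤s ())) _ _

encodeString-head : ∀ w {f p} ys → Seg f p (encodeString w ++ ys) → 3 ∸ f p ≢ 0
encodeString-head []          ys (h , _) rewrite h = λ ()
encodeString-head (false ∷ w) ys (h , _) rewrite h = λ ()
encodeString-head (true ∷ w)  ys (h , _) rewrite h = λ ()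

encodeTuples-∷ : ∀ {m} (v : Vec BitString m) ts → encodeTuples (v ∷ ts) ≡ encodeTuple v ++ encodeTuples ts
encodeTuples-∷ v ts = ++-assoc (encodeTuple v) _ _

module Evaluator (p : Program) (ρ : BitString → Bool) (K : ℕ)
  (p-computes : ∀ w → ∃[ t ] Computes p (encodeString w) [ bit (ρ w) ] t × t ≤ K * suc (length w))
  (flag : BitString → ℕ) (j wgt : ℕ) where

  FlagsOf : State → Set
  FlagsOf σ = ∀ w → clamp (j ∸ arr σ 4 (codeOf (reg σ U) w)) ≡ flag w

  entryOf : ∀ {m} → ℕ → Vec BitString (suc m) → Entry
  entryOf u = tupleEntry ρ flag wgt u

  tupleHead-run : ∀ {m} (v : Vec BitString (suc m)) {σ} → m ≤ 2 → reg σ ar ≡ m → Clean σ → FlagsOf σ →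
    Seg (io σ) (reg σ rp) (encodeTuple v) → reg σ rp + length (encodeTuple v) ≤ reg σ wp →
    Run (stringState (sim p) ⨾ flags j wgt ⨾ parseChildren) σ ((40 + 20 * K) * length (encodeTuple v) + 40) (λ σ′ →
      Clean σ′ × io σ ≈[ reg σ wp ] io σ′ × reg σ′ wp ≡ reg σ wp ×
      reg σ′ rp ≡ reg σ rp + length (encodeTuple v) × current σ′ ≡ entryOf (reg σ U) v)
  tupleHead-run (w ∷ ws) {σ} m≤2 ar≡ cl fl≡ sg le with t , cp , t≤ ← p-computes w =
    weaken bound
    (framed (stringState-run p w cp cl (Seg-++ˡ xs sg) (≤-trans (+-monoʳ-≤ (reg σ rp) len≤) le)) ▷
    λ { {σ₁} ((cl₁ , io₁ , own₁ , rp₁ , bw₁ , wp₁) , fr₁) → framed (flags-run j wgt (ρ w) bw₁) ▷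
    λ { {σ₂} ((bw₂ , fl₂) , fr₂) →
      framed (parseChildren-run ws m≤2
        (trans (regs fr₂ ar refl) (trans (regs fr₁ ar (stringState-reg p 17 refl)) ar≡))
        (subst₂ (λ f i → Seg f i (encodeTuple ws)) (sym (arrs fr₂ 0 refl)) (sym (trans (regs fr₂ rp refl) rp₁))
          (Seg-≈ (encodeTuple ws) {reg σ rp + length xs} io₁
            (subst (_≤ reg σ wp) (trans (cong (reg σ rp +_) (length-++ xs)) (sym (+-assoc (reg σ rp) _ _))) le)
            (Seg-++ʳ xs sg)))) ⟫
    λ { {σ₃} ((a , b , c) , fr₃) →
      let U≡ : reg σ₂ U ≡ reg σ U
          U≡ = trans (regs fr₂ U refl) (regs fr₁ U (stringState-reg p 7 refl))
      in Clean-frame fr₃ refl (λ _ → refl) (Clean-frame fr₂ refl (λ _ → refl) cl₁)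
       , (λ i i< → trans (cong (λ f → f i) (trans (arrs fr₃ 0 refl) (arrs fr₂ 0 refl))) (io₁ i i<))
       , trans (regs fr₃ wp refl) (trans (regs fr₂ wp refl) wp₁)
       , trans c (trans (cong (_+ length (encodeTuple ws)) (trans (regs fr₂ rp refl) rp₁))
           (trans (+-assoc (reg σ rp) _ _) (cong (reg σ rp +_) (sym (length-++ xs)))))
       , Entry-≡ (trans (regs fr₃ own refl) (trans (regs fr₂ own refl) own₁))
                (trans a (cong (λ u → child₁ u ws) U≡)) (trans b (cong (λ u → child₂ u ws) U≡))
                (trans (regs fr₃ bw refl) bw₂)
                (trans (regs fr₃ fl refl) (trans fl₂ (trans (cong₂ (λ f x → clamp (j ∸ f x))
                  (arrs fr₁ 4 (stringState-arr p 3 refl)) own₁) (fl≡ w)))) } } })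
    where
    xs = encodeString w
    len≤ : length xs ≤ length (xs ++ encodeTuple ws)
    len≤ = subst (length xs ≤_) (sym (length-++ xs)) (m≤m+n _ _)
    bound : 2 + (17 * length xs + (7 + (2 + 20 * t + 5))) + (7 + (13 + 17 * length (encodeTuple ws)))
            ≤ (40 + 20 * K) * length (xs ++ encodeTuple ws) + 40
    bound = begin
      2 + (17 * X + (7 + (2 + 20 * t + 5))) + (7 + (13 + 17 * Y))
        -- `suc (length w)` is the length of the encoded string, so the evaluation of the membership
        -- function is charged to the symbols read.
        ≤⟨ +-monoˡ-≤ (7 + (13 + 17 * Y)) (+-monoʳ-≤ 2 (+-monoʳ-≤ (17 * X) (+-monoʳ-≤ 7 (+-monoˡ-≤ 5 (+-monoʳ-≤ 2 (*-monoʳ-≤ 20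
             (≤-trans t≤ (*-monoʳ-≤ K (≤-reflexive (sym (encodeString-length w)))))))))))
         ⟩
      2 + (17 * X + (7 + (2 + 20 * (K * X) + 5))) + (7 + (13 + 17 * Y))
        ≤⟨ m≤m+n _ (23 * (X + Y) + 20 * K * Y + 4) ⟩
      2 + (17 * X + (7 + (2 + 20 * (K * X) + 5))) + (7 + (13 + 17 * Y)) + (23 * (X + Y) + 20 * K * Y + 4)
        ≡⟨ lemma K X Y ⟩
      (40 + 20 * K) * (X + Y) + 40
        ≡⟨ cong (λ l → (40 + 20 * K) * l + 40) (sym (length-++ xs)) ⟩
      (40 + 20 * K) * length (xs ++ encodeTuple ws) + 40 ∎
      where
      open ≤-Reasoning
      X = length xs
      Y = length (encodeTuple ws)
      lemma : ∀ K X Y → 2 + (17 * X + (7 + (2 + 20 * (K * X) + 5))) + (7 + (13 + 17 * Y)) + (23 * (X + Y) + 20 * K * Y + 4)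
                        ≡ (40 + 20 * K) * (X + Y) + 40
      lemma = solve-∀

  tuple-run : ∀ {m} (v : Vec BitString (suc m)) es {σ} → m ≤ 2 → reg σ ar ≡ m → Clean σ → FlagsOf σ →
    Seg (io σ) (reg σ rp) (encodeTuple v) → reg σ rp + length (encodeTuple v) ≤ reg σ wp →
    Seg (io σ) (reg σ g) (encodeEntries es) → reg σ g + length (encodeEntries es) ≤ reg σ wp →
    Run (tuple (sim p) j wgt) σ ((40 + 20 * K) * length (encodeTuple v) + 50 * length es + 100) (λ σ′ →
      Clean σ′ × reg σ′ rp ≡ reg σ rp + length (encodeTuple v) ×
      suc (reg σ′ gg) ≡ reg σ g + length (encodeEntries es) ×
      Grew (concatMap encodeEntry (map (_⊞ entryOf (reg σ U) v) es)) σ σ′)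
  tuple-run v es {σ} m≤2 ar≡ cl fl≡ sg le sg′ le′ =
    weaken (≤-trans (m≤m+n _ 7) (≤-reflexive (lemma ((40 + 20 * K) * length (encodeTuple v)) (length es))))
    (framed (tupleHead-run v m≤2 ar≡ cl fl≡ sg le) ▷ λ { {σ₁} ((cl₁ , io₁ , wp₁ , rp₁ , cur₁) , fr₁) →
     let g≡ : reg σ₁ g ≡ reg σ g
         g≡ = regs fr₁ g (headReg 8 refl)
     in (move gg g ⨾ load s 0 gg) , refl ▸
        framed (emit-loop es
          (subst (λ i → Seg (io σ₁) i (encodeEntries es)) (sym g≡) (Seg-≈ (encodeEntries es) io₁ le′ sg′)) refl
          (subst₂ (λ a b → a + length (encodeEntries es) ≤ b) (sym g≡) (sym wp₁) le′)) ⟫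
     λ { {σ₂} ((gg₂ , gr) , fr₂) →
        Clean-frame fr₂ refl (λ _ → refl) cl₁ , trans (regs fr₂ rp refl) rp₁ ,
        trans gg₂ (cong (_+ length (encodeEntries es)) g≡) ,
        grew (≈-trans {io σ} io₁ (Grew.kept gr) (≤-reflexive (sym wp₁)))
          (subst₂ (λ e i → Seg (io σ₂) i (concatMap encodeEntry (map (_⊞ e) es))) cur₁ wp₁ (Grew.new gr))
          (trans (Grew.end gr) (cong₂ (λ i e → i + length (concatMap encodeEntry (map (_⊞ e) es))) wp₁ cur₁)) } })
    where
    headReg : ∀ x → writesReg (stringState skip ⨾ flags j wgt ⨾ parseChildren) (8 + x) ≡ false →
              writesReg (stringState (sim p) ⨾ flags j wgt ⨾ parseChildren) (8 + x) ≡ false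
    headReg x h rewrite sim-reg p x = h
    lemma : ∀ A l → A + 40 + (3 + 50 * (1 + l)) + 7 ≡ A + 50 * l + 100
    lemma = solve-∀

  -- The old entries are traversed once per tuple, and only such a traversal brings `gg` to their
  -- end. The last premise therefore speaks of the empty list: it comes from the previous tuple, or
  -- is vacuous when the set at the node is not empty.
  tuples-loop : ∀ {m} (ts : List (Vec BitString (suc m))) es {σ} → m ≤ 2 → reg σ ar ≡ m → Clean σ → FlagsOf σ →
    Seg (io σ) (reg σ rp) (encodeTuples ts) → reg σ rp + length (encodeTuples ts) ≤ reg σ wp →
    Seg (io σ) (reg σ g) (encodeEntries es) → reg σ g + length (encodeEntries es) ≤ reg σ wp →
    reg σ c ≡ 3 ∸ io σ (reg σ rp) →
    (ts ≡ [] → suc (reg σ gg) ≡ reg σ g + length (encodeEntries es)) →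
    Run (whilenz c (tuple (sim p) j wgt ⨾ peek)) σ
      ((150 + 20 * K) * length (encodeTuples ts) + 50 * length (extend (entryOf (reg σ U)) ts es)) (λ σ′ →
      Clean σ′ × suc (reg σ′ rp) ≡ reg σ rp + length (encodeTuples ts) ×
      suc (reg σ′ gg) ≡ reg σ g + length (encodeEntries es) ×
      Grew (concatMap encodeEntry (extend (entryOf (reg σ U)) ts es)) σ σ′)
  tuples-loop [] es {σ} _ _ cl _ (h , _) _ _ _ c≡ gg≡ =
    weaken (s≤s z≤n)
    (whileEnd (trans c≡ (cong (3 ∸_) h))
      (cl , sym (+-comm (reg σ rp) 1) , gg≡ refl , grew (λ _ _ → refl) tt (sym (+-identityʳ _))))
  tuples-loop (v ∷ ts) es {σ} m≤2 ar≡ cl fl≡ sg le sg′ le′ c≡ _ =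
    weaken bound
    (whileStep {T = (150 + 20 * K) * length (encodeTuples ts) + 50 * length (extend (entryOf (reg σ U)) ts es)}
      (λ z → head v sg₁ (trans (sym c≡) z))
      (framed (_▷_ {T = 3} (tuple-run v es m≤2 ar≡ cl fl≡ (Seg-++ˡ (encodeTuple v) sg₁) (≤-trans (m≤m+n _ _) le₁) sg′ le′)
        λ { (cl₁ , rp₁ , gg₁ , grew ka ne en) →
          block peek {Q = λ σ₁ → (Clean σ₁ × reg σ₁ rp ≡ reg σ rp + length (encodeTuple v) ×
            suc (reg σ₁ gg) ≡ reg σ g + length (encodeEntries es) ×
            Grew (concatMap encodeEntry (map (_⊞ entryOf (reg σ U) v) es)) σ σ₁) ×
            reg σ₁ c ≡ 3 ∸ io σ₁ (reg σ₁ rp)} refl ((cl₁ , rp₁ , gg₁ , grew ka ne en) , refl) }))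
    λ { {σ₁} (((cl₁ , rp₁ , gg₁ , gr) , c₁≡) , fr) →
      let U≡ : reg σ₁ U ≡ reg σ U
          U≡ = regs fr U (bodyReg 7 refl)
          g≡ : reg σ₁ g ≡ reg σ g
          g≡ = regs fr g (bodyReg 8 refl)
      in subst (λ u → Run (whilenz c (tuple (sim p) j wgt ⨾ peek)) σ₁
           ((150 + 20 * K) * length (encodeTuples ts) + 50 * length (extend (entryOf u) ts es)) _) U≡
         (tuples-loop ts es m≤2 (trans (regs fr ar (bodyReg 17 refl)) ar≡) cl₁
          (λ w → trans (cong₂ (λ f u → clamp (j ∸ f (codeOf u w))) (arrs fr 4 (bodyArr 3 refl)) U≡) (fl≡ w))
          (subst (λ i → Seg (io σ₁) i (encodeTuples ts)) (sym rp₁)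
            (Grew-seg gr (encodeTuples ts) le₁ (Seg-++ʳ (encodeTuple v) sg₁)))
          (subst (λ i → i + length (encodeTuples ts) ≤ reg σ₁ wp) (sym rp₁) (≤-trans le₁ (Grew-≤ gr)))
          (subst (λ i → Seg (io σ₁) i (encodeEntries es)) (sym g≡) (Grew-seg gr (encodeEntries es) le′ sg′))
          (subst (λ i → i + length (encodeEntries es) ≤ reg σ₁ wp) (sym g≡) (≤-trans le′ (Grew-≤ gr)))
          c₁≡ (λ _ → trans gg₁ (cong (_+ length (encodeEntries es)) (sym g≡))) ⟫
         λ { {σ₂} (cl₂ , rp₂ , gg₂ , gr₂) → cl₂ ,
           trans rp₂ (trans (cong (_+ length (encodeTuples ts)) rp₁) (trans (+-assoc (reg σ rp) _ _)
             (cong (reg σ rp +_) (sym len≡)))) ,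
           trans gg₂ (cong (_+ length (encodeEntries es)) g≡) ,
           subst (λ ys → Grew ys σ σ₂)
             (sym (concatMap-++ encodeEntry (map (_⊞ entryOf (reg σ U) v) es) (extend (entryOf (reg σ U)) ts es)))
             (Grew-trans gr (subst (λ u → Grew (concatMap encodeEntry (extend (entryOf u) ts es)) σ₁ σ₂) U≡ gr₂)) }) })
    where
    len≡ : length (encodeTuples (v ∷ ts)) ≡ length (encodeTuple v) + length (encodeTuples ts)
    len≡ = trans (cong length (encodeTuples-∷ v ts)) (length-++ (encodeTuple v))
    sg₁ : Seg (io σ) (reg σ rp) (encodeTuple v ++ encodeTuples ts)
    sg₁ = subst (Seg (io σ) (reg σ rp)) (encodeTuples-∷ v ts) sg
    le₁ : reg σ rp + length (encodeTuple v) + length (encodeTuples ts) ≤ reg σ wp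
    le₁ = subst (_≤ reg σ wp) (trans (cong (reg σ rp +_) len≡) (sym (+-assoc (reg σ rp) _ _))) le
    head : ∀ {m} (v : Vec BitString (suc m)) {f q ys} → Seg f q (encodeTuple v ++ ys) → 3 ∸ f q ≢ 0
    head (w ∷ ws) {f} {q} {ys} s = encodeString-head w _ (subst (Seg f q) (++-assoc (encodeString w) (encodeTuple ws) ys) s)
    bodyReg : ∀ x → writesReg (tuple skip j wgt ⨾ peek) (8 + x) ≡ false →
              writesReg (tuple (sim p) j wgt ⨾ peek) (8 + x) ≡ false
    bodyReg x h rewrite sim-reg p x = h
    bodyArr : ∀ a → (a <ᵇ 7) ≡ true → writesArr (tuple (sim p) j wgt ⨾ peek) (suc a) ≡ false
    bodyArr a h rewrite sim-arr p a h = refl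
    positive : ∀ {m} (v : Vec BitString (suc m)) → 1 ≤ length (encodeTuple v)
    positive (w ∷ ws) = subst (1 ≤_) (sym (trans (length-++ (encodeString w)) (cong (_+ length (encodeTuple ws)) (encodeString-length w)))) (s≤s z≤n)
    bound : suc (((40 + 20 * K) * length (encodeTuple v) + 50 * length es + 100 + 3)
              + ((150 + 20 * K) * length (encodeTuples ts) + 50 * length (extend (entryOf (reg σ U)) ts es)))
            ≤ (150 + 20 * K) * length (encodeTuples (v ∷ ts)) + 50 * length (extend (entryOf (reg σ U)) (v ∷ ts) es)
    bound = begin
      suc (((40 + 20 * K) * V + 50 * E + 100 + 3) + ((150 + 20 * K) * L + 50 * X))
        ≤⟨ s≤s (+-monoˡ-≤ _ (+-monoʳ-≤ ((40 + 20 * K) * V + 50 * E + 100) (≤-trans (m≤m+n 3 6) ≤-refl))) ⟩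
      suc (((40 + 20 * K) * V + 50 * E + 100 + 9) + ((150 + 20 * K) * L + 50 * X))
        ≡⟨ lemma₁ K V E L X ⟩
      (40 + 20 * K) * V + 110 * 1 + ((150 + 20 * K) * L + 50 * (E + X))
        -- The encoding of a tuple has at least one symbol, which pays for the constant overhead of
        -- the tuple.
        ≤⟨ +-monoˡ-≤ _ (+-monoʳ-≤ ((40 + 20 * K) * V) (*-monoʳ-≤ 110 (positive v))) ⟩
      (40 + 20 * K) * V + 110 * V + ((150 + 20 * K) * L + 50 * (E + X))
        ≡⟨ lemma₂ K V L (E + X) ⟩
      (150 + 20 * K) * (V + L) + 50 * (E + X)
        ≡⟨ cong₂ (λ a b → (150 + 20 * K) * a + 50 * b) (sym len≡)
             (sym (trans (length-++ (map (_⊞ entryOf (reg σ U) v) es)) (cong (_+ X) (length-map _ es)))) ⟩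
      (150 + 20 * K) * length (encodeTuples (v ∷ ts)) + 50 * length (extend (entryOf (reg σ U)) (v ∷ ts) es) ∎
      where
      open ≤-Reasoning
      V = length (encodeTuple v)
      E = length es
      L = length (encodeTuples ts)
      X = length (extend (entryOf (reg σ U)) ts es)
      lemma₁ : ∀ K V E L X → (1 + (((40 + 20 * K) * V + 50 * E + 100 + 9) + ((150 + 20 * K) * L + 50 * X)))
                             ≡ (40 + 20 * K) * V + 110 * 1 + ((150 + 20 * K) * L + 50 * (E + X))
      lemma₁ = solve-∀
      lemma₂ : ∀ K V L Y → (40 + 20 * K) * V + 110 * V + ((150 + 20 * K) * L + 50 * Y)
                           ≡ (150 + 20 * K) * (V + L) + 50 * Y
      lemma₂ = solve-∀

  module _ {N : Set} (deg : N → ℕ) (deg≤2 : ∀ a → deg a ≤ 2) (proc : ∀ a → List (Vec BitString (suc (deg a))))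
           (es : N → List Entry) where

    gen′ : ℕ → N → List Entry
    gen′ u a = extend (entryOf u) (proc a) (es a)

    node-run : ∀ a {σ} rest rest′ → proc a ≢ [] → Clean σ → FlagsOf σ →
      arr σ 1 (suc (reg σ k)) ≡ deg a →
      Seg (io σ) (reg σ rp) (encodeTuples (proc a) ++ rest) →
      reg σ rp + length (encodeTuples (proc a) ++ rest) ≤ reg σ wp →
      Seg (io σ) (reg σ g) (encodeEntries (es a) ++ rest′) →
      reg σ g + length (encodeEntries (es a) ++ rest′) ≤ reg σ wp →
      Run (node (sim p) j wgt) σ
        ((170 + 20 * K) * length (encodeTuples (proc a)) + 50 * length (gen′ (reg σ U) a)) (λ σ′ →
        (Clean σ′ × reg σ′ rp ≡ reg σ rp + length (encodeTuples (proc a)) ×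
        reg σ′ g ≡ reg σ g + length (encodeEntries (es a)) × reg σ′ cnt ≡ reg σ cnt ∸ 1 ×
        reg σ′ k ≡ suc (reg σ k) ×
        Grew (encodeEntries (gen′ (reg σ U) a)) σ σ′) × Frame (node (sim p) j wgt) σ σ′)
    node-run a {σ} rest rest′ ne cl fl≡ ar≡ sg le sg′ le′ =
      weaken (≤-trans (m≤m+n _ 2) (≤-trans (≤-reflexive (lemma₁ K (length (encodeTuples (proc a))) (50 * length (gen′ (reg σ U) a))))
        (≤-trans (+-monoʳ-≤ ((150 + 20 * K) * length (encodeTuples (proc a)) + 50 * length (gen′ (reg σ U) a)) (*-monoʳ-≤ 20 {1} pos))
          (≤-reflexive (lemma₂ K (length (encodeTuples (proc a))) (50 * length (gen′ (reg σ U) a)))))))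
      (framed ((inc k ⨾ load ar 1 k ⨾ peek) , refl ▸
        framed (tuples-loop (proc a) (es a) (deg≤2 a) ar≡ cl fl≡ (Seg-++ˡ (encodeTuples (proc a)) sg)
          (≤-trans (+-monoʳ-≤ (reg σ rp) (prefix (encodeTuples (proc a)) rest)) le)
          (Seg-++ˡ (encodeEntries (es a)) sg′)
          (≤-trans (+-monoʳ-≤ (reg σ g) (prefix (encodeEntries (es a)) rest′)) le′)
          refl (λ z → contradiction z ne)) ▷
        λ { {σ₁} ((cl₁ , rp₁ , gg₁ , gr) , fr) →
          block (inc rp ⨾ move g gg ⨾ inc g ⨾ const e₀ 0 ⨾ push e₀ ⨾ dec cnt) refl
            ( cl₁ , rp₁ , gg₁ , cong (_∸ 1) (regs fr cnt (loopReg 6 refl)) , regs fr k (loopReg 16 refl)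
            , Grew-trans {σ = σ} {σ₁} (grew (Grew.kept gr) (Grew.new gr) (Grew.end gr)) (grew (≈-update ≤-refl) (update-same (io σ₁) (reg σ₁ wp) , tt) (sym (+-comm (reg σ₁ wp) 1)))) }))
      where
      prefix : ∀ (xs ys : List ℕ) → length xs ≤ length (xs ++ ys)
      prefix xs ys = subst (length xs ≤_) (sym (length-++ xs)) (m≤m+n _ _)
      loopReg : ∀ x → writesReg (whilenz c (tuple skip j wgt ⨾ peek)) (8 + x) ≡ false →
                writesReg (whilenz c (tuple (sim p) j wgt ⨾ peek)) (8 + x) ≡ false
      loopReg x h rewrite sim-reg p x = h
      pos : 1 ≤ length (encodeTuples (proc a))
      pos = subst (1 ≤_) (sym (trans (length-++ (concatMap encodeTuple (proc a))) (+-comm _ 1))) (s≤s z≤n)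
      lemma₁ : ∀ K L X → 6 + ((150 + 20 * K) * L + X + 12) + 2 ≡ (150 + 20 * K) * L + X + 20 * 1
      lemma₁ = solve-∀
      lemma₂ : ∀ K L X → (150 + 20 * K) * L + X + 20 * L ≡ (170 + 20 * K) * L + X
      lemma₂ = solve-∀

    nodes-loop : ∀ as {σ} B → All (λ a → proc a ≢ []) as → Clean σ → FlagsOf σ →
      All (λ a → length (gen′ (reg σ U) a) ≤ B) as →
      reg σ cnt ≡ length as → Seg (arr σ 1) (suc (reg σ k)) (map deg as) →
      ∀ rest →
      Seg (io σ) (reg σ rp) (concatMap (encodeTuples ∘ proc) as ++ rest) →
      reg σ rp + length (concatMap (encodeTuples ∘ proc) as ++ rest) ≤ reg σ wp →
      Seg (io σ) (reg σ g) (concatMap (encodeEntries ∘ es) as) →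
      reg σ g + length (concatMap (encodeEntries ∘ es) as) ≤ reg σ wp →
      Run (whilenz cnt (node (sim p) j wgt)) σ
        (suc ((171 + 20 * K) * length (concatMap (encodeTuples ∘ proc) as) + 50 * (length as * B))) (λ σ′ →
        Clean σ′ × reg σ′ rp ≡ reg σ rp + length (concatMap (encodeTuples ∘ proc) as) ×
        Grew (concatMap (encodeEntries ∘ gen′ (reg σ U)) as) σ σ′)
    nodes-loop [] B _ cl _ _ cnt≡ _ _ _ _ _ _ =
      weaken (s≤s z≤n) (whileEnd cnt≡ (cl , sym (+-identityʳ _) , grew (λ _ _ → refl) tt (sym (+-identityʳ _))))
    nodes-loop (a ∷ as) {σ} B (ne ∷ nes) cl fl≡ (b ∷ bs) cnt≡ (ar≡ , ars) rest sg le sg′ le′ =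
      weaken bound
      (whileStep {T = suc ((171 + 20 * K) * length (concatMap (encodeTuples ∘ proc) as) + 50 * (length as * B))}
        (λ z → case trans (sym cnt≡) z of λ ())
        (node-run a (concatMap (encodeTuples ∘ proc) as ++ rest) (concatMap (encodeEntries ∘ es) as) ne cl fl≡ ar≡ sg₁ le₁ sg′ le′)
      λ { {σ₁} ((cl₁ , rp₁ , g₁ , cnt₁ , k₁ , gr) , fr) →
        let U≡ : reg σ₁ U ≡ reg σ U
            U≡ = regs fr U (node-reg p j wgt 7 refl)
        in nodes-loop as B nes cl₁
          (λ w → trans (cong₂ (λ f u → clamp (j ∸ f (codeOf u w))) (arrs fr 4 (node-arr p j wgt 3 refl)) U≡) (fl≡ w))
          (subst (λ u → All (λ a → length (gen′ u a) ≤ B) as) (sym U≡) bs)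
          (trans cnt₁ (cong (_∸ 1) cnt≡))
          (subst₂ (λ f i → Seg f (suc i) (map deg as)) (sym (arrs fr 1 (node-arr p j wgt 0 refl))) (sym k₁) ars)
          rest
          (subst (λ i → Seg (io σ₁) i _) (sym rp₁) (Grew-seg gr _ le₂ (Seg-++ʳ (encodeTuples (proc a)) sg₁)))
          (subst (λ i → i + length (concatMap (encodeTuples ∘ proc) as ++ rest) ≤ reg σ₁ wp) (sym rp₁) (≤-trans le₂ (Grew-≤ gr)))
          (subst (λ i → Seg (io σ₁) i _) (sym g₁) (Grew-seg gr _ le₃ (Seg-++ʳ (encodeEntries (es a)) sg′)))
          (subst (λ i → i + length (concatMap (encodeEntries ∘ es) as) ≤ reg σ₁ wp) (sym g₁) (≤-trans le₃ (Grew-≤ gr)))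
        ⟫ λ { {σ₂} (cl₂ , rp₂ , gr₂) → cl₂ ,
          trans rp₂ (trans (cong (_+ length (concatMap (encodeTuples ∘ proc) as)) rp₁) (trans (+-assoc (reg σ rp) _ _)
            (cong (reg σ rp +_) (sym (length-++ (encodeTuples (proc a))))))) ,
          Grew-trans gr (subst (λ u → Grew (concatMap (encodeEntries ∘ gen′ u) as) σ₁ σ₂) U≡ gr₂) } })
      where
      sg₁ : Seg (io σ) (reg σ rp) (encodeTuples (proc a) ++ concatMap (encodeTuples ∘ proc) as ++ rest)
      sg₁ = subst (Seg (io σ) (reg σ rp)) (++-assoc (encodeTuples (proc a)) _ rest) sg
      le₁ : reg σ rp + length (encodeTuples (proc a) ++ concatMap (encodeTuples ∘ proc) as ++ rest) ≤ reg σ wp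
      le₁ = subst (λ l → reg σ rp + length l ≤ reg σ wp) (++-assoc (encodeTuples (proc a)) _ rest) le
      le₂ : reg σ rp + length (encodeTuples (proc a)) + length (concatMap (encodeTuples ∘ proc) as ++ rest) ≤ reg σ wp
      le₂ = subst (_≤ reg σ wp) (trans (cong (reg σ rp +_) (length-++ (encodeTuples (proc a)))) (sym (+-assoc (reg σ rp) _ _))) le₁
      le₃ : reg σ g + length (encodeEntries (es a)) + length (concatMap (encodeEntries ∘ es) as) ≤ reg σ wp
      le₃ = subst (_≤ reg σ wp) (trans (cong (reg σ g +_) (length-++ (encodeEntries (es a)))) (sym (+-assoc (reg σ g) _ _))) le′
      bound : suc (((170 + 20 * K) * length (encodeTuples (proc a)) + 50 * length (gen′ (reg σ U) a))
                + suc ((171 + 20 * K) * length (concatMap (encodeTuples ∘ proc) as) + 50 * (length as * B)))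
              ≤ suc ((171 + 20 * K) * length (concatMap (encodeTuples ∘ proc) (a ∷ as)) + 50 * (suc (length as) * B))
      bound = begin
        suc (((170 + 20 * K) * X + 50 * length (gen′ (reg σ U) a)) + suc ((171 + 20 * K) * Y + 50 * (l * B)))
          ≤⟨ s≤s (+-monoˡ-≤ _ (+-monoʳ-≤ ((170 + 20 * K) * X) (*-monoʳ-≤ 50 b))) ⟩
        suc (((170 + 20 * K) * X + 50 * B) + suc ((171 + 20 * K) * Y + 50 * (l * B)))
          ≡⟨ lemma₁ K X Y B l ⟩
        suc ((170 + 20 * K) * X + 1 + ((171 + 20 * K) * Y + 50 * (suc l * B)))
          -- The terminator 3 in the block of the node pays for the test of the loop.
          ≤⟨ s≤s (+-monoˡ-≤ _ (+-monoʳ-≤ ((170 + 20 * K) * X) pos)) ⟩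
        suc ((170 + 20 * K) * X + X + ((171 + 20 * K) * Y + 50 * (suc l * B)))
          ≡⟨ lemma₂ K X Y (50 * (suc l * B)) ⟩
        suc ((171 + 20 * K) * (X + Y) + 50 * (suc l * B))
          ≡⟨ cong (λ z → suc ((171 + 20 * K) * z + 50 * (suc l * B))) (sym (length-++ (encodeTuples (proc a)))) ⟩
        _ ∎
        where
        open ≤-Reasoning
        X = length (encodeTuples (proc a))
        Y = length (concatMap (encodeTuples ∘ proc) as)
        l = length as
        pos : 1 ≤ X
        pos = subst (1 ≤_) (sym (trans (length-++ (concatMap encodeTuple (proc a))) (+-comm _ 1))) (s≤s z≤n)
        lemma₁ : ∀ K X Y B l → (1 + (((170 + 20 * K) * X + 50 * B) + (1 + ((171 + 20 * K) * Y + 50 * (l * B)))))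
                               ≡ (1 + ((170 + 20 * K) * X + 1 + ((171 + 20 * K) * Y + 50 * ((1 + l) * B))))
        lemma₁ = solve-∀
        lemma₂ : ∀ K X Y Z → (1 + ((170 + 20 * K) * X + X + ((171 + 20 * K) * Y + Z))) ≡ (1 + ((171 + 20 * K) * (X + Y) + Z))
        lemma₂ = solve-∀

-- Codes of strings

horner-* : ∀ u a w → horner u (u * a) w ≡ u * horner 1 a w
horner-* u a []      = refl
horner-* u a (b ∷ w) = trans (cong (λ x → horner u x w) (step b)) (horner-* u _ w)
  where
  step : ∀ b → u * a + u * a + (if b then u else 0) ≡ u * (a + a + (if b then 1 else 0))
  step false = lemma u a
    where
    lemma : ∀ u a → u * a + u * a + 0 ≡ u * (a + a + 0)
    lemma = solve-∀
  step true = lemma u a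
    where
    lemma : ∀ u a → u * a + u * a + u ≡ u * (a + a + 1)
    lemma = solve-∀

binary : BitString → ℕ
binary = horner 1 1

codeOf-binary : ∀ u w → codeOf u w ≡ u * binary w
codeOf-binary u w = trans (cong (λ x → horner u x w) (sym (*-identityʳ u))) (horner-* u 1 w)

horner-< : ∀ w {a b} → a < b → horner 1 a w < b * 2 ^ length w
horner-< []      {a} {b} a<b = subst (a <_) (sym (*-identityʳ b)) a<b
horner-< (x ∷ w) {a} {b} a<b = subst (horner 1 (a + a + (if x then 1 else 0)) w <_) (*-assoc b 2 (2 ^ length w)) (horner-< w (digit< x))
  where
  double : ∀ a → a + a + 2 ≡ (1 + a) * 2
  double = solve-∀
  digit< : ∀ x → a + a + (if x then 1 else 0) < b * 2
  digit< x = <-≤-trans (+-monoʳ-< (a + a) (small x)) (≤-trans (≤-reflexive (double a)) (*-monoˡ-≤ 2 a<b))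
    where
    small : ∀ x → (if x then 1 else 0) < 2
    small false = s≤s z≤n
    small true  = s≤s (s≤s z≤n)

horner-≥ : ∀ w a → a * 2 ^ length w ≤ horner 1 a w
horner-≥ []      a = ≤-reflexive (*-identityʳ a)
horner-≥ (x ∷ w) a = ≤-trans (subst (_≤ (a + a + (if x then 1 else 0)) * 2 ^ length w) (*-assoc a 2 (2 ^ length w))
    (*-monoˡ-≤ (2 ^ length w) (≤-trans (≤-reflexive (double a)) (m≤m+n (a + a) _))))
  (horner-≥ w _)
  where
  double : ∀ a → a * 2 ≡ a + a
  double = solve-∀

binary-< : ∀ w → binary w < 2 ^ suc (length w)
binary-< w = horner-< w {1} {2} (s≤s (s≤s z≤n))

double-injective : ∀ a b x y → a + a + (if x then 1 else 0) ≡ b + b + (if y then 1 else 0) → a ≡ b × x ≡ y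
double-injective zero    zero    false false _ = refl , refl
double-injective zero    zero    true  true  _ = refl , refl
double-injective zero    (suc b) false y eq = case trans eq (cong (_+ (if y then 1 else 0)) (+-suc (suc b) b)) of λ ()
double-injective zero    (suc b) true  y eq = case suc-injective (trans eq (cong (_+ (if y then 1 else 0)) (+-suc (suc b) b))) of λ ()
double-injective (suc a) zero    x false eq = case trans (sym eq) (cong (_+ (if x then 1 else 0)) (+-suc (suc a) a)) of λ ()
double-injective (suc a) zero    x true  eq = case suc-injective (trans (sym (cong (_+ (if x then 1 else 0)) (+-suc (suc a) a))) eq) of λ ()
double-injective (suc a) (suc b) x y eq
  with double-injective a b x y (suc-injective (suc-injective (trans (sym (cong (_+ (if x then 1 else 0)) (+-suc (suc a) a)))
         (trans eq (cong (_+ (if y then 1 else 0)) (+-suc (suc b) b))))))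
... | refl , refl = refl , refl

horner-injective : ∀ w w′ a a′ → length w ≡ length w′ → horner 1 a w ≡ horner 1 a′ w′ → a ≡ a′ × w ≡ w′
horner-injective []      []        a a′ _  eq = eq , refl
horner-injective (x ∷ w) (x′ ∷ w′) a a′ le eq with horner-injective w w′ _ _ (suc-injective le) eq
... | eq′ , refl with double-injective a a′ x x′ eq′
...   | refl , refl = refl , refl

-- Because of the leading 1, `binary w` lies between `2 ^ length w` and its double, so the number
-- determines the length. Strings of equal length are then compared digit by digit.
binary-injective : ∀ {w w′} → binary w ≡ binary w′ → w ≡ w′
binary-injective {w} {w′} eq = proj₂ (horner-injective w w′ 1 1 (≤-antisym (shorter w w′ eq) (shorter w′ w (sym eq))) eq)
  where
  shorter : ∀ w w′ → binary w ≡ binary w′ → length w ≤ length w′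
  shorter w w′ eq = ≮⇒≥ λ lt → <-irrefl refl (begin-strict
    binary w′              <⟨ binary-< w′ ⟩
    2 ^ suc (length w′)    ≤⟨ ^-monoʳ-≤ 2 lt ⟩
    2 ^ length w           ≡⟨ *-identityˡ _ ⟨
    1 * 2 ^ length w       ≤⟨ horner-≥ w 1 ⟩
    binary w               ≡⟨ eq ⟩
    binary w′              ∎)
    where open ≤-Reasoning

codeOf-injective : ∀ {u w w′} → 0 < u → codeOf u w ≡ codeOf u w′ → w ≡ w′
codeOf-injective {u@(suc _)} {w} {w′} _ eq = binary-injective
  (*-cancelˡ-≡ (binary w) (binary w′) u (trans (sym (codeOf-binary u w)) (trans eq (codeOf-binary u w′))))

-- Accepting states are stamped with the number of their core, so the table of
-- stamps needs no clearing between cores.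

_∈?_ : (w : BitString) (ws : List BitString) → Dec (w ∈ ws)
_∈?_ = Data.List.Membership.DecPropositional._∈?_ (≡-dec Bool._≟_)

rejected : List BitString → BitString → ℕ
rejected acc w = if does (w ∈? acc) then 0 else 1

stamp : ℕ → ℕ → List BitString → (ℕ → ℕ) → ℕ → ℕ
stamp u j []       h = h
stamp u j (w ∷ ws) h = stamp u j ws (h [ codeOf u w ↦ j ])

stamp-keep : ∀ {u j} ws {h x} → h x ≡ j → stamp u j ws h x ≡ j
stamp-keep []       e = e
stamp-keep {u} {j} (w ∷ ws) {h} {x} e = stamp-keep ws updated
  where
  updated : (h [ codeOf u w ↦ j ]) x ≡ j
  updated with codeOf u w ≟ x
  ... | yes refl = update-same h (codeOf u w)
  ... | no ≢x    = trans (update-other h ≢x) e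

stamp-∈ : ∀ {u j} ws {h w} → w ∈ ws → stamp u j ws h (codeOf u w) ≡ j
stamp-∈ {u} (w ∷ ws) {h} (here refl) = stamp-keep ws (update-same h (codeOf u w))
stamp-∈     (w ∷ ws)     (there w∈)  = stamp-∈ ws w∈

stamp-∉ : ∀ {u j} ws {h w} → 0 < u → ¬ w ∈ ws → stamp u j ws h (codeOf u w) ≡ h (codeOf u w)
stamp-∉ []       u>0 w∉ = refl
stamp-∉ (x ∷ ws) {h} u>0 w∉ = trans (stamp-∉ ws u>0 (w∉ ∘ there))
  (update-other h (w∉ ∘ here ∘ sym ∘ codeOf-injective u>0))

stamp-≤ : ∀ {u j} ws {h} → (∀ x → h x ≤ j) → ∀ x → stamp u j ws h x ≤ j
stamp-≤ []       h≤ = h≤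
stamp-≤ {u} {j} (w ∷ ws) {h} h≤ = stamp-≤ ws updated
  where
  updated : ∀ x → (h [ codeOf u w ↦ j ]) x ≤ j
  updated x with codeOf u w ≟ x
  ... | yes refl = ≤-reflexive (update-same h (codeOf u w))
  ... | no ≢x    = ≤-trans (≤-reflexive (update-other h ≢x)) (h≤ x)

-- Cells stamped by earlier cores, or never, hold at most `j`. So it does no harm that codes of
-- different cores, formed with different units, may coincide.
stamp-rejected : ∀ {u j} acc {h} → 0 < u → (∀ x → h x ≤ j) → ∀ w →
                 clamp (suc j ∸ stamp u (suc j) acc h (codeOf u w)) ≡ rejected acc w
stamp-rejected {u} {j} acc {h} u>0 h≤ w with w ∈? acc
... | yes w∈ rewrite stamp-∈ {u} {suc j} acc {h} w∈ | n∸n≡0 j = refl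
... | no w∉ rewrite stamp-∉ {u} {suc j} acc {h} u>0 w∉ = lemma (h≤ (codeOf u w))
  where
  lemma : ∀ {x j} → x ≤ j → clamp (suc j ∸ x) ≡ 1
  lemma {x} {j} x≤j rewrite +-∸-assoc 1 x≤j = refl

acceptLoop : ℕ → Program
acceptLoop j = whilenz c (parseString ⨾ (const t j ⨾ store 4 code t) ⨾ peek)

accept-loop : ∀ j acc {σ} → Seg (io σ) (reg σ rp) (encodeTuples (map Vec.[_] acc)) →
  reg σ c ≡ 3 ∸ io σ (reg σ rp) →
  Run (acceptLoop j) σ (23 * length (encodeTuples (map Vec.[_] acc))) (λ σ′ →
    suc (reg σ′ rp) ≡ reg σ rp + length (encodeTuples (map Vec.[_] acc)) ×
    arr σ′ 4 ≡ stamp (reg σ U) j acc (arr σ 4))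
accept-loop j [] {σ} (h , _) c≡ =
  weaken (s≤s z≤n) (whileEnd (trans c≡ (cong (3 ∸_) h)) (sym (+-comm (reg σ rp) 1) , refl))
accept-loop j (w ∷ acc) {σ} sg c≡ =
  weaken bound
  (whileStep {T = 23 * length rest} (λ z → encodeString-head w rest sg₁ (trans (sym c≡) z))
    (framed (_▷_ {T = 5} {R = λ σ₁ → reg σ₁ rp ≡ reg σ rp + length (encodeString w) ×
                               arr σ₁ 4 ≡ arr σ 4 [ codeOf (reg σ U) w ↦ j ] × reg σ₁ c ≡ 3 ∸ io σ₁ (reg σ₁ rp)}
       (framed (parseString-run w (Seg-++ˡ (encodeString w) sg₁)))
       λ { {σ₁} ((code≡ , rp≡) , fr) → (const t j ⨾ store 4 code t) , refl ▸
           block peek refl (rp≡ , cong₂ (λ f x → f [ x ↦ j ]) (arrs fr 4 refl) code≡ , refl) }))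
    λ { {σ₁} ((rp≡ , a≡ , c≡′) , fr) →
      accept-loop j acc
        (subst₂ (λ f i → Seg f i rest) (sym (arrs fr 0 refl)) (sym rp≡) (Seg-++ʳ (encodeString w) sg₁)) c≡′ ⟫
      λ { (rp≡₂ , a≡₂) →
        trans rp≡₂ (trans (cong (_+ length rest) rp≡) (trans (+-assoc (reg σ rp) _ _) (cong (reg σ rp +_) (sym len≡)))) ,
        trans a≡₂ (cong₂ (λ u h → stamp u j acc h) (regs fr U refl) a≡) } })
  where
  rest : List ℕ
  rest = encodeTuples (map Vec.[_] acc)
  stream≡ : encodeTuples (map Vec.[_] (w ∷ acc)) ≡ encodeString w ++ rest
  stream≡ = trans (encodeTuples-∷ (w ∷ []) (map Vec.[_] acc)) (cong (_++ rest) (++-identityʳ (encodeString w)))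
  len≡ : length (encodeTuples (map Vec.[_] (w ∷ acc))) ≡ length (encodeString w) + length rest
  len≡ = trans (cong length stream≡) (length-++ (encodeString w))
  sg₁ : Seg (io σ) (reg σ rp) (encodeString w ++ rest)
  sg₁ = subst (Seg (io σ) (reg σ rp)) stream≡ sg
  bound : suc (17 * length (encodeString w) + 5 + 23 * length rest) ≤ 23 * length (encodeTuples (map Vec.[_] (w ∷ acc)))
  bound = begin
    suc (17 * X + 5 + 23 * Y)      ≡⟨ lemma₁ X Y ⟩
    17 * X + 6 * 1 + 23 * Y        ≤⟨ +-monoˡ-≤ (23 * Y) (+-monoʳ-≤ (17 * X) (*-monoʳ-≤ 6 (subst (1 ≤_) (sym (encodeString-length w)) (s≤s z≤n)))) ⟩
    17 * X + 6 * X + 23 * Y        ≡⟨ lemma₂ X Y ⟩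
    23 * (X + Y)                   ≡⟨ cong (23 *_) (sym len≡) ⟩
    _ ∎
    where
    open ≤-Reasoning
    X = length (encodeString w)
    Y = length rest
    lemma₁ : ∀ X Y → (1 + (17 * X + 5 + 23 * Y)) ≡ 17 * X + 6 * 1 + 23 * Y
    lemma₁ = solve-∀
    lemma₂ : ∀ X Y → 17 * X + 6 * X + 23 * Y ≡ 23 * (X + Y)
    lemma₂ = solve-∀

-- Phases, one for each core

doubling : Program
doubling = whilenz cnt (add U U U ⨾ dec cnt)

-- Repeated doubling replaces the multiplication that the machine does not offer. It is affordable
-- because `L` is the length of output that has already been written.
doubling-run : ∀ L {σ} → reg σ cnt ≡ L → Run doubling σ (suc (4 * L)) (λ σ′ → reg σ′ U ≡ reg σ U * 2 ^ L)
doubling-run zero    c≡ = whileEnd c≡ (sym (*-identityʳ _))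
doubling-run (suc L) {σ} c≡ =
  weaken (≤-reflexive (cong suc (sym (*-suc 4 L))))
  (whileStep {T = suc (4 * L)} {Q = λ σ₁ → reg σ₁ cnt ≡ L × reg σ₁ U ≡ reg σ U + reg σ U}
    (λ z → case trans (sym c≡) z of λ ())
    (block (add U U U ⨾ dec cnt) refl (cong (_∸ 1) c≡ , refl))
    λ { (c≡′ , U≡) → doubling-run L c≡′ ⟫ λ e →
      trans e (trans (cong (_* 2 ^ L) U≡) (eq (reg σ U) (2 ^ L))) })
  where
  eq : ∀ a b → (a + a) * b ≡ a * (2 * b)
  eq = solve-∀

-- The old generation is read from `g` while the new one grows at the end of the log; `ng` remembers
-- where it starts.
phase : Program → (j wgt : ℕ) → Program
phase ρ j wgt = peek ⨾ acceptLoop j ⨾ (inc rp ⨾ move ng wp ⨾ move cnt n ⨾ const k 0) ⨾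
                whilenz cnt (node ρ j wgt) ⨾ (move g ng ⨾ move cnt len) ⨾ doubling

phases : ∀ r → (Fin r → Program) → (j wgt : ℕ) → Program
phases zero    ρ j wgt = skip
phases (suc r) ρ j wgt = phase (sim (ρ zero)) (suc j) wgt ⨾ phases r (ρ ∘ suc) (suc j) (2 * wgt)

phases-reg : ∀ r ρ j wgt x → writesReg (phase skip 0 0) (8 + x) ≡ false → writesReg (phases r ρ j wgt) (8 + x) ≡ false
phases-reg zero    ρ j wgt x h = refl
phases-reg (suc r) ρ j wgt x h rewrite sim-reg (ρ zero) x | h = phases-reg r (ρ ∘ suc) (suc j) (2 * wgt) x h

phases-arr : ∀ r ρ j wgt a → (a <ᵇ 7) ≡ true → writesArr (phase skip 0 0) (suc a) ≡ false →
             writesArr (phases r ρ j wgt) (suc a) ≡ false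
phases-arr zero    ρ j wgt a a<7 h = refl
phases-arr (suc r) ρ j wgt a a<7 h rewrite sim-arr (ρ zero) a a<7 | h = phases-arr r (ρ ∘ suc) (suc j) (2 * wgt) a a<7 h

phases-writes : ∀ r ρ j wgt → writes (phases r ρ j wgt) ≡ false
phases-writes zero    ρ j wgt = refl
phases-writes (suc r) ρ j wgt rewrite sim-writes (ρ zero) = phases-writes r (ρ ∘ suc) (suc j) (2 * wgt)

-- A record, so that `ρ`, `p` and `K` can be inferred from a proof of it.
record Evaluates (ρ : BitString → Bool) (p : Program) (K : ℕ) : Set where
  field
    evaluates : ∀ w → ∃[ t ] Computes p (encodeString w) [ bit (ρ w) ] t × t ≤ K * suc (length w)

phasesCost : ∀ r → (Fin r → ℕ) → ℕ
phasesCost zero    K = 1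
phasesCost (suc r) K = 284 + 20 * K zero + phasesCost r (K ∘ suc)

-- For the phases a decomposition is a mere list of nodes with arities. The tree structure is hidden
-- in the first generation `es`.
module Phases {N : Set} (deg : N → ℕ) (deg≤2 : ∀ a → deg a ≤ 2) (as : List N) where

  Transitions : Set
  Transitions = ∀ a → List (Vec BitString (suc (deg a)))

  coreStream : List BitString → Transitions → List ℕ
  coreStream acc proc = encodeTuples (map Vec.[_] acc) ++ concatMap (encodeTuples ∘ proc) as

  generation : (N → List Entry) → List ℕ
  generation es = concatMap (encodeEntries ∘ es) as

  record PhaseInv (es : N → List Entry) (j : ℕ) (stream : List ℕ) (u L : ℕ) (σ : State) : Set where
    constructor phaseInv
    field
      clean   : Clean σ
      count   : reg σ n ≡ length as
      len≡    : reg σ len ≡ L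
      unit    : reg σ U ≡ u
      degs    : Seg (arr σ 1) 1 (map deg as)
      outs    : Seg (io σ) (reg σ rp) stream
      outs≤   : reg σ rp + length stream ≤ reg σ wp
      gen     : Seg (io σ) (reg σ g) (generation es)
      gen≤    : reg σ g + length (generation es) ≤ reg σ wp
      stamps  : ∀ x → arr σ 4 x ≤ j

  extendAll : (BitString → Bool) → List BitString → Transitions → (wgt u : ℕ) →
              (N → List Entry) → N → List Entry
  extendAll ρ acc proc wgt u es a = extend (tupleEntry ρ (rejected acc) wgt u) (proc a) (es a)

  phase-run : ∀ {ρ p K} → Evaluates ρ p K → ∀ acc proc {es j wgt u L B rest σ} →
    All (λ a → proc a ≢ []) as → 0 < u →
    All (λ a → length (extendAll ρ acc proc wgt u es a) ≤ B) as →
    PhaseInv es j (coreStream acc proc ++ rest) u L σ →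
    Run (phase (sim p) (suc j) wgt) σ
      (30 + (200 + 20 * K) * length (coreStream acc proc) + 50 * (length as * B) + 4 * L)
      (PhaseInv (extendAll ρ acc proc wgt u es) (suc j) rest (u * 2 ^ L) L)
  phase-run {ρ} {p} {K} ev acc proc {es} {j} {wgt} {u} {L} {B} {rest} {σ} nes u>0 bs (phaseInv cl n≡ L≡ refl ds sg le sg′ le′ st) =
    weaken bound
    (peek , refl ▸ framed (accept-loop (suc j) acc (Seg-++ˡ A sg₁) refl) ▷
    λ { {σ₂} ((rp₂ , acc₂) , fr₂) →
    (inc rp ⨾ move ng wp ⨾ move cnt n ⨾ const k 0) , refl ▸
    (let io≡ : io σ₂ ≡ io σ
         io≡ = arrs fr₂ 0 refl
         wp≡ : reg σ₂ wp ≡ reg σ wp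
         wp≡ = regs fr₂ wp refl
         U≡ : reg σ₂ U ≡ u
         U≡ = regs fr₂ U refl
         g≡ : reg σ₂ g ≡ reg σ g
         g≡ = regs fr₂ g refl
     in
    framed (E.nodes-loop deg deg≤2 proc es as B nes
      (Clean-frame fr₂ refl (λ _ → refl) cl)
      (λ w → trans (cong₂ (λ f v → clamp (suc j ∸ f (codeOf v w))) acc₂ U≡) (stamp-rejected acc u>0 st w))
      (subst (λ v → All (λ a → length (extendAll ρ acc proc wgt v es a) ≤ B) as) (sym U≡) bs)
      (trans (regs fr₂ n refl) n≡)
      (subst (λ f → Seg f 1 (map deg as)) (sym (arrs fr₂ 1 refl)) ds)
      rest
      (subst₂ (λ f i → Seg f i (P ++ rest)) (sym io≡) (sym rp₂) (Seg-++ʳ A sg₁))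
      (subst₂ (λ i w → i + length (P ++ rest) ≤ w) (sym rp₂) (sym wp≡) le₁)
      (subst₂ (λ f i → Seg f i (generation es)) (sym io≡) (sym g≡) sg′)
      (subst₂ (λ i w → i + length (generation es) ≤ w) (sym g≡) (sym wp≡) le′)) ▷
    λ { {σ₄} ((cl₄ , rp₄ , gr) , fr₄) →
    (move g ng ⨾ move cnt len) , refl ▸
    framed (doubling-run L (trans (regs fr₄ len (nodesReg 1 refl)) (trans (regs fr₂ len refl) L≡))) ⟫
    λ { {σ₆} (U₆ , fr₆) →
      let es′ = extendAll ρ acc proc wgt u es
          wp₆ : reg σ₆ wp ≡ reg σ₄ wp
          wp₆ = regs fr₆ wp refl
          g₆ : reg σ₆ g ≡ reg σ wp
          g₆ = trans (regs fr₆ g refl) (trans (regs fr₄ ng (nodesReg 25 refl)) wp≡)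
          rp₆ : reg σ₆ rp ≡ reg σ rp + length A + length P
          rp₆ = trans (regs fr₆ rp refl) (trans rp₄ (cong (_+ length P) rp₂))
          end : reg σ₄ wp ≡ reg σ wp + length (generation es′)
          end = trans (Grew.end gr) (cong₂ (λ w v → w + length (generation (extendAll ρ acc proc wgt v es))) wp≡ U≡)
          le₂ : reg σ rp + length A + length P + length rest ≤ reg σ wp
          le₂ = subst (_≤ reg σ wp) (trans (cong (reg σ rp + length A +_) (length-++ P)) (sym (+-assoc (reg σ rp + length A) (length P) (length rest)))) le₁
          wp≤ : reg σ wp ≤ reg σ₄ wp
          wp≤ = subst (reg σ wp ≤_) (sym end) (m≤m+n _ _)
      in phaseInv
        (Clean-frame fr₆ refl (λ _ → refl) cl₄)
        (trans (regs fr₆ n refl) (trans (regs fr₄ n (nodesReg 0 refl)) (trans (regs fr₂ n refl) n≡)))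
        (trans (regs fr₆ len refl) (trans (regs fr₄ len (nodesReg 1 refl)) (trans (regs fr₂ len refl) L≡)))
        (trans U₆ (cong (_* 2 ^ L) (trans (regs fr₄ U (nodesReg 7 refl)) U≡)))
        (subst (λ f → Seg f 1 (map deg as)) (sym (trans (arrs fr₆ 1 refl) (trans (arrs fr₄ 1 (nodesArr 0 refl)) (arrs fr₂ 1 refl)))) ds)
        (subst₂ (λ f i → Seg f i rest) (sym (arrs fr₆ 0 refl)) (sym rp₆)
          (Seg-≈ rest (Grew.kept gr) (subst (reg σ rp + length A + length P + length rest ≤_) (sym wp≡) le₂)
            (subst (λ f → Seg f (reg σ rp + length A + length P) rest) (sym io≡) (Seg-++ʳ P (Seg-++ʳ A sg₁)))))
        (subst₂ (λ i w → i + length rest ≤ w) (sym rp₆) (sym wp₆) (≤-trans le₂ wp≤))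
        (subst₂ (λ f i → Seg f i (generation es′)) (sym (arrs fr₆ 0 refl)) (sym g₆)
          (subst₂ (λ w v → Seg (io σ₄) w (generation (extendAll ρ acc proc wgt v es))) wp≡ U≡ (Grew.new gr)))
        (subst₂ (λ i w → i + length (generation es′) ≤ w) (sym g₆) (sym wp₆) (≤-reflexive (sym end)))
        (subst (λ f → ∀ x → f x ≤ suc j) (sym (trans (arrs fr₆ 4 refl) (trans (arrs fr₄ 4 (nodesArr 3 refl)) acc₂)))
          (stamp-≤ acc (λ x → m≤n⇒m≤1+n (st x)))) } }) })
    where
    module E = Evaluator p ρ K (Evaluates.evaluates ev) (rejected acc) (suc j) wgt
    A P : List ℕ
    A = encodeTuples (map Vec.[_] acc)
    P = concatMap (encodeTuples ∘ proc) as
    sg₁ : Seg (io σ) (reg σ rp) (A ++ P ++ rest)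
    sg₁ = subst (Seg (io σ) (reg σ rp)) (++-assoc A P rest) sg
    le₁ : reg σ rp + length A + length (P ++ rest) ≤ reg σ wp
    le₁ = subst (_≤ reg σ wp) (trans (cong (reg σ rp +_) (trans (cong length (++-assoc A P rest)) (length-++ A)))
            (sym (+-assoc (reg σ rp) _ _))) le
    nodesReg : ∀ x → writesReg (node skip (suc j) wgt) (8 + x) ≡ false →
               writesReg (whilenz cnt (node (sim p) (suc j) wgt)) (8 + x) ≡ false
    nodesReg = node-reg p (suc j) wgt
    nodesArr : ∀ a → (a <ᵇ 7) ≡ true → writesArr (whilenz cnt (node (sim p) (suc j) wgt)) (suc a) ≡ false
    nodesArr = node-arr p (suc j) wgt
    bound : 3 + (23 * length A + (7 + (suc ((171 + 20 * K) * length P + 50 * (length as * B)) + (4 + suc (4 * L)))))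
            ≤ 30 + (200 + 20 * K) * length (coreStream acc proc) + 50 * (length as * B) + 4 * L
    bound = begin
      3 + (23 * length A + (7 + (suc ((171 + 20 * K) * length P + 50 * (length as * B)) + (4 + suc (4 * L)))))
        ≤⟨ m≤m+n _ (14 + 177 * length A + 20 * K * length A + 29 * length P) ⟩
      _ ≡⟨ lemma K (length A) (length P) (50 * (length as * B)) (4 * L) ⟩
      30 + (200 + 20 * K) * (length A + length P) + 50 * (length as * B) + 4 * L
        ≡⟨ cong (λ l → 30 + (200 + 20 * K) * l + 50 * (length as * B) + 4 * L) (sym (length-++ A)) ⟩
      _ ∎
      where
      open ≤-Reasoning
      lemma : ∀ K A P X Y → 3 + (23 * A + (7 + (1 + ((171 + 20 * K) * P + X) + (4 + (1 + Y))))) + (14 + 177 * A + 20 * K * A + 29 * P)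
                            ≡ 30 + (200 + 20 * K) * (A + P) + X + Y
      lemma = solve-∀

  streams : ∀ r → (Fin r → List BitString) → (Fin r → Transitions) → List ℕ
  streams zero    acc proc = []
  streams (suc r) acc proc = coreStream (acc zero) (proc zero) ++ streams r (acc ∘ suc) (proc ∘ suc)

  generations : ∀ r → (Fin r → BitString → Bool) → (Fin r → List BitString) → (Fin r → Transitions) →
                (wgt u L : ℕ) → (N → List Entry) → N → List Entry
  generations zero    ρ acc proc wgt u L es = es
  generations (suc r) ρ acc proc wgt u L es =
    generations r (ρ ∘ suc) (acc ∘ suc) (proc ∘ suc) (2 * wgt) (u * 2 ^ L) L
      (extendAll (ρ zero) (acc zero) (proc zero) wgt u es)

  extend-length : ∀ {m} (conv : Vec BitString m → Entry) ts es → length (extend conv ts es) ≡ length ts * length es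
  extend-length conv []       es = refl
  extend-length conv (v ∷ ts) es = trans (length-++ (map (_⊞ conv v) es))
    (cong₂ _+_ (length-map (_⊞ conv v) es) (extend-length conv ts es))

  product-positive : ∀ {r} (xs : Fin r → ℕ) → (∀ i → 1 ≤ xs i) → 1 ≤ product (tabulate xs)
  product-positive {zero}  xs pos = ≤-refl
  product-positive {suc r} xs pos = *-mono-≤ (pos zero) (product-positive (xs ∘ suc) (pos ∘ suc))

  length-positive : ∀ {A : Set} {xs : List A} → xs ≢ [] → 1 ≤ length xs
  length-positive {xs = []}    ne = contradiction refl ne
  length-positive {xs = _ ∷ _} ne = s≤s z≤n

  -- The invariant behind `B`: the number of entries of a node, times the sizes of its sets of
  -- tuples still to come, does not change from phase to phase. As these sizes are positive, every
  -- generation has at most `B` entries per node, although `B` initially bounds the full product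
  -- only.
  phases-run : ∀ r {ρ p K} → (∀ i → Evaluates (ρ i) (p i) (K i)) → ∀ acc proc {es j wgt u L B X σ} →
    (∀ i a → proc i a ≢ []) → 0 < u →
    (∀ a → length (es a) * product (tabulate λ i → length (proc i a)) ≤ B) →
    length (streams r acc proc) ≤ X → length as * B ≤ X → L ≤ X → 1 ≤ X →
    PhaseInv es j (streams r acc proc) u L σ →
    Run (phases r p j wgt) σ (phasesCost r K * X)
      (λ σ′ → ∃[ j′ ] ∃[ u′ ] PhaseInv (generations r ρ acc proc wgt u L es) j′ [] u′ L σ′)
  phases-run zero    ev acc proc nes u>0 bs _ _ _ 1≤X inv =
    weaken (≤-trans 1≤X (≤-reflexive (sym (+-identityʳ _)))) (block skip refl (_ , _ , inv))
  phases-run (suc r) {ρ} {K = K} ev acc proc {es} {j} {wgt} {u} {L} {B} {X} nes u>0 bs s≤X b≤X L≤X 1≤X inv =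
    weaken (≤-trans (+-monoˡ-≤ _ bound) (≤-reflexive (sym (*-distribʳ-+ X (284 + 20 * K zero) (phasesCost r (K ∘ suc))))))
    (phase-run (ev zero) (acc zero) (proc zero) (All.tabulate (λ {a} _ → nes zero a)) u>0 (All.tabulate (λ {a} _ → first a)) inv ▷
     phases-run r (ev ∘ suc) (acc ∘ suc) (proc ∘ suc) (nes ∘ suc) (*-mono-≤ u>0 (m^n>0 2 L)) later
       (≤-trans (subst (length (streams r (acc ∘ suc) (proc ∘ suc)) ≤_) (sym (length-++ C)) (m≤n+m _ _)) s≤X) b≤X L≤X 1≤X)
    where
    C : List ℕ
    C = coreStream (acc zero) (proc zero)
    es′ : N → List Entry
    es′ = extendAll (ρ zero) (acc zero) (proc zero) wgt u es
    rest : N → ℕ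
    rest a = product (tabulate λ i → length (proc (suc i) a))
    later : ∀ a → length (es′ a) * rest a ≤ B
    later a = ≤-trans (≤-reflexive (trans (cong (_* rest a) (extend-length _ (proc zero a) (es a)))
      (lemma (length (proc zero a)) (length (es a)) (rest a)))) (bs a)
      where
      lemma : ∀ x y z → x * y * z ≡ y * (x * z)
      lemma = solve-∀
    first : ∀ a → length (es′ a) ≤ B
    first a = ≤-trans (≤-trans (≤-reflexive (sym (*-identityʳ _)))
      (*-monoʳ-≤ (length (es′ a)) (product-positive _ (λ i → length-positive (nes (suc i) a))))) (later a)
    bound : 30 + (200 + 20 * K zero) * length C + 50 * (length as * B) + 4 * L ≤ (284 + 20 * K zero) * X
    bound = begin
      30 + (200 + 20 * K zero) * length C + 50 * (length as * B) + 4 * L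
        ≤⟨ +-mono-≤ (+-mono-≤ (+-mono-≤ (*-monoʳ-≤ 30 1≤X) (*-monoʳ-≤ (200 + 20 * K zero)
             (≤-trans (subst (length C ≤_) (sym (length-++ C)) (m≤m+n _ _)) s≤X))) (*-monoʳ-≤ 50 b≤X)) (*-monoʳ-≤ 4 L≤X) ⟩
      30 * X + (200 + 20 * K zero) * X + 50 * X + 4 * X
        ≡⟨ lemma (K zero) X ⟩
      (284 + 20 * K zero) * X ∎
      where
      open ≤-Reasoning
      lemma : ∀ K X → 30 * X + (200 + 20 * K) * X + 50 * X + 4 * X ≡ (284 + 20 * K) * X
      lemma = solve-∀

-- The end of the copied input in the log, which is also where the outputs of the cores begin.
inl : Register
inl = 34

-- Reading the input

read-run : ∀ {x y ys σ} → input σ ≡ y ∷ ys →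
           Run (read x) σ 1 (λ σ′ → σ′ ≡ record (setReg σ x y) { input = ys })
read-run {σ = state _ _ _ _} refl = ran ⇓read∷ ≤-refl refl

readLoop : Program
readLoop = whilenz cnt (read e₀ ⨾ push e₀ ⨾ dec cnt)

read-loop : ∀ xs {σ} → reg σ cnt ≡ length xs → input σ ≡ xs → Run readLoop σ (suc (7 * length xs)) (Grew xs σ)
read-loop [] c≡ _ = whileEnd c≡ (grew (λ _ _ → refl) tt (sym (+-identityʳ _)))
read-loop (x ∷ xs) {σ} c≡ i≡ =
  weaken (≤-reflexive (cong suc (sym (*-suc 7 (length xs)))))
  (whileStep {T = suc (7 * length xs)} {Q = λ σ₁ → reg σ₁ cnt ≡ length xs × input σ₁ ≡ xs × Grew [ x ] σ σ₁}
    (λ z → case trans (sym c≡) z of λ ())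
    (read-run i≡ ▷ λ { refl → block (push e₀ ⨾ dec cnt) refl
      (cong (_∸ 1) c≡ , refl , grew (≈-update ≤-refl) (update-same (io σ) (reg σ wp) , tt) (sym (+-comm (reg σ wp) 1))) })
    λ { (c≡′ , i≡′ , gr) → read-loop xs c≡′ i≡′ ⟫ Grew-trans gr })

-- The end of the input cannot be detected, since reading past it yields 0. Its length follows from
-- the first number `n`: the width and three numbers for each node come after it.
readInput : Program
readInput = read n ⨾ (push n ⨾ add cnt n n ⨾ add cnt cnt n ⨾ inc cnt) ⨾ readLoop ⨾ move inl wp

readInput-run : ∀ m xs {σ} → length xs ≡ suc (m + m + m) → input σ ≡ m ∷ xs →
  Run readInput σ (11 + 7 * length xs) (λ σ′ → Grew (m ∷ xs) σ σ′ × reg σ′ n ≡ m × reg σ′ inl ≡ reg σ′ wp)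
readInput-run m xs {σ} len≡ i≡ = weaken (≤-reflexive (lemma (7 * length xs)))
  (read-run i≡ ▷ λ { refl → (push n ⨾ add cnt n n ⨾ add cnt cnt n ⨾ inc cnt) , refl ▸
    (framed (read-loop xs (sym len≡) refl) ▷ λ { (gr , fr) → block (move inl wp) refl
      (Grew-trans {σ = σ} {⟦ push n ⨾ add cnt n n ⨾ add cnt cnt n ⨾ inc cnt ⟧ (record (setReg σ n m) { input = xs })} (grew (≈-update ≤-refl) (update-same (io σ) (reg σ wp) , tt) (sym (+-comm (reg σ wp) 1)))
                  (grew (Grew.kept gr) (Grew.new gr) (Grew.end gr))
      , regs fr n refl , refl) }) })
  where
  lemma : ∀ l → 1 + (7 + (suc l + 2)) ≡ 11 + l
  lemma l = cong (9 +_) (+-comm l 2)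

-- Tables of values indexed by bit vectors

index : ∀ {r} → Vec Bool r → ℕ
index []      = 0
index (b ∷ v) = bit b + 2 * index v

index-injective : ∀ {r} (v w : Vec Bool r) → index v ≡ index w → v ≡ w
index-injective []      []      _  = refl
index-injective (b ∷ v) (c ∷ w) eq with double-injective (index v) (index w) b c (trans (sym (shape b v)) (trans eq (shape c w)))
  where
  shape : ∀ {r} b (v : Vec Bool r) → index (b ∷ v) ≡ index v + index v + (if b then 1 else 0)
  shape false v = lemma (index v)
    where
    lemma : ∀ i → 0 + 2 * i ≡ i + i + 0
    lemma = solve-∀
  shape true v = lemma (index v)
    where
    lemma : ∀ i → 1 + 2 * i ≡ i + i + 1
    lemma = solve-∀
... | i≡ , refl = cong (b ∷_) (index-injective v w i≡)

allVecs : ∀ r → List (Vec Bool r)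
allVecs zero    = [ [] ]
allVecs (suc r) = map (false ∷_) (allVecs r) ++ map (true ∷_) (allVecs r)

∈-allVecs : ∀ {r} (v : Vec Bool r) → v ∈ allVecs r
∈-allVecs []          = here refl
∈-allVecs (false ∷ v) = ∈-++⁺ˡ (∈-map⁺ (false ∷_) (∈-allVecs v))
∈-allVecs (true ∷ v)  = ∈-++⁺ʳ (map (false ∷_) (allVecs _)) (∈-map⁺ (true ∷_) (∈-allVecs v))

tabulated : ∀ {r} → (Vec Bool r → ℕ) → List (Vec Bool r) → (ℕ → ℕ) → ℕ → ℕ
tabulated f []       h = h
tabulated f (v ∷ vs) h = tabulated f vs (h [ index v ↦ f v ])

tabulated-keep : ∀ {r} f vs {h} (v : Vec Bool r) → h (index v) ≡ f v → tabulated f vs h (index v) ≡ f v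
tabulated-keep f []       v e = e
tabulated-keep f (x ∷ vs) {h} v e = tabulated-keep f vs v updated
  where
  updated : (h [ index x ↦ f x ]) (index v) ≡ f v
  updated with index x ≟ index v
  ... | yes eq with refl ← index-injective x v eq = update-same h (index x)
  ... | no ≢v  = trans (update-other h ≢v) e

tabulated-∈ : ∀ {r} f vs {h} {v : Vec Bool r} → v ∈ vs → tabulated f vs h (index v) ≡ f v
tabulated-∈ f (x ∷ vs) {h} (here refl) = tabulated-keep f vs x (update-same h (index x))
tabulated-∈ f (x ∷ vs)     (there v∈)  = tabulated-∈ f vs v∈

-- The values of `f` are constants in the program text, one block for each vector, so the time
-- depends on `r` but not on the size of the values.
fill : ∀ {r} → (Vec Bool r → ℕ) → List (Vec Bool r) → Program
fill f []       = skip
fill f (v ∷ vs) = (const e₀ (index v) ⨾ const e₁ (f v) ⨾ store 3 e₀ e₁) ⨾ fill f vs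

fill-run : ∀ {r} (f : Vec Bool r → ℕ) vs {σ} →
           Run (fill f vs) σ (suc (3 * length vs)) (λ σ′ → arr σ′ 3 ≡ tabulated f vs (arr σ 3))
fill-run f []       = block skip refl refl
fill-run f (v ∷ vs) = weaken (≤-reflexive (trans (+-suc 3 _) (cong suc (sym (*-suc 3 (length vs))))))
  ((const e₀ (index v) ⨾ const e₁ (f v) ⨾ store 3 e₀ e₁) , refl ▸ fill-run f vs)

fill-reg : ∀ {r} f (vs : List (Vec Bool r)) x → does (e₀ ≟ x) ≡ false → does (e₁ ≟ x) ≡ false →
           writesReg (fill f vs) x ≡ false
fill-reg f []       x _  _  = refl
fill-reg f (v ∷ vs) x h₀ h₁ = cong₂ _∨_ (cong₂ _∨_ h₀ (cong₂ _∨_ h₁ refl)) (fill-reg f vs x h₀ h₁)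

fill-arr : ∀ {r} f (vs : List (Vec Bool r)) a → does (3 ≟ a) ≡ false → writesArr (fill f vs) a ≡ false
fill-arr f []       a h = refl
fill-arr f (v ∷ vs) a h = cong₂ _∨_ h (fill-arr f vs a h)

fill-writes : ∀ {r} f (vs : List (Vec Bool r)) → writes (fill f vs) ≡ false
fill-writes f []       = refl
fill-writes f (v ∷ vs) = fill-writes f vs

-- The children of every node, found with a stack of the nodes without parent

record Stack : Set where
  constructor stack
  field
    cells : ℕ → ℕ
    size  : ℕ
    seen  : ℕ

open Stack

nonleaf : ℕ → ℕ
nonleaf zero    = 0
nonleaf (suc _) = 1

pop : ℕ → Stack → ℕ
pop m S = size S ∸ m

pushed : ℕ → Stack → Stack
pushed m S = stack (cells S [ pop m S ↦ suc (seen S) ]) (suc (pop m S)) (suc (seen S))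

-- In a postorder, the children of a node are the topmost roots on the stack, the right child on
-- top. Nodes are numbered from 1, so 0 can stand for a missing child.
startEntry : ℕ → Stack → Entry
startEntry 0             S = mkEntry (suc (seen S)) 0 0 0 0
startEntry 1             S = mkEntry (suc (seen S)) (cells S (pop 1 S)) 0 1 0
startEntry (suc (suc _)) S = mkEntry (suc (seen S)) (cells S (pop 2 S)) (cells S (pop 1 S)) 1 0

startEntries : List ℕ → Stack → List Entry
startEntries []       S = []
startEntries (m ∷ ms) S = startEntry m S ∷ startEntries ms (pushed m S)

pushedAll : List ℕ → Stack → Stack
pushedAll []       S = S
pushedAll (m ∷ ms) S = pushedAll ms (pushed m S)

stackOf : State → Stack
stackOf σ = stack (arr σ 2) (reg σ st) (reg σ k)

-- An operation occupies three numbers in the input; the first determines the arity of the node.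
fetchOp : Program
fetchOp = load s 0 gg ⨾ inc gg ⨾ inc gg ⨾ inc gg ⨾ inc k

popKids : Program
popKids = ifnz s
  ((move c s ⨾ dec c) ⨾ ifnz c
     (dec st ⨾ load e₁ 2 st ⨾ const e₂ 0 ⨾ const e₃ 1 ⨾ const ar 1)
     (dec st ⨾ load e₂ 2 st ⨾ dec st ⨾ load e₁ 2 st ⨾ const e₃ 1 ⨾ const ar 2))
  (const e₁ 0 ⨾ const e₂ 0 ⨾ const e₃ 0 ⨾ const ar 0)

pushNode : Program
pushNode = store 2 st k ⨾ inc st ⨾ store 1 k ar ⨾ const t 1 ⨾ push t ⨾ push k ⨾ push e₁ ⨾ push e₂ ⨾ push e₃ ⨾
           -- The first 0 is the number of rejected states, the second ends the list of the node.
           const e₀ 0 ⨾ push e₀ ⨾ push e₀ ⨾ dec cnt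

start : Program
start = fetchOp ⨾ popKids ⨾ pushNode

opcode : ∀ {ω} → CW ω → ℕ
opcode (intro _ _)      = 0
opcode (_ ⊕ _)          = 1
opcode (recolor _ _ _)  = 2
opcode (addEdges _ _ _) = 3

module _ {ω : ℕ} where

  popKids-run : ∀ (D : CW ω) {σ m} → reg σ s ≡ opcode D → reg σ k ≡ suc m →
    Run popKids σ 14 (λ σ′ →
      reg σ′ ar ≡ arity D × reg σ′ st ≡ pop (arity D) (stack (arr σ 2) (reg σ st) m) ×
      mkEntry (reg σ′ k) (reg σ′ e₁) (reg σ′ e₂) (reg σ′ e₃) 0 ≡ startEntry (arity D) (stack (arr σ 2) (reg σ st) m))
  popKids-run (intro _ _) s≡ k≡ = weaken (m≤m+n _ 9) (ifZero s≡ (block _ refl (refl , refl , cong (λ x → mkEntry x 0 0 0 0) k≡)))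
  popKids-run (_ ⊕ _) {σ} {m} s≡ k≡ = weaken (m≤m+n _ 0) (ifNonzero (λ z → case trans (sym s≡) z of λ ())
    ((move c s ⨾ dec c) , refl ▸ ifZero (cong (_∸ 1) s≡)
      (block _ refl (refl , ∸-+-assoc (reg σ st) 1 1 ,
        trans (cong (λ x → mkEntry x (arr σ 2 (reg σ st ∸ 1 ∸ 1)) (arr σ 2 (reg σ st ∸ 1)) 1 0) k≡)
              (cong (λ x → mkEntry (suc m) (arr σ 2 x) (arr σ 2 (reg σ st ∸ 1)) 1 0) (∸-+-assoc (reg σ st) 1 1))))))
  popKids-run (recolor _ _ _) {σ} s≡ k≡ = weaken (m≤m+n _ 2) (ifNonzero (λ z → case trans (sym s≡) z of λ ())
    ((move c s ⨾ dec c) , refl ▸ ifNonzero (λ z → case trans (sym (cong (_∸ 1) s≡)) z of λ ())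
      (block _ refl (refl , refl , cong (λ x → mkEntry x (arr σ 2 (reg σ st ∸ 1)) 0 1 0) k≡))))
  popKids-run (addEdges _ _ _) {σ} s≡ k≡ = weaken (m≤m+n _ 2) (ifNonzero (λ z → case trans (sym s≡) z of λ ())
    ((move c s ⨾ dec c) , refl ▸ ifNonzero (λ z → case trans (sym (cong (_∸ 1) s≡)) z of λ ())
      (block _ refl (refl , refl , cong (λ x → mkEntry x (arr σ 2 (reg σ st ∸ 1)) 0 1 0) k≡))))

  encodeOp-shape : ∀ (D : CW ω) → ∃[ x ] ∃[ y ] encodeOp D ≡ opcode D ∷ x ∷ y ∷ []
  encodeOp-shape (intro _ _)      = _ , _ , refl
  encodeOp-shape (_ ⊕ _)          = _ , _ , refl
  encodeOp-shape (recolor _ _ _)  = _ , _ , refl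
  encodeOp-shape (addEdges _ _ _) = _ , _ , refl

  start-loop : ∀ (Ds : List (CW ω)) {σ} → reg σ cnt ≡ length Ds →
    Seg (io σ) (reg σ gg) (concatMap encodeOp Ds) → reg σ gg + length (concatMap encodeOp Ds) ≤ reg σ wp →
    Run (whilenz cnt start) σ (suc (60 * length Ds)) (λ σ′ →
      Grew (concatMap (λ e → encodeEntries [ e ]) (startEntries (map arity Ds) (stackOf σ))) σ σ′ ×
      arr σ′ 1 ≡ put (arr σ 1) (suc (reg σ k)) (map arity Ds))
  start-loop []       c≡ _ _ = whileEnd c≡ (grew (λ _ _ → refl) tt (sym (+-identityʳ _)) , refl)
  start-loop (D ∷ Ds) {σ} c≡ sg le with x , y , op≡ ← encodeOp-shape D rewrite op≡ =
    weaken (≤-trans (m≤m+n _ 7) (≤-reflexive (lemma (length Ds))))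
    (whileStep {T = suc (60 * length Ds)} {Q = λ σ₁ → reg σ₁ cnt ≡ length Ds × reg σ₁ gg ≡ reg σ gg + 3 ×
        stackOf σ₁ ≡ pushed (arity D) (stackOf σ) × arr σ₁ 1 ≡ arr σ 1 [ suc (reg σ k) ↦ arity D ] ×
        Grew (encodeEntries [ startEntry (arity D) (stackOf σ) ]) σ σ₁}
      (λ z → case trans (sym c≡) z of λ ())
      (fetchOp , refl ▸ framed (popKids-run D {m = reg σ k} (proj₁ sg) refl) ▷ λ { {σ₁} ((ar≡ , st≡ , e≡) , fr) →
        let k≡ : reg σ₁ k ≡ suc (reg σ k)
            k≡ = regs fr k refl
            io≡ : io σ₁ ≡ io σ
            io≡ = arrs fr 0 refl
            wp≡ : reg σ₁ wp ≡ reg σ wp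
            wp≡ = regs fr wp refl
            entry = mkEntry (reg σ₁ k) (reg σ₁ e₁) (reg σ₁ e₂) (reg σ₁ e₃) 0
        in block pushNode refl
          ( trans (cong (_∸ 1) (regs fr cnt refl)) (cong (_∸ 1) c≡)
          , trans (regs fr gg refl) (+-comm 3 (reg σ gg))
          , stack≡ (arrs fr 2 refl) st≡ k≡
          , trans (cong₂ (λ h a → h [ reg σ₁ k ↦ a ]) (arrs fr 1 refl) ar≡) (cong (λ i → arr σ 1 [ i ↦ arity D ]) k≡)
          , subst (λ e → Grew (encodeEntries [ e ]) σ _) e≡
              (grew (subst₂ (λ f w → f ≈[ w ] put (io σ₁) (reg σ₁ wp) (encodeEntries [ entry ])) io≡ wp≡
                       (put-≈ (encodeEntries [ entry ]) {io σ₁} (reg σ₁ wp) ≤-refl))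
                    (subst (λ w → Seg (put (io σ₁) (reg σ₁ wp) (encodeEntries [ entry ])) w (encodeEntries [ entry ])) wp≡
                       (put-Seg (encodeEntries [ entry ]) {io σ₁} (reg σ₁ wp)))
                    (trans (cong (7 +_) wp≡) (+-comm 7 (reg σ wp)))) ) })
      λ { {σ₁} (c₁ , gg₁ , S₁ , a₁ , gr) →
        start-loop Ds c₁
          (subst (λ i → Seg (io σ₁) i (concatMap encodeOp Ds)) (sym gg₁)
            (Grew-seg gr (concatMap encodeOp Ds) le′ (subst (λ i → Seg (io σ) i (concatMap encodeOp Ds)) (+-comm 3 (reg σ gg)) (proj₂ (proj₂ (proj₂ sg))))))
          (subst (λ i → i + length (concatMap encodeOp Ds) ≤ reg σ₁ wp) (sym gg₁) (≤-trans le′ (Grew-≤ gr))) ⟫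
        λ { {σ₂} (gr₂ , a₂) →
          Grew-trans gr (subst (λ S → Grew (concatMap (λ e → encodeEntries [ e ]) (startEntries (map arity Ds) S)) σ₁ σ₂) S₁ gr₂) ,
          trans a₂ (cong₂ (λ f i → put f (suc i) (map arity Ds)) a₁ (cong seen S₁)) } })
    where
    le′ : reg σ gg + 3 + length (concatMap encodeOp Ds) ≤ reg σ wp
    le′ = subst (_≤ reg σ wp) (sym (+-assoc (reg σ gg) 3 _)) le
    stack≡ : ∀ {a a′ : ℕ → ℕ} {b b′ k k′} → a ≡ a′ → b ≡ b′ → k ≡ k′ →
             stack (a [ b ↦ k ]) (suc b) k ≡ stack (a′ [ b′ ↦ k′ ]) (suc b′) k′
    stack≡ refl refl refl = refl
    lemma : ∀ l → suc (52 + suc (60 * l)) + 7 ≡ suc (60 * suc l)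
    lemma l = cong suc (trans (+-comm (53 + 60 * l) 7) (sym (*-suc 60 l)))

findChildren : Program
findChildren = (const k 0 ⨾ move cnt n ⨾ const st 0 ⨾ const gg 2 ⨾ move g wp) ⨾ whilenz cnt start

-- Running all cores

-- The machine can read its input only once, so every core gets the copy at the start of the log as
-- its simulated input.
runs : ∀ r → (Fin r → Program) → Program
runs zero    p = skip
runs (suc r) p = (const rp 0 ⨾ move rem inl) ⨾ call (sim (p zero)) ⨾ runs r (p ∘ suc)

runs-reg : ∀ r p x → writesReg (runs r p) (8 + x) ≡ false
runs-reg zero    p x = refl
runs-reg (suc r) p x rewrite sim-reg (p zero) x = runs-reg r (p ∘ suc) x

runs-arr : ∀ r p a → (a <ᵇ 7) ≡ true → writesArr (runs r p) (suc a) ≡ false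
runs-arr zero    p a h = refl
runs-arr (suc r) p a h rewrite sim-arr (p zero) a h = runs-arr r (p ∘ suc) a h

runs-writes : ∀ r p → writes (runs r p) ≡ false
runs-writes zero    p = refl
runs-writes (suc r) p rewrite sim-writes (p zero) = runs-writes r (p ∘ suc)

concatAll : ∀ r → (Fin r → List ℕ) → List ℕ
concatAll zero    out = []
concatAll (suc r) out = out zero ++ concatAll r (out ∘ suc)

runs-run : ∀ r {p : Fin r → Program} {out} {time : Fin r → ℕ} {xs X σ} → (∀ i → Computes (p i) xs (out i) (time i)) → (∀ i → time i ≤ X) → 1 ≤ X →
  Clean σ → Seg (io σ) 0 xs → reg σ inl ≡ length xs → length xs ≤ reg σ wp →
  Run (runs r p) σ (suc (r * 25) * X) (λ σ′ → Clean σ′ × Grew (concatAll r out) σ σ′)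
runs-run zero _ _ 1≤X cl _ _ _ =
  weaken (≤-trans 1≤X (≤-reflexive (sym (+-identityʳ _)))) (block skip refl (cl , grew (λ _ _ → refl) tt (sym (+-identityʳ _))))
runs-run (suc r) {p} {out} {time} {xs} {X} {σ} cp t≤ 1≤X cl sg l≡ le =
  weaken bound
  ((const rp 0 ⨾ move rem inl) , refl ▸ framed (call-run (cp zero) cl sg l≡ le) ▷ λ { {σ₁} ((cl₁ , gr) , fr) →
    runs-run r (cp ∘ suc) (t≤ ∘ suc) 1≤X cl₁ (Seg-≈ xs (Grew.kept gr) le sg)
      (trans (regs fr inl (sim-reg (p zero) 26)) l≡) (≤-trans le (Grew-≤ gr)) ⟫
    λ { (cl₂ , gr₂) → cl₂ , Grew-trans {σ = σ} (grew (Grew.kept gr) (Grew.new gr) (Grew.end gr)) gr₂ } })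
  where
  bound : 3 + (2 + 20 * time zero + suc (r * 25) * X) ≤ suc (suc r * 25) * X
  bound = begin
    3 + (2 + 20 * time zero + suc (r * 25) * X)     ≤⟨ +-monoʳ-≤ 5 (+-monoˡ-≤ _ (*-monoʳ-≤ 20 (t≤ zero))) ⟩
    5 * 1 + (20 * X + suc (r * 25) * X)             ≤⟨ +-monoˡ-≤ _ (*-monoʳ-≤ 5 1≤X) ⟩
    5 * X + (20 * X + suc (r * 25) * X)             ≡⟨ lemma X (suc (r * 25)) ⟩
    (25 + suc (r * 25)) * X                         ≡⟨ cong (_* X) (+-suc 25 (r * 25)) ⟩
    suc (suc r * 25) * X                            ∎
    where
    open ≤-Reasoning
    lemma : ∀ X Y → 5 * X + (20 * X + Y * X) ≡ (25 + Y) * X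
    lemma = solve-∀

-- Detecting empty sets

-- An empty set of tuples shows as a 3 right after another 3 (or at the very start).

mark : ℕ → ℕ → ℕ
mark zero    b = 1
mark (suc _) b = b

-- `pc` is 3 minus the previous symbol. Its sum with `3 ∸ x` is zero just when neither symbol is
-- below 3; starting with `pc` equal to 0 pretends that a 3 came before.
scanned : ℕ → ℕ → List ℕ → ℕ
scanned pc b []       = b
scanned pc b (x ∷ xs) = scanned (3 ∸ x) (mark (3 ∸ x + pc) b) xs

scanStep : Program
scanStep = (load s 0 rp ⨾ inc rp ⨾ const c 3 ⨾ sub c c s ⨾ add e₀ c prev ⨾ move prev c ⨾ dec cnt) ⨾
           ifnz e₀ skip (const bad 1)

scan-loop : ∀ xs {σ} → reg σ cnt ≡ length xs → Seg (io σ) (reg σ rp) xs →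
  Run (whilenz cnt scanStep) σ (suc (13 * length xs)) (λ σ′ → reg σ′ bad ≡ scanned (reg σ prev) (reg σ bad) xs)
scan-loop []       c≡ _ = whileEnd c≡ refl
scan-loop (x ∷ xs) {σ} c≡ (h , sg) =
  weaken (≤-reflexive (cong suc (sym (*-suc 13 (length xs)))))
  (whileStep {T = suc (13 * length xs)} {Q = λ σ₁ → reg σ₁ cnt ≡ length xs × Seg (io σ₁) (reg σ₁ rp) xs ×
      reg σ₁ prev ≡ 3 ∸ x × reg σ₁ bad ≡ mark (3 ∸ x + reg σ prev) (reg σ bad)}
    (λ z → case trans (sym c≡) z of λ ())
    ((load s 0 rp ⨾ inc rp ⨾ const c 3 ⨾ sub c c s ⨾ add e₀ c prev ⨾ move prev c ⨾ dec cnt) , refl ▸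
      branch (λ ≢0 → block skip refl (cong (_∸ 1) c≡ , sg , cong (3 ∸_) h ,
                sym (unmarked (λ z → ≢0 (trans (cong (λ y → 3 ∸ y + reg σ prev) h) z)))))
             (λ ≡0 → block (const bad 1) refl (cong (_∸ 1) c≡ , sg , cong (3 ∸_) h ,
                sym (cong (λ m → mark m (reg σ bad)) (trans (cong (λ y → 3 ∸ y + reg σ prev) (sym h)) ≡0)))))
    λ { {σ₁} (c₁ , sg₁ , p₁ , b₁) → scan-loop xs c₁ sg₁ ⟫ λ e → trans e (cong₂ (λ p b → scanned p b xs) p₁ b₁) })
  where
  unmarked : ∀ {m b} → m ≢ 0 → mark m b ≡ b
  unmarked {zero}  ne = contradiction refl ne
  unmarked {suc m} ne = refl

scan : Program
scan = (const prev 0 ⨾ const bad 0 ⨾ move rp inl ⨾ sub cnt wp inl ⨾ move len cnt) ⨾ whilenz cnt scanStep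

-- The table

-- The maximum of `a` and `b`, in the form that addition and truncated subtraction provide.
join : ℕ → ℕ → ℕ
join a b = a + (b ∸ a)

-- The first two arguments are table values, that is 0 or a sum plus 1. Hence 0 absorbs, and
-- otherwise one of the two extra units is dropped.
combine : ℕ → ℕ → ℕ → ℕ
combine zero    _       f = 0
combine (suc x) zero    f = 0
combine (suc x) (suc y) f = x + suc y + f

value : (F tb : ℕ → ℕ) → Entry → ℕ
value F tb e = combine (tb (addr₁ e)) (tb (addr₂ e)) (F (bits e))

relaxed : (F tb : ℕ → ℕ) → Entry → ℕ → ℕ
relaxed F tb e = tb [ addr e ↦ join (tb (addr e)) (value F tb e) ]

better : (F tb : ℕ → ℕ) → Entry → ℕ → ℕ
better F tb e b with rejects e
... | zero  = join b (value F tb e)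
... | suc _ = b

better-rejected : ∀ F tb e {b} → rejects e ≢ 0 → better F tb e b ≡ b
better-rejected F tb e ne with rejects e
... | zero  = contradiction refl ne
... | suc _ = refl

better-accepted : ∀ F tb e {b} → rejects e ≡ 0 → better F tb e b ≡ join b (value F tb e)
better-accepted F tb e eq rewrite eq = refl

relaxAll : (F : ℕ → ℕ) → List Entry → (ℕ → ℕ) → ℕ → ℕ
relaxAll F []       tb = tb
relaxAll F (e ∷ es) tb = relaxAll F es (relaxed F tb e)

bestOf : (F : ℕ → ℕ) → List Entry → (ℕ → ℕ) → ℕ → ℕ
bestOf F []       tb b = b
bestOf F (e ∷ es) tb b = bestOf F es (relaxed F tb e) (better F tb e b)

best : Register
best = sv

combine-run : ∀ {σ} → reg σ fl ≡ 0 →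
  Run (ifnz c₁ (ifnz c₂ (add fl c₁ c₂ ⨾ dec fl ⨾ add fl fl bw) skip) skip) σ 6
    (λ σ′ → reg σ′ fl ≡ combine (reg σ c₁) (reg σ c₂) (reg σ bw))
combine-run {σ} f≡ with reg σ c₁ in x≡ | reg σ c₂ in y≡
... | zero  | _     = weaken (m≤m+n _ 4) (ifZero x≡ (block skip refl f≡))
... | suc x | zero  = weaken (m≤m+n _ 3) (ifNonzero (λ z → case trans (sym x≡) z of λ ()) (ifZero y≡ (block skip refl f≡)))
... | suc x | suc y = ifNonzero (λ z → case trans (sym x≡) z of λ ()) (ifNonzero (λ z → case trans (sym y≡) z of λ ())
        (block (add fl c₁ c₂ ⨾ dec fl ⨾ add fl fl bw) refl (cong₂ (λ a b → a + b ∸ 1 + reg σ bw) x≡ y≡)))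

loadArgs : Program
loadArgs = loadEntry ⨾ load c₁ 7 e₁ ⨾ load c₂ 7 e₂ ⨾ load bw 3 e₃ ⨾ const fl 0

record Loaded (e : Entry) (σ σ′ : State) : Set where
  constructor isLoaded
  field
    gg≡ : reg σ′ gg ≡ reg σ gg + 6
    s≡  : reg σ′ s ≡ io σ (reg σ gg + 6)
    e₀≡ : reg σ′ e₀ ≡ addr e
    c₁≡ : reg σ′ c₁ ≡ arr σ 7 (addr₁ e)
    c₂≡ : reg σ′ c₂ ≡ arr σ 7 (addr₂ e)
    bw≡ : reg σ′ bw ≡ arr σ 3 (bits e)
    e₄≡ : reg σ′ e₄ ≡ rejects e
    fl≡ : reg σ′ fl ≡ 0

loadArgs-run : ∀ e rest {σ} → Seg (io σ) (reg σ gg) (encodeEntry e ++ rest) → Run loadArgs σ 22 (Loaded e σ)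
loadArgs-run e@(mkEntry a a₁ a₂ b r) rest {σ} (_ , h₀ , h₁ , h₂ , h₃ , h₄ , _) =
  block loadArgs {σ} {λ σ′ →
      (reg σ′ gg ≡ 6 + reg σ gg × reg σ′ s ≡ io σ (6 + reg σ gg) × reg σ′ e₀ ≡ io σ (1 + reg σ gg)) ×
      (reg σ′ c₁ ≡ arr σ 7 (io σ (2 + reg σ gg)) × reg σ′ c₂ ≡ arr σ 7 (io σ (3 + reg σ gg))) ×
      (reg σ′ bw ≡ arr σ 3 (io σ (4 + reg σ gg)) × reg σ′ e₄ ≡ io σ (5 + reg σ gg) × reg σ′ fl ≡ 0)}
    refl ((refl , refl , refl) , (refl , refl) , (refl , refl , refl)) ⟫
  λ { ((p₁ , p₂ , p₃) , (p₄ , p₅) , (p₆ , p₇ , p₈)) → isLoaded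
    (trans p₁ (+-comm 6 (reg σ gg))) (trans p₂ (cong (io σ) (+-comm 6 (reg σ gg)))) (trans p₃ h₀)
    (trans p₄ (cong (arr σ 7) h₁)) (trans p₅ (cong (arr σ 7) h₂)) (trans p₆ (cong (arr σ 3) h₃)) (trans p₇ h₄) p₈ }

relaxTable : Program
relaxTable = load own 7 e₀ ⨾ sub t fl own ⨾ add own own t ⨾ store 7 e₀ own

relaxBest : Program
relaxBest = ifnz e₄ skip (sub t fl best ⨾ add best best t)

relaxBest-run : ∀ {σ} e {F tb b} → reg σ e₄ ≡ rejects e → reg σ fl ≡ value F tb e → reg σ best ≡ b →
                Run relaxBest σ 3 (λ σ′ → reg σ′ best ≡ better F tb e b)
relaxBest-run {σ} e {F} {tb} {b} r≡ v≡ b≡ = branch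
  (λ ≢0 → weaken (m≤m+n 1 1) (block skip refl (trans b≡ (sym (better-rejected F tb e (λ z → ≢0 (trans r≡ z)))))))
  (λ ≡0 → block (sub t fl best ⨾ add best best t) refl
    (trans (cong₂ join b≡ v≡) (sym (better-accepted F tb e (trans (sym r≡) ≡0)))))

relax : Program
relax = loadArgs ⨾ ifnz c₁ (ifnz c₂ (add fl c₁ c₂ ⨾ dec fl ⨾ add fl fl bw) skip) skip ⨾ relaxTable ⨾ relaxBest

relax-run : ∀ e rest {σ} → Seg (io σ) (reg σ gg) (encodeEntry e ++ rest) →
  Run relax σ 40 (λ σ′ → reg σ′ gg ≡ reg σ gg + 6 × reg σ′ s ≡ io σ (reg σ gg + 6) ×
    arr σ′ 7 ≡ relaxed (arr σ 3) (arr σ 7) e × reg σ′ best ≡ better (arr σ 3) (arr σ 7) e (reg σ best))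
relax-run e rest {σ} sg =
  weaken (m≤m+n 35 5)
  (framed (loadArgs-run e rest sg) ▷ λ { {σ₁} (ld , fr₁) → framed (combine-run (Loaded.fl≡ ld)) ▷
   λ { {σ₂} (sum≡ , fr₂) →
    let open Loaded ld
        val≡ : reg σ₂ fl ≡ value (arr σ 3) (arr σ 7) e
        val≡ = trans sum≡ (trans (cong₂ (λ x y → combine x y (reg σ₁ bw)) c₁≡ c₂≡)
                 (cong (combine (arr σ 7 (addr₁ e)) (arr σ 7 (addr₂ e))) bw≡))
        a≡ : reg σ₂ e₀ ≡ addr e
        a≡ = trans (regs fr₂ e₀ refl) e₀≡
        tb≡ : arr σ₂ 7 ≡ arr σ 7
        tb≡ = trans (arrs fr₂ 7 refl) (arrs fr₁ 7 refl)
    in _▷_ {Q = λ σ₃ → arr σ₃ 7 ≡ relaxed (arr σ 3) (arr σ 7) e × reg σ₃ fl ≡ reg σ₂ fl × reg σ₃ e₄ ≡ reg σ₂ e₄ ×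
                 reg σ₃ best ≡ reg σ₂ best × reg σ₃ gg ≡ reg σ₂ gg × reg σ₃ s ≡ reg σ₂ s}
         (block relaxTable refl (table≡ tb≡ a≡ val≡ , refl , refl , refl , refl , refl))
       λ { {σ₃} (tb′ , f₃ , r₃ , b₃ , g₃ , s₃) →
         framed (relaxBest-run e (trans r₃ (trans (regs fr₂ e₄ refl) e₄≡)) (trans f₃ val≡)
                  (trans b₃ (trans (regs fr₂ best refl) (regs fr₁ best refl)))) ⟫
         λ { (best≡ , fr₄) →
           trans (regs fr₄ gg refl) (trans g₃ (trans (regs fr₂ gg refl) gg≡)) ,
           trans (regs fr₄ s refl) (trans s₃ (trans (regs fr₂ s refl) s≡)) ,
           trans (arrs fr₄ 7 refl) tb′ , best≡ } } } })
  where
  table≡ : ∀ {f g a a′ x x′} → f ≡ g → a ≡ a′ → x ≡ x′ → f [ a ↦ join (f a) x ] ≡ g [ a′ ↦ join (g a′) x′ ]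
  table≡ refl refl refl = refl

relax-loop : ∀ es rest {σ} → Seg (io σ) (reg σ gg) (encodeEntries es ++ rest) → reg σ s ≡ io σ (reg σ gg) →
  Run (whilenz s relax) σ (41 * suc (length es)) (λ σ′ → suc (reg σ′ gg) ≡ reg σ gg + length (encodeEntries es) ×
    arr σ′ 7 ≡ relaxAll (arr σ 3) es (arr σ 7) × reg σ′ best ≡ bestOf (arr σ 3) es (arr σ 7) (reg σ best))
relax-loop [] rest {σ} (z , _) s≡ = weaken (s≤s z≤n) (whileEnd (trans s≡ z) (+-comm 1 (reg σ gg) , refl , refl))
relax-loop (e ∷ es) rest {σ} sg s≡ =
  weaken (≤-reflexive (sym (*-suc 41 (suc (length es)))))
  (whileStep {T = 41 * suc (length es)}
    (λ z → case trans (sym (proj₁ sg)) (trans (sym s≡) z) of λ ())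
    (framed (relax-run e (encodeEntries es ++ rest) sg))
    λ { {σ₁} ((g₁ , s₁ , t₁ , b₁) , fr) →
      relax-loop es rest
        (subst₂ (λ f i → Seg f i (encodeEntries es ++ rest)) (sym (arrs fr 0 refl)) (sym g₁) (Seg-++ʳ (encodeEntry e) sg))
        (trans s₁ (cong₂ (λ f i → f i) (sym (arrs fr 0 refl)) (sym g₁))) ⟫
      λ { (g₂ , t₂ , b₂) →
        trans g₂ (trans (cong (_+ length (encodeEntries es)) g₁) (+-assoc (reg σ gg) 6 _)) ,
        trans t₂ (cong₂ (λ F tb → relaxAll F es tb) (arrs fr 3 refl) t₁) ,
        trans b₂ (trans (cong₂ (λ F tb → bestOf F es tb _) (arrs fr 3 refl) t₁) (cong (bestOf (arr σ 3) es _) b₁)) } })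

relaxNodes : (F : ℕ → ℕ) → List (List Entry) → (ℕ → ℕ) → ℕ → ℕ
relaxNodes F []         tb = tb
relaxNodes F (es ∷ ess) tb = relaxNodes F ess (relaxAll F es tb)

-- The best value starts again from 0 at every node. The root comes last in a postorder, so its
-- value is the one that survives, without a test for the root.
finalBest : (F : ℕ → ℕ) → List (List Entry) → (ℕ → ℕ) → ℕ → ℕ
finalBest F []         tb b = b
finalBest F (es ∷ ess) tb b = finalBest F ess (relaxAll F es tb) (bestOf F es tb 0)

tableStep : Program
tableStep = (const best 0 ⨾ load s 0 gg) ⨾ whilenz s relax ⨾ (inc gg ⨾ dec cnt)

table-loop : ∀ ess B {σ} → reg σ cnt ≡ length ess → All (λ es → length es ≤ B) ess →
  Seg (io σ) (reg σ gg) (concatMap encodeEntries ess) →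
  Run (whilenz cnt tableStep) σ (suc (length ess * (48 + 41 * B))) (λ σ′ →
    reg σ′ best ≡ finalBest (arr σ 3) ess (arr σ 7) (reg σ best))
table-loop []         B c≡ _ _ = whileEnd c≡ refl
table-loop (es ∷ ess) B {σ} c≡ (b ∷ bs) sg =
  weaken bound
  (whileStep {T = suc (length ess * (48 + 41 * B))}
    (λ z → case trans (sym c≡) z of λ ())
    (framed (_▷_ {p = const best 0 ⨾ load s 0 gg} {Q = λ σ₁ → σ₁ ≡ ⟦ const best 0 ⨾ load s 0 gg ⟧ σ} (block (const best 0 ⨾ load s 0 gg) refl refl) (λ { refl → _▷_ {T = 4} {R = λ σ₁ → reg σ₁ gg ≡ reg σ gg + length (encodeEntries es) ×
        arr σ₁ 7 ≡ relaxAll (arr σ 3) es (arr σ 7) × reg σ₁ best ≡ bestOf (arr σ 3) es (arr σ 7) 0 × reg σ₁ cnt ≡ length ess}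
      (framed (relax-loop es (concatMap encodeEntries ess) sg refl))
      λ { ((g₁ , t₁ , b₁) , fr) → block (inc gg ⨾ dec cnt) refl
        (g₁ , t₁ , b₁ , trans (cong (_∸ 1) (regs fr cnt refl)) (cong (_∸ 1) c≡)) } })))
    λ { {σ₁} ((g₁ , t₁ , b₁ , c₁) , fr) →
      table-loop ess B c₁ bs
        (subst₂ (λ f i → Seg f i (concatMap encodeEntries ess)) (sym (arrs fr 0 refl)) (sym g₁) (Seg-++ʳ (encodeEntries es) sg)) ⟫
      λ e → trans e (trans (cong₂ (λ F tb → finalBest F ess tb (reg σ₁ best)) (arrs fr 3 refl) t₁)
                           (cong (finalBest (arr σ 3) ess _) b₁)) })
  where
  bound : suc ((2 + (41 * suc (length es) + 4)) + suc (length ess * (48 + 41 * B)))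
          ≤ suc (suc (length ess) * (48 + 41 * B))
  bound = begin
    suc ((2 + (41 * suc (length es) + 4)) + suc (length ess * (48 + 41 * B)))
      ≤⟨ s≤s (+-monoˡ-≤ _ (+-monoʳ-≤ 2 (+-monoˡ-≤ 4 (*-monoʳ-≤ 41 (s≤s b))))) ⟩
    suc ((2 + (41 * suc B + 4)) + suc (length ess * (48 + 41 * B)))
      ≡⟨ lemma B (length ess * (48 + 41 * B)) ⟩
    suc (suc (length ess) * (48 + 41 * B)) ∎
    where
    open ≤-Reasoning
    lemma : ∀ B X → 1 + ((2 + (41 * (1 + B) + 4)) + (1 + X)) ≡ 1 + (48 + 41 * B + X)
    lemma = solve-∀

-- The decision program

-- The initial store presets cell 0, the cell of all missing children, with 1: such a child is
-- reachable and contributes diversity 0.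
finish : ℕ → Program
finish d = (const e₀ 0 ⨾ const e₁ 1 ⨾ store 7 e₀ e₁ ⨾ move gg g ⨾ move cnt n ⨾ const best 0) ⨾
           whilenz cnt tableStep ⨾ (const t d ⨾ sub t best t) ⨾ ifnz t (const v 1) (const v 0) ⨾ write v

-- The node number is a digit from 0 to `n`, so the first core gets the unit `n + 1`. The weights
-- begin with 2 because the bit of weight 1 marks inner nodes, and the stamps with 1 because blank
-- cells hold 0.
search : ∀ r → (Fin r → Program) → ℕ → Program
search r q d = findChildren ⨾ (move rp inl ⨾ move U n ⨾ inc U) ⨾ phases r q 0 2 ⨾ finish d

prepare : ∀ r → (Fin r → Program) → (Vec Bool (suc r) → ℕ) → Program
prepare r p f = readInput ⨾ fill f (allVecs (suc r)) ⨾ runs r p ⨾ scan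

decide : ∀ r → (p q : Fin r → Program) → (Vec Bool (suc r) → ℕ) → ℕ → Program
decide r p q f d = prepare r p f ⨾ ifnz bad (const v 0 ⨾ write v) (search r q d)

-- A table value is one more than the optimum, so the optimum reaches `d` when the table value is
-- strictly larger than `d`.
exceeds : ℕ → ℕ → ℕ
exceeds b d = clamp (b ∸ d)

finish-run : ∀ d ess B {σ} → reg σ n ≡ length ess → All (λ es → length es ≤ B) ess →
  Seg (io σ) (reg σ g) (concatMap encodeEntries ess) → output σ ≡ [] →
  Run (finish d) σ (14 + length ess * (48 + 41 * B)) (λ σ′ →
    output σ′ ≡ [ exceeds (finalBest (arr σ 3) ess (arr σ 7 [ 0 ↦ 1 ]) 0) d ])
finish-run d ess B {σ} n≡ bs sg o≡ =
  weaken (≤-reflexive (cong (8 +_) (trans (cong suc (+-comm (length ess * (48 + 41 * B)) 5)) refl)))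
  ((const e₀ 0 ⨾ const e₁ 1 ⨾ store 7 e₀ e₁ ⨾ move gg g ⨾ move cnt n ⨾ const best 0) , refl ▸
   framed (table-loop ess B n≡ bs sg) ▷ λ { {σ₁} (b≡ , fr) →
   (const t d ⨾ sub t best t) , refl ▸
   _▷_ {Q = λ σ₂ → reg σ₂ v ≡ exceeds (reg σ₁ best) d × output σ₂ ≡ []}
     (branch (λ ≢0 → block (const v 1) refl (one ≢0 , trans (out fr refl) o≡))
             (λ ≡0 → block (const v 0) refl (sym (cong clamp ≡0) , trans (out fr refl) o≡)))
     λ { (v≡ , o₂) → block (write v) refl (cong₂ _∷ʳ_ o₂ (trans v≡ (cong (λ b → exceeds b d) b≡))) } })
  where
  one : ∀ {m} → m ≢ 0 → 1 ≡ clamp m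
  one {zero}  h = contradiction refl h
  one {suc m} h = refl

findChildren-run : ∀ {ω} (Ds : List (CW ω)) {σ} → reg σ n ≡ length Ds →
  Seg (io σ) 2 (concatMap encodeOp Ds) → 2 + length (concatMap encodeOp Ds) ≤ reg σ wp →
  Run findChildren σ (8 + 60 * length Ds) (λ σ′ →
    Grew (concatMap (λ e → encodeEntries [ e ]) (startEntries (map arity Ds) (stack (arr σ 2) 0 0))) σ σ′ ×
    arr σ′ 1 ≡ put (arr σ 1) 1 (map arity Ds) × reg σ′ g ≡ reg σ wp)
findChildren-run Ds {σ} n≡ sg le =
  (const k 0 ⨾ move cnt n ⨾ const st 0 ⨾ const gg 2 ⨾ move g wp) , refl ▸
  (framed (start-loop Ds n≡ sg le) ⟫ λ { ((gr , a≡) , fr) →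
    grew (Grew.kept gr) (Grew.new gr) (Grew.end gr) , a≡ , regs fr g refl })

prepareCost : ℕ → ℕ
prepareCost r = 39 + suc (3 * length (allVecs (suc r))) + suc (r * 25) + 21

searchCost : ∀ r → (Fin r → ℕ) → ℕ
searchCost r K = 75 + phasesCost r K + 103

module Decision {ω : ℕ} (D : CW ω) (r : ℕ) where

  δ≤2 : ∀ (D : CW ω) → arity D ≤ 2
  δ≤2 (intro _ _)      = z≤n
  δ≤2 (_ ⊕ _)          = ≤-refl
  δ≤2 (recolor _ _ _)  = s≤s z≤n
  δ≤2 (addEdges _ _ _) = s≤s z≤n

  nodes : List (Node D)
  nodes = postorder D

  open Phases (δ {D = D}) (λ a → δ≤2 (subtree a)) nodes public

  outputs : (Fin r → List BitString) → (Fin r → Transitions) → List ℕ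
  outputs = streams r

  ops-length : ∀ (as : List (Node D)) → length (concatMap (encodeOp ∘ subtree) as) ≡ length as + length as + length as
  ops-length []       = refl
  ops-length (a ∷ as) with x , y , eq ← encodeOp-shape (subtree a) rewrite eq | ops-length as =
    lemma (length as)
    where
    lemma : ∀ l → 3 + (l + l + l) ≡ 1 + l + (1 + l) + (1 + l)
    lemma = solve-∀

  record Prepared (f : Vec Bool (suc r) → ℕ) (outs : List ℕ) (σ : State) : Set where
    constructor prepared
    field
      clean  : Clean σ
      n≡     : reg σ n ≡ ∣V D ∣
      inSeg  : Seg (io σ) 0 (encodeCW D)
      outSeg : Seg (io σ) (reg σ inl) outs
      in≤    : length (encodeCW D) ≤ reg σ wp
      wp≡    : reg σ wp ≡ reg σ inl + length outs
      len≡   : reg σ len ≡ length outs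
      bad≡   : reg σ bad ≡ scanned 0 0 outs
      table  : ∀ v → arr σ 3 (index v) ≡ f v
      stamps : ∀ x → arr σ 4 x ≡ 0
      blank  : ∀ x → arr σ 7 x ≡ 0
      silent : output σ ≡ []

  streams-concat : ∀ r acc proc → concatAll r (λ i → coreStream (acc i) (proc i)) ≡ streams r acc proc
  streams-concat zero    acc proc = refl
  streams-concat (suc r) acc proc = cong (coreStream (acc zero) (proc zero) ++_) (streams-concat r (acc ∘ suc) (proc ∘ suc))

  module _ {p : Fin r → Program} {f : Vec Bool (suc r) → ℕ} {acc : Fin r → List BitString} {proc : Fin r → Transitions}
           {time : Fin r → ℕ} {X : ℕ}
           (computes : ∀ i → Computes (p i) (encodeCW D) (coreStream (acc i) (proc i)) (time i))
           (time≤ : ∀ i → time i ≤ X) (n≤ : ∣V D ∣ ≤ X) (outs≤ : length (outputs acc proc) ≤ X) (1≤ : 1 ≤ X) where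

    prepare-run : Run (prepare r p f) (initial (encodeCW D)) (prepareCost r * X) (Prepared f (outputs acc proc))
    prepare-run = weaken bound
      (framed (readInput-run ∣V D ∣ rest (cong suc (ops-length nodes)) refl) ▷ λ { {σ₁} ((gr₁ , n₁ , inl₁) , fr₁) →
       framed (fill-run f (allVecs (suc r))) ▷ λ { {σ₂} (tab₂ , fr₂) →
       let vs = allVecs (suc r)
           io₂ : io σ₂ ≡ io σ₁
           io₂ = arrs fr₂ 0 (fill-arr f vs 0 refl)
           wp₂ : reg σ₂ wp ≡ reg σ₁ wp
           wp₂ = regs fr₂ wp (fill-reg f vs wp refl refl)
           inl₂ : reg σ₂ inl ≡ length (encodeCW D)
           inl₂ = trans (regs fr₂ inl (fill-reg f vs inl refl refl)) (trans inl₁ (Grew.end gr₁))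
           in₂ : Seg (io σ₂) 0 (encodeCW D)
           in₂ = subst (λ h → Seg h 0 (encodeCW D)) (sym io₂) (Grew.new gr₁)
           le₂ : length (encodeCW D) ≤ reg σ₂ wp
           le₂ = ≤-reflexive (sym (trans wp₂ (Grew.end gr₁)))
           cl₁ : Clean σ₁
           cl₁ = Clean-frame fr₁ refl (λ _ → refl) (λ _ _ _ → refl)
           cl₂ : Clean σ₂
           cl₂ = Clean-frame fr₂ (fill-reg f vs lim refl refl) (λ a → fill-arr f vs (8 + a) refl) cl₁
       in framed (runs-run r {p} computes time≤ 1≤ cl₂ in₂ inl₂ le₂) ▷ λ { {σ₃} ((cl₃ , gr₃′) , fr₃) →
       let gr₃ : Grew (outputs acc proc) σ₂ σ₃
           gr₃ = subst (λ xs → Grew xs σ₂ σ₃) (streams-concat r acc proc) gr₃′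
           inl₃ : reg σ₃ inl ≡ reg σ₂ inl
           inl₃ = regs fr₃ inl (runs-reg r p 26)
           wp₃ : reg σ₃ wp ≡ reg σ₃ inl + length (outputs acc proc)
           wp₃ = trans (Grew.end gr₃) (cong (_+ length (outputs acc proc))
                   (trans (trans wp₂ (Grew.end gr₁)) (trans (sym inl₂) (sym inl₃))))
           out₃ : Seg (io σ₃) (reg σ₃ inl) (outputs acc proc)
           out₃ = subst (λ i → Seg (io σ₃) i (outputs acc proc))
                    (trans (trans wp₂ (Grew.end gr₁)) (trans (sym inl₂) (sym inl₃))) (Grew.new gr₃)
           cnt₃ : reg σ₃ wp ∸ reg σ₃ inl ≡ length (outputs acc proc)
           cnt₃ = trans (cong (_∸ reg σ₃ inl) wp₃) (m+n∸m≡n (reg σ₃ inl) _)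
       in (const prev 0 ⨾ const bad 0 ⨾ move rp inl ⨾ sub cnt wp inl ⨾ move len cnt) , refl ▸
          framed (scan-loop (outputs acc proc) cnt₃ out₃) ⟫ λ { {σ₄} (bad₄ , fr₄) → prepared
            (Clean-frame fr₄ refl (λ _ → refl) cl₃)
            (trans (regs fr₄ n refl) (trans (regs fr₃ n (runs-reg r p 0)) (trans (regs fr₂ n (fill-reg f vs n refl refl)) n₁)))
            (subst (λ h → Seg h 0 (encodeCW D)) (sym (arrs fr₄ 0 refl)) (Seg-≈ (encodeCW D) (Grew.kept gr₃) le₂ in₂))
            (subst₂ (λ h i → Seg h i (outputs acc proc)) (sym (arrs fr₄ 0 refl)) (sym (regs fr₄ inl refl)) out₃)
            (subst (length (encodeCW D) ≤_) (sym (regs fr₄ wp refl)) (≤-trans le₂ (Grew-≤ gr₃)))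
            (trans (regs fr₄ wp refl) (trans wp₃ (cong (_+ length (outputs acc proc)) (sym (regs fr₄ inl refl)))))
            (trans (regs fr₄ len refl) cnt₃)
            bad₄
            (λ v → trans (cong (λ h → h (index v)) (trans (arrs fr₄ 3 refl) (trans (arrs fr₃ 3 (runs-arr r p 2 refl)) tab₂)))
                     (tabulated-∈ f vs (∈-allVecs v)))
            (λ x → cong (λ h → h x) (trans (arrs fr₄ 4 refl) (trans (arrs fr₃ 4 (runs-arr r p 3 refl))
                     (trans (arrs fr₂ 4 (fill-arr f vs 4 refl)) (arrs fr₁ 4 refl)))))
            (λ x → cong (λ h → h x) (trans (arrs fr₄ 7 refl) (trans (arrs fr₃ 7 (runs-arr r p 6 refl))
                     (trans (arrs fr₂ 7 (fill-arr f vs 7 refl)) (arrs fr₁ 7 refl)))))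
            (trans (out fr₄ refl) (trans (out fr₃ (runs-writes r p)) (trans (out fr₂ (fill-writes f vs)) (out fr₁ refl)))) } } } })
      where
      rest : List ℕ
      rest = ω ∷ concatMap (encodeOp ∘ subtree) nodes
      bound : 11 + 7 * length rest + (suc (3 * length (allVecs (suc r))) + (suc (r * 25) * X + (7 + suc (13 * length (outputs acc proc)))))
              ≤ prepareCost r * X
      bound = begin
        11 + 7 * length rest + (V + (R * X + (7 + suc (13 * O))))
          ≡⟨ cong (λ l → 11 + 7 * suc l + (V + (R * X + (7 + suc (13 * O))))) (ops-length nodes) ⟩
        11 + 7 * suc (N + N + N) + (V + (R * X + (7 + suc (13 * O))))
          ≡⟨ lemma₁ N V R X O ⟩
        18 * 1 + 21 * N + V * 1 + R * X + 8 * 1 + 13 * O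
          ≤⟨ +-mono-≤ (+-mono-≤ (+-monoˡ-≤ (R * X) (+-mono-≤ (+-mono-≤ (*-monoʳ-≤ 18 1≤) (*-monoʳ-≤ 21 n≤)) (*-monoʳ-≤ V 1≤)))
               (*-monoʳ-≤ 8 1≤)) (*-monoʳ-≤ 13 outs≤) ⟩
        18 * X + 21 * X + V * X + R * X + 8 * X + 13 * X
          ≡⟨ lemma₂ V R X ⟩
        prepareCost r * X ∎
        where
        open ≤-Reasoning
        N = ∣V D ∣
        V = suc (3 * length (allVecs (suc r)))
        R = suc (r * 25)
        O = length (outputs acc proc)
        lemma₁ : ∀ N V R X O → 11 + 7 * (1 + (N + N + N)) + (V + (R * X + (7 + (1 + 13 * O))))
                               ≡ 18 * 1 + 21 * N + V * 1 + R * X + 8 * 1 + 13 * O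
        lemma₁ = solve-∀
        lemma₂ : ∀ V R X → 18 * X + 21 * X + V * X + R * X + 8 * X + 13 * X ≡ (39 + V + R + 21) * X
        lemma₂ = solve-∀

  generations-length : ∀ r ρ acc proc wgt u L es a →
    length (generations r ρ acc proc wgt u L es a) ≡ length (es a) * product (tabulate λ i → length (proc i a))
  generations-length zero    ρ acc proc wgt u L es a = sym (*-identityʳ _)
  generations-length (suc r) ρ acc proc wgt u L es a =
    trans (generations-length r (ρ ∘ suc) (acc ∘ suc) (proc ∘ suc) _ _ L _ a)
      (trans (cong (_* product (tabulate λ i → length (proc (suc i) a))) (extend-length _ (proc zero a) (es a)))
        (lemma (length (proc zero a)) (length (es a)) _))
    where
    lemma : ∀ x y z → x * y * z ≡ y * (x * z)
    lemma = solve-∀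

  module _ {q : Fin r → Program} {ρ : Fin r → BitString → Bool} {K : Fin r → ℕ} (ev : ∀ i → Evaluates (ρ i) (q i) (K i))
           {f : Vec Bool (suc r) → ℕ} {acc : Fin r → List BitString} {proc : Fin r → Transitions}
           (starting : Node D → Entry)
           (starts≡ : ∀ S → startEntries (map arity (map subtree nodes)) (stack S 0 0) ≡ map starting nodes)
           {B X : ℕ} (nonempty : ∀ i a → proc i a ≢ []) (B≥ : ∀ a → product (tabulate λ i → length (proc i a)) ≤ B)
           (n≤ : ∣V D ∣ ≤ X) (nB≤ : ∣V D ∣ * B ≤ X) (outs≤ : length (outputs acc proc) ≤ X) (1≤ : 1 ≤ X) (d : ℕ) where

    finalEntries : Node D → List Entry
    finalEntries = generations r ρ acc proc 2 (suc ∣V D ∣) (length (outputs acc proc)) (λ a → [ starting a ])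

    search-run : ∀ {σ} → Prepared f (outputs acc proc) σ → Run (search r q d) σ (searchCost r K * X) (λ σ′ →
      ∃[ F ] ∃[ tb ] (∀ v → F (index v) ≡ f v) × (∀ x → tb x ≡ 0) ×
      output σ′ ≡ [ exceeds (finalBest F (map finalEntries nodes) (tb [ 0 ↦ 1 ]) 0) d ])
    search-run {σ} pr = weaken bound
      (framed (findChildren-run Ds (trans n≡ (sym (length-map subtree nodes)))
         (subst (Seg (io σ) 2) (sym ops≡) (proj₂ (proj₂ inSeg)))
         (subst (λ xs → 2 + length xs ≤ reg σ wp) (sym ops≡) in≤)) ▷ λ { {σ₁} ((gr , a≡ , g≡) , fr) →
       let inl₁ : reg σ₁ inl ≡ reg σ inl
           inl₁ = regs fr inl refl
           starting≡ : concatMap (λ e → encodeEntries [ e ]) (startEntries (map arity Ds) (stack (arr σ 2) 0 0))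
                       ≡ generation (λ a → [ starting a ])
           starting≡ = trans (cong (concatMap (λ e → encodeEntries [ e ])) (starts≡ (arr σ 2)))
                         (concatMap-map (λ e → encodeEntries [ e ]) starting nodes)
           gr′ : Grew (generation (λ a → [ starting a ])) σ σ₁
           gr′ = subst (λ xs → Grew xs σ σ₁) starting≡ gr
           inv : PhaseInv (λ a → [ starting a ]) 0 outs (suc ∣V D ∣) (length outs) (⟦ move rp inl ⨾ move U n ⨾ inc U ⟧ σ₁)
           inv = phaseInv (Clean-frame fr refl (λ _ → refl) clean)
             (trans (regs fr n refl) n≡) (trans (regs fr len refl) len≡) (cong suc (trans (regs fr n refl) n≡))
             (subst (λ h → Seg h 1 (map δ nodes)) (sym a≡)
               (subst (λ ms → Seg (put (arr σ 1) 1 (map arity Ds)) 1 ms) (sym (map-∘ nodes)) (put-Seg (map arity Ds) {arr σ 1} 1)))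
             (subst (λ i → Seg (io σ₁) i outs) (sym inl₁) (Grew-seg gr′ outs (≤-reflexive (sym wp≡)) outSeg))
             (subst (λ i → i + length outs ≤ reg σ₁ wp) (sym inl₁) (≤-trans (≤-reflexive (sym wp≡)) (Grew-≤ gr′)))
             (subst (λ i → Seg (io σ₁) i (generation (λ a → [ starting a ]))) (sym g≡) (Grew.new gr′))
             (≤-reflexive (sym (trans (Grew.end gr′) (cong (_+ length (generation (λ a → [ starting a ]))) (sym g≡)))))
             (λ x → ≤-reflexive (trans (cong (λ h → h x) (arrs fr 4 refl)) (stamps x)))
       in (move rp inl ⨾ move U n ⨾ inc U) , refl ▸
          framed (phases-run r {ρ} {q} {K} ev acc proc nonempty (s≤s z≤n)
            (λ a → ≤-trans (≤-reflexive (*-identityˡ _)) (B≥ a)) outs≤ nB≤ outs≤ 1≤ inv) ▷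
       λ { {σ₂} ((_ , _ , inv₂) , fr₂) →
          finish-run d (map finalEntries nodes) B
            (trans (PhaseInv.count inv₂) (sym (length-map finalEntries nodes)))
            (map⁺ (All.tabulate λ {a} _ → ≤-trans (≤-reflexive (trans
              (generations-length r ρ acc proc 2 (suc ∣V D ∣) (length outs) (λ a → [ starting a ]) a) (*-identityˡ _))) (B≥ a)))
            (subst (Seg (io σ₂) (reg σ₂ g)) (sym (concatMap-map encodeEntries finalEntries nodes)) (PhaseInv.gen inv₂))
            (trans (out fr₂ (phases-writes r q 0 2)) (trans (out fr refl) silent)) ⟫
          λ o≡ → arr σ₂ 3 , arr σ₂ 7 ,
            (λ w → trans (cong (λ h → h (index w)) (trans (arrs fr₂ 3 (phases-arr r q 0 2 2 refl refl)) (arrs fr 3 refl))) (table w)) ,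
            (λ x → trans (cong (λ h → h x) (trans (arrs fr₂ 7 (phases-arr r q 0 2 6 refl refl)) (arrs fr 7 refl))) (blank x)) , o≡ } })
      where
      open Prepared pr
      outs : List ℕ
      outs = outputs acc proc
      Ds : List (CW ω)
      Ds = map subtree nodes
      ops≡ : concatMap encodeOp Ds ≡ concatMap (encodeOp ∘ subtree) nodes
      ops≡ = concatMap-map encodeOp subtree nodes
      bound : 8 + 60 * length Ds + (6 + (phasesCost r K * X + (14 + length (map finalEntries nodes) * (48 + 41 * B))))
              ≤ searchCost r K * X
      bound = begin
        8 + 60 * length Ds + (6 + (P * X + (14 + length (map finalEntries nodes) * (48 + 41 * B))))
          ≡⟨ cong₂ (λ a b → 8 + 60 * a + (6 + (P * X + (14 + b * (48 + 41 * B))))) (length-map subtree nodes) (length-map finalEntries nodes) ⟩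
        8 + 60 * N + (6 + (P * X + (14 + N * (48 + 41 * B))))
          ≡⟨ lemma₁ N P X B ⟩
        28 * 1 + 108 * N + P * X + 41 * (N * B)
          ≤⟨ +-mono-≤ (+-monoˡ-≤ (P * X) (+-mono-≤ (*-monoʳ-≤ 28 1≤) (*-monoʳ-≤ 108 n≤))) (*-monoʳ-≤ 41 nB≤) ⟩
        28 * X + 108 * X + P * X + 41 * X
          ≤⟨ m≤m+n _ X ⟩
        28 * X + 108 * X + P * X + 41 * X + X
          ≡⟨ lemma₂ P X ⟩
        searchCost r K * X ∎
        where
        open ≤-Reasoning
        N = ∣V D ∣
        P = phasesCost r K
        lemma₁ : ∀ N P X B → 8 + 60 * N + (6 + (P * X + (14 + N * (48 + 41 * B)))) ≡ 28 * 1 + 108 * N + P * X + 41 * (N * B)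
        lemma₁ = solve-∀
        lemma₂ : ∀ P X → 28 * X + 108 * X + P * X + 41 * X + X ≡ (75 + P + 103) * X
        lemma₂ = solve-∀

-- Numbering of the nodes

∣⊕∣ : ∀ {ω} (D₁ D₂ : CW ω) → ∣V D₁ ⊕ D₂ ∣ ≡ suc (∣V D₁ ∣ + ∣V D₂ ∣)
∣⊕∣ D₁ D₂ = begin
  length (map inˡ (postorder D₁) ++ map inʳ (postorder D₂) ++ [ root ])
    ≡⟨ length-++ (map inˡ (postorder D₁)) ⟩
  length (map {B = Node (D₁ ⊕ D₂)} inˡ (postorder D₁)) + length (map inʳ (postorder D₂) ++ [ root ])
    ≡⟨ cong₂ _+_ (length-map inˡ (postorder D₁)) (length-++ (map inʳ (postorder D₂))) ⟩
  ∣V D₁ ∣ + (length (map {B = Node (D₁ ⊕ D₂)} inʳ (postorder D₂)) + 1)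
    ≡⟨ cong (λ l → ∣V D₁ ∣ + (l + 1)) (length-map inʳ (postorder D₂)) ⟩
  ∣V D₁ ∣ + (∣V D₂ ∣ + 1)   ≡⟨ lemma ∣V D₁ ∣ ∣V D₂ ∣ ⟩
  suc (∣V D₁ ∣ + ∣V D₂ ∣)   ∎
  where
  open ≡-Reasoning
  lemma : ∀ a b → a + (b + 1) ≡ 1 + (a + b)
  lemma = solve-∀

∣recolor∣ : ∀ {ω} (D : CW ω) a b → ∣V recolor D a b ∣ ≡ suc ∣V D ∣
∣recolor∣ D a b = trans (length-++ (map inRecolor (postorder D)))
  (trans (+-comm _ 1) (cong suc (length-map inRecolor (postorder D))))

∣addEdges∣ : ∀ {ω} (D : CW ω) a b → ∣V addEdges D a b ∣ ≡ suc ∣V D ∣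
∣addEdges∣ D a b = trans (length-++ (map inAdd (postorder D)))
  (trans (+-comm _ 1) (cong suc (length-map inAdd (postorder D))))

-- The position of a node in the postorder, counted from k + 1; 0 is not a node.
num : ∀ {ω} {D : CW ω} → ℕ → Node D → ℕ
num {D = D} k root       = k + ∣V D ∣
num k (inˡ t)            = num k t
num k (inʳ {D₁} t)       = num (k + ∣V D₁ ∣) t
num k (inRecolor t)      = num k t
num k (inAdd t)          = num k t

kid₁ kid₂ : ∀ {m} → Vec ℕ m → ℕ
kid₁ []      = 0
kid₁ (x ∷ _) = x
kid₂ []      = 0
kid₂ (_ ∷ v) = kid₁ v

childNums : ∀ {ω} {D : CW ω} → ℕ → (t : Node D) → Vec ℕ (δ t)
childNums k t = Vec.map (num k) (children t)

-- The lowest bit of the index marks inner nodes, where f must not be counted.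
starting : ∀ {ω} {D : CW ω} → ℕ → Node D → Entry
starting k t = mkEntry (num k t) (kid₁ (childNums k t)) (kid₂ (childNums k t)) (nonleaf (δ t)) 0

arities : ∀ {ω} (D : CW ω) → List ℕ
arities D = map (λ t → δ t) (postorder D)

startEntries-++ : ∀ ms {ms′} S → startEntries (ms ++ ms′) S ≡ startEntries ms S ++ startEntries ms′ (pushedAll ms S)
startEntries-++ []       S = refl
startEntries-++ (m ∷ ms) S = cong (startEntry m S ∷_) (startEntries-++ ms (pushed m S))

pushedAll-++ : ∀ ms {ms′} S → pushedAll (ms ++ ms′) S ≡ pushedAll ms′ (pushedAll ms S)
pushedAll-++ []       S = refl
pushedAll-++ (m ∷ ms) S = pushedAll-++ ms (pushed m S)

-- The net effect of a subtree on the stack: one new cell with the number of its root, and nothing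
-- changed below. An induction over the tree needs this together with the entries produced.
record Pushes (ms : List ℕ) (size : ℕ) (S : ℕ → ℕ) (sp k : ℕ) (es : List Entry) : Set where
  constructor pushes
  field
    {cells′} : ℕ → ℕ
    entries  : startEntries ms (stack S sp k) ≡ es
    final    : pushedAll ms (stack S sp k) ≡ stack cells′ (suc sp) (k + size)
    top      : cells′ sp ≡ k + size
    below    : ∀ j → j < sp → cells′ j ≡ S j

startEntries-tree : ∀ {ω} (D : CW ω) S sp k → Pushes (arities D) ∣V D ∣ S sp k (map (starting k) (postorder D))

-- Shared by `recolor` and `addEdges`, whose nodes have different types; hence the arbitrary list
-- `as` of nodes, followed by the root `a`.
startEntries-unary : ∀ {ω} (D : CW ω) {N : Set} (as : List N) (a : N) (entry : N → Entry) {ms size} S sp k →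
  ms ≡ arities D ++ [ 1 ] → size ≡ suc ∣V D ∣ →
  map (starting k) (postorder D) ≡ map entry as →
  entry a ≡ mkEntry (k + size) (k + ∣V D ∣) 0 1 0 →
  Pushes ms size S sp k (map entry (as ++ [ a ]))
startEntries-unary D as a entry S sp k refl refl as≡ a≡
  with startEntries-tree D S sp k
... | pushes {S′} es fin top below = pushes
  (trans (startEntries-++ (arities D) _) (trans (cong₂ (λ xs st → xs ++ startEntries [ 1 ] st) (trans es as≡) fin)
    (trans (cong (λ e → map entry as ++ [ e ]) (sym (trans a≡ (cong₂ (λ x y → mkEntry x y 0 1 0) (+-suc k _) (sym top)))))
      (sym (map-++ entry as [ a ])))))
  (trans (pushedAll-++ (arities D) _) (trans (cong (pushedAll [ 1 ]) fin)
    (cong (λ m → stack (S′ [ sp ↦ m ]) (suc sp) m) (sym (+-suc k _)))))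
  (update-same S′ sp)
  (λ j j<sp → trans (update-other S′ (>⇒≢ j<sp)) (below j j<sp))

startEntries-tree (intro v a) S sp k = pushes
  (cong (λ x → mkEntry x 0 0 0 0 ∷ []) (+-comm 1 k))
  (cong (λ x → stack (S [ sp ↦ x ]) (suc sp) x) (+-comm 1 k))
  (update-same S sp) (λ j j<sp → update-other S (>⇒≢ j<sp))
startEntries-tree (D₁ ⊕ D₂) S sp k
  with startEntries-tree D₁ S sp k
... | pushes {S₁} es₁ fin₁ top₁ below₁ with startEntries-tree D₂ S₁ (suc sp) (k + ∣V D₁ ∣)
...   | pushes {S₂} es₂ fin₂ top₂ below₂ = pushes
  (trans (cong (λ ms → startEntries ms (stack S sp k)) ms≡) (trans (startEntries-++ (arities D₁) _) (trans
    (cong₂ (λ xs st → xs ++ startEntries (arities D₂ ++ [ 2 ]) st) es₁ fin₁)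
    (trans (cong (map (starting k) (postorder D₁) ++_) (trans (startEntries-++ (arities D₂) _)
      (cong₂ (λ xs st → xs ++ startEntries [ 2 ] st) es₂ fin₂)))
    (sym es≡)))))
  (trans (cong (λ ms → pushedAll ms (stack S sp k)) ms≡) (trans (pushedAll-++ (arities D₁) _) (trans
    (cong (pushedAll (arities D₂ ++ [ 2 ])) fin₁) (trans (pushedAll-++ (arities D₂) _) (trans (cong (pushedAll [ 2 ]) fin₂)
    (cong (λ x → stack (S₂ [ sp ↦ x ]) (suc sp) x) size≡))))))
  (update-same S₂ sp)
  (λ j j<sp → trans (update-other S₂ (>⇒≢ j<sp)) (trans (below₂ j (m≤n⇒m≤1+n j<sp)) (below₁ j j<sp)))
  where
  ms≡ : arities (D₁ ⊕ D₂) ≡ arities D₁ ++ arities D₂ ++ [ 2 ]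
  ms≡ = trans (map-++ (λ t → δ t) (map inˡ (postorder D₁)) _) (cong₂ _++_ (sym (map-∘ (postorder D₁)))
          (trans (map-++ (λ t → δ t) (map inʳ (postorder D₂)) _) (cong (_++ [ 2 ]) (sym (map-∘ (postorder D₂))))))
  size≡ : suc (k + ∣V D₁ ∣ + ∣V D₂ ∣) ≡ k + ∣V D₁ ⊕ D₂ ∣
  size≡ = trans (trans (cong suc (+-assoc k _ _)) (sym (+-suc k _))) (cong (k +_) (sym (∣⊕∣ D₁ D₂)))
  starting-ˡ : ∀ t → starting {D = D₁ ⊕ D₂} k (inˡ t) ≡ starting k t
  starting-ˡ t = cong (λ v → mkEntry (num k t) (kid₁ v) (kid₂ v) (nonleaf (δ t)) 0) (sym (Vec.map-∘ (num k) inˡ (children t)))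
  starting-ʳ : ∀ t → starting {D = D₁ ⊕ D₂} k (inʳ t) ≡ starting (k + ∣V D₁ ∣) t
  starting-ʳ t = cong (λ v → mkEntry (num (k + ∣V D₁ ∣) t) (kid₁ v) (kid₂ v) (nonleaf (δ t)) 0) (sym (Vec.map-∘ (num k) inʳ (children t)))
  es≡ : map (starting k) (postorder (D₁ ⊕ D₂)) ≡ map (starting k) (postorder D₁) ++
        map (starting (k + ∣V D₁ ∣)) (postorder D₂) ++ [ startEntry 2 (stack S₂ (suc (suc sp)) (k + ∣V D₁ ∣ + ∣V D₂ ∣)) ]
  es≡ = trans (map-++ (starting k) (map inˡ (postorder D₁)) _) (cong₂ _++_
          (trans (sym (map-∘ (postorder D₁))) (map-cong starting-ˡ (postorder D₁)))
          (trans (map-++ (starting k) (map inʳ (postorder D₂)) _) (cong₂ _++_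
            (trans (sym (map-∘ (postorder D₂))) (map-cong starting-ʳ (postorder D₂)))
            -- The right subtree has left the cell `sp` intact, so it still holds the number of the
            -- left root.
            (cong [_] (Entry-≡ (sym size≡) (sym (trans (below₂ sp ≤-refl) top₁)) (sym top₂) refl refl)))))
startEntries-tree (recolor D a b) S sp k = startEntries-unary D (map inRecolor (postorder D)) root (starting k) S sp k
  (trans (map-++ (λ t → δ t) (map inRecolor (postorder D)) _) (cong (_++ [ 1 ]) (sym (map-∘ (postorder D)))))
  (∣recolor∣ D a b)
  (trans (map-cong (λ t → cong (λ v → mkEntry (num k t) (kid₁ v) (kid₂ v) (nonleaf (δ t)) 0)
    (Vec.map-∘ (num k) inRecolor (children t))) (postorder D)) (map-∘ (postorder D)))
  refl
startEntries-tree (addEdges D a b) S sp k = startEntries-unary D (map inAdd (postorder D)) root (starting k) S sp k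
  (trans (map-++ (λ t → δ t) (map inAdd (postorder D)) _) (cong (_++ [ 1 ]) (sym (map-∘ (postorder D)))))
  (∣addEdges∣ D a b)
  (trans (map-cong (λ t → cong (λ v → mkEntry (num k t) (kid₁ v) (kid₂ v) (nonleaf (δ t)) 0)
    (Vec.map-∘ (num k) inAdd (children t))) (postorder D)) (map-∘ (postorder D)))
  refl

∈-postorder : ∀ {ω} {D : CW ω} (t : Node D) → t ∈ postorder D
∈-postorder {D = intro _ _}    root = here refl
∈-postorder {D = D₁ ⊕ D₂}      root = ∈-++⁺ʳ (map inˡ (postorder D₁)) (∈-++⁺ʳ (map inʳ (postorder D₂)) (here refl))
∈-postorder {D = recolor D _ _}  root = ∈-++⁺ʳ (map inRecolor (postorder D)) (here refl)
∈-postorder {D = addEdges D _ _} root = ∈-++⁺ʳ (map inAdd (postorder D)) (here refl)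
∈-postorder (inˡ t)              = ∈-++⁺ˡ (∈-map⁺ inˡ (∈-postorder t))
∈-postorder {D = D₁ ⊕ D₂} (inʳ t) = ∈-++⁺ʳ (map inˡ (postorder D₁)) (∈-++⁺ˡ (∈-map⁺ inʳ (∈-postorder t)))
∈-postorder (inRecolor t)        = ∈-++⁺ˡ (∈-map⁺ inRecolor (∈-postorder t))
∈-postorder (inAdd t)            = ∈-++⁺ˡ (∈-map⁺ inAdd (∈-postorder t))

-- Correctness of the emptiness test

scanned-string : ∀ pc b w ys → scanned pc b (encodeString w ++ ys) ≡ scanned 1 b ys
scanned-string pc b []          ys = refl
scanned-string pc b (false ∷ w) ys = scanned-string 3 b w ys
scanned-string pc b (true ∷ w)  ys = scanned-string 2 b w ys

scanned-tuple : ∀ {m} pc b (v : Vec BitString (suc m)) ys → scanned pc b (encodeTuple v ++ ys) ≡ scanned 1 b ys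
scanned-tuple pc b (w ∷ []) ys = trans (cong (λ xs → scanned pc b (xs ++ ys)) (++-identityʳ (encodeString w))) (scanned-string pc b w ys)
scanned-tuple pc b (w ∷ ws@(_ ∷ _)) ys = trans (cong (scanned pc b) (++-assoc (encodeString w) (encodeTuple ws) ys))
  (trans (scanned-string pc b w _) (scanned-tuple 1 b ws ys))

-- Every tuple ends with a 2, which leaves `pc` at 1. The closing 3 can therefore follow another 3
-- only if no tuple precedes it.
scanned-tuples : ∀ {m} pc b (ts : List (Vec BitString (suc m))) ys → ts ≢ [] ⊎ pc ≡ 1 →
                 scanned pc b (encodeTuples ts ++ ys) ≡ scanned 0 b ys
scanned-tuples pc b [] ys (inj₁ ne)   = contradiction refl ne
scanned-tuples pc b [] ys (inj₂ refl) = refl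
scanned-tuples pc b (v ∷ ts) ys _ = trans (cong (λ xs → scanned pc b (xs ++ ys)) (encodeTuples-∷ v ts))
  (trans (cong (scanned pc b) (++-assoc (encodeTuple v) (encodeTuples ts) ys))
    (trans (scanned-tuple pc b v _) (scanned-tuples 1 b ts ys (inj₂ refl))))

scanned-marked : ∀ pc xs → scanned pc 1 xs ≡ 1
scanned-marked pc []       = refl
scanned-marked pc (x ∷ xs) with 3 ∸ x + pc
... | zero  = scanned-marked (3 ∸ x) xs
... | suc _ = scanned-marked (3 ∸ x) xs

scanned-block : ∀ {m} (ts : List (Vec BitString (suc m))) ys →
  (ts ≡ [] × scanned 0 0 (encodeTuples ts ++ ys) ≡ 1) ⊎ (ts ≢ [] × scanned 0 0 (encodeTuples ts ++ ys) ≡ scanned 0 0 ys)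
scanned-block []         ys = inj₁ (refl , scanned-marked 0 ys)
scanned-block ts@(_ ∷ _) ys = inj₂ ((λ ()) , scanned-tuples 0 0 ts ys (inj₁ λ ()))

module Scan {N : Set} (deg : N → ℕ) (deg≤2 : ∀ a → deg a ≤ 2) (as : List N) where

  open Phases deg deg≤2 as

  scanned-nodes : ∀ (proc : Transitions) bs ys →
    ((∃[ a ] proc a ≡ []) × scanned 0 0 (concatMap (encodeTuples ∘ proc) bs ++ ys) ≡ 1) ⊎
    (All (λ a → proc a ≢ []) bs × scanned 0 0 (concatMap (encodeTuples ∘ proc) bs ++ ys) ≡ scanned 0 0 ys)
  scanned-nodes proc []       ys = inj₂ ([] , refl)
  scanned-nodes proc (b ∷ bs) ys rewrite ++-assoc (encodeTuples (proc b)) (concatMap (encodeTuples ∘ proc) bs) ys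
    with scanned-block (proc b) (concatMap (encodeTuples ∘ proc) bs ++ ys) | scanned-nodes proc bs ys
  ... | inj₁ (e , eq)  | _                = inj₁ ((b , e) , eq)
  ... | inj₂ (ne , eq) | inj₁ (e , eq′)   = inj₁ (e , trans eq eq′)
  ... | inj₂ (ne , eq) | inj₂ (nes , eq′) = inj₂ (ne ∷ nes , trans eq eq′)

  scanned-streams : ∀ r acc proc →
    ((∃[ i ] (acc i ≡ [] ⊎ ∃[ a ] proc i a ≡ [])) × scanned 0 0 (streams r acc proc) ≡ 1) ⊎
    ((∀ i → All (λ a → proc i a ≢ []) as) × scanned 0 0 (streams r acc proc) ≡ 0)
  scanned-streams zero    acc proc = inj₂ ((λ ()) , refl)
  scanned-streams (suc r) acc proc
    rewrite ++-assoc (encodeTuples (map Vec.[_] (acc zero))) (concatMap (encodeTuples ∘ proc zero) as) (streams r (acc ∘ suc) (proc ∘ suc))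
    with scanned-block (map Vec.[_] (acc zero)) (concatMap (encodeTuples ∘ proc zero) as ++ streams r (acc ∘ suc) (proc ∘ suc))
       | scanned-nodes (proc zero) as (streams r (acc ∘ suc) (proc ∘ suc)) | scanned-streams r (acc ∘ suc) (proc ∘ suc)
  ... | inj₁ (e , eq)  | _                | _                      = inj₁ ((zero , inj₁ (unmap e)) , eq)
    where
    unmap : ∀ {xs : List BitString} → map Vec.[_] xs ≡ [] → xs ≡ []
    unmap {[]} _ = refl
  ... | inj₂ (_ , eq)  | inj₁ (e , eq′)   | _                      = inj₁ ((zero , inj₂ e) , trans eq eq′)
  ... | inj₂ (_ , eq)  | inj₂ (_ , eq′)   | inj₁ ((i , e) , eq″)   = inj₁ ((suc i , e) , trans eq (trans eq′ eq″))
  ... | inj₂ (_ , eq)  | inj₂ (nes , eq′) | inj₂ (rest , eq″)      =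
    inj₂ ((λ { zero → nes ; (suc i) → rest i }) , trans eq (trans eq′ eq″))

-- The entries of the last generation

-- Core `i` contributes at the unit `u * 2 ^ (i * L)`. As contributions are functions of the unit,
-- one definition serves the cells of a node and of its children.
place : ∀ r → ℕ → ℕ → (Fin r → ℕ → ℕ) → ℕ
place zero    u L x = 0
place (suc r) u L x = x zero u + place r (u * 2 ^ L) L (x ∘ suc)

place-cong : ∀ r {u L x y} → (∀ i u → x i u ≡ y i u) → place r u L x ≡ place r u L y
place-cong zero    eq = refl
place-cong (suc r) eq = cong₂ _+_ (eq zero _) (place-cong r (eq ∘ suc))

place-zero : ∀ r {u L} → place r u L (λ _ _ → 0) ≡ 0
place-zero zero    = refl
place-zero (suc r) = place-zero r

-- Node k and the strings ws are the digits of a mixed-radix number.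
address : ∀ r → ℕ → ℕ → ℕ → (Fin r → BitString) → ℕ
address r u L k ws = k + place r u L (λ i u → codeOf u (ws i))

digits : ∀ {u a a′} b b′ → a < u → a′ < u → a + u * b ≡ a′ + u * b′ → a ≡ a′ × b ≡ b′
digits {u@(suc _)} {a} {a′} b b′ a< a′< eq = a≡ , *-cancelˡ-≡ b b′ u (+-cancelˡ-≡ a _ _ (trans eq (cong (_+ u * b′) (sym a≡))))
  where
  mod : ∀ a b → a < u → (a + u * b) % u ≡ a
  mod a b a<u = trans (cong (λ x → (a + x) % u) (*-comm u b)) (trans ([m+kn]%n≡m%n a b u) (m<n⇒m%n≡m a<u))
  a≡ : a ≡ a′
  a≡ = trans (sym (mod a b a<)) (trans (cong (_% u) eq) (mod a′ b′ a′<))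

digit-< : ∀ {u a b B} → a < u → b < B → a + u * b < u * B
digit-< {u} {a} {b} {B} a<u b<B = begin-strict
  a + u * b    <⟨ +-monoˡ-< (u * b) a<u ⟩
  u + u * b    ≡⟨ *-suc u b ⟨
  u * suc b    ≤⟨ *-monoʳ-≤ u b<B ⟩
  u * B        ∎
  where open ≤-Reasoning

-- The node digit and the digit of the first core merge into a single digit below `u * 2 ^ L`, which
-- takes the place of `k` for the remaining cores. Division by `u` separates the two at the end.
address-injective : ∀ r {u L k k′} {ws ws′ : Fin r → BitString} →
  (∀ i → binary (ws i) < 2 ^ L) → (∀ i → binary (ws′ i) < 2 ^ L) → k < u → k′ < u →
  address r u L k ws ≡ address r u L k′ ws′ → k ≡ k′ × (∀ i → ws i ≡ ws′ i)
address-injective zero {k = k} {k′} _ _ _ _ eq = trans (sym (+-identityʳ k)) (trans eq (+-identityʳ k′)) , λ ()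
address-injective (suc r) {u} {L} {k} {k′} {ws} {ws′} b b′ k< k′< eq
  with address-injective r {u * 2 ^ L} {L} {k + u * binary (ws zero)} {k′ + u * binary (ws′ zero)} {ws ∘ suc} {ws′ ∘ suc}
         (b ∘ suc) (b′ ∘ suc) (digit-< k< (b zero)) (digit-< k′< (b′ zero)) (trans (shift k ws) (trans eq (sym (shift k′ ws′))))
  where
  shift : ∀ k ws → k + u * binary (ws zero) + place r (u * 2 ^ L) L (λ i u → codeOf u (ws (suc i))) ≡ address (suc r) u L k ws
  shift k ws = trans (+-assoc k _ _) (cong (λ x → k + (x + place r (u * 2 ^ L) L (λ i u → codeOf u (ws (suc i))))) (sym (codeOf-binary u (ws zero))))
... | k≡ , rest with digits (binary (ws zero)) (binary (ws′ zero)) k< k′< k≡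
...   | k≡′ , w≡ = k≡′ , λ { zero → binary-injective w≡ ; (suc i) → rest i }

-- The entry in the last generation that arises from `e` when the tuple `κ i` is chosen for every
-- core `i`.
total : ∀ r {m} → (Fin r → BitString → Bool) → (Fin r → List BitString) → (wgt u L : ℕ) →
        Entry → (Fin r → Vec BitString (suc m)) → Entry
total zero    ρ acc wgt u L e κ = e
total (suc r) ρ acc wgt u L e κ =
  total r (ρ ∘ suc) (acc ∘ suc) (2 * wgt) (u * 2 ^ L) L (e ⊞ tupleEntry (ρ zero) (rejected (acc zero)) wgt u (κ zero)) (κ ∘ suc)

tupleEntry-addr : ∀ {ρ flag wgt u m} (v : Vec BitString (suc m)) → addr (tupleEntry ρ flag wgt u v) ≡ codeOf u (Vec.head v)
tupleEntry-addr (_ ∷ _) = refl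

tupleEntry-addr₁ : ∀ {ρ flag wgt u m} (v : Vec BitString (suc m)) → addr₁ (tupleEntry ρ flag wgt u v) ≡ child₁ u (Vec.tail v)
tupleEntry-addr₁ (_ ∷ _) = refl

tupleEntry-addr₂ : ∀ {ρ flag wgt u m} (v : Vec BitString (suc m)) → addr₂ (tupleEntry ρ flag wgt u v) ≡ child₂ u (Vec.tail v)
tupleEntry-addr₂ (_ ∷ _) = refl

total-addr : ∀ r {m ρ acc wgt u L} e (κ : Fin r → Vec BitString (suc m)) →
  addr (total r ρ acc wgt u L e κ) ≡ address r u L (addr e) (Vec.head ∘ κ)
total-addr zero    e κ = sym (+-identityʳ _)
total-addr (suc r) {ρ = ρ} {acc} {wgt} {u} {L} e κ = trans (total-addr r _ (κ ∘ suc))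
  (trans (cong (λ x → addr e + x + _) (tupleEntry-addr (κ zero))) (+-assoc (addr e) _ _))

total-addr₁ : ∀ r {m ρ acc wgt u L} e (κ : Fin r → Vec BitString (suc m)) →
  addr₁ (total r ρ acc wgt u L e κ) ≡ addr₁ e + place r u L (λ i u → child₁ u (Vec.tail (κ i)))
total-addr₁ zero    e κ = sym (+-identityʳ _)
total-addr₁ (suc r) e κ = trans (total-addr₁ r _ (κ ∘ suc))
  (trans (cong (λ x → addr₁ e + x + _) (tupleEntry-addr₁ (κ zero))) (+-assoc (addr₁ e) _ _))

total-addr₂ : ∀ r {m ρ acc wgt u L} e (κ : Fin r → Vec BitString (suc m)) →
  addr₂ (total r ρ acc wgt u L e κ) ≡ addr₂ e + place r u L (λ i u → child₂ u (Vec.tail (κ i)))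
total-addr₂ zero    e κ = sym (+-identityʳ _)
total-addr₂ (suc r) e κ = trans (total-addr₂ r _ (κ ∘ suc))
  (trans (cong (λ x → addr₂ e + x + _) (tupleEntry-addr₂ (κ zero))) (+-assoc (addr₂ e) _ _))

-- Doubling `wgt` from core to core follows the recursion of `index`.
total-bits : ∀ r {m ρ acc wgt u L} e (κ : Fin r → Vec BitString (suc m)) →
  bits (total r ρ acc wgt u L e κ) ≡ bits e + wgt * index (Vec.tabulate λ i → ρ i (Vec.head (κ i)))
total-bits zero {wgt = wgt} e κ = trans (sym (+-identityʳ _)) (cong (bits e +_) (sym (*-zeroʳ wgt)))
total-bits (suc r) {ρ = ρ} {wgt = wgt} e κ = trans (total-bits r _ (κ ∘ suc)) (step (κ zero) _)
  where
  step : ∀ v i → bits (e ⊞ tupleEntry (ρ zero) _ wgt _ v) + 2 * wgt * i ≡ bits e + wgt * (bit (ρ zero (Vec.head v)) + 2 * i)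
  step (w ∷ _) i with ρ zero w
  ... | false = lemma (bits e) wgt i
    where
    lemma : ∀ b w i → b + 0 + 2 * w * i ≡ b + w * (0 + 2 * i)
    lemma = solve-∀
  ... | true  = lemma (bits e) wgt i
    where
    lemma : ∀ b w i → b + w + 2 * w * i ≡ b + w * (1 + 2 * i)
    lemma = solve-∀

rejected-∈ : ∀ {acc w} → rejected acc w ≡ 0 → w ∈ acc
rejected-∈ {acc} {w} eq with w ∈? acc
... | yes w∈ = w∈

∈-rejected : ∀ {acc w} → w ∈ acc → rejected acc w ≡ 0
∈-rejected {acc} {w} w∈ with w ∈? acc
... | yes _ = refl
... | no ∉  = contradiction w∈ ∉

tupleEntry-rejects : ∀ {ρ flag wgt u m} (v : Vec BitString (suc m)) → rejects (tupleEntry ρ flag wgt u v) ≡ flag (Vec.head v)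
tupleEntry-rejects (_ ∷ _) = refl

total-rejects⁻ : ∀ r {m ρ acc wgt u L} e (κ : Fin r → Vec BitString (suc m)) →
  rejects (total r ρ acc wgt u L e κ) ≡ 0 → rejects e ≡ 0 × (∀ i → Vec.head (κ i) ∈ acc i)
total-rejects⁻ zero    e κ eq = eq , λ ()
total-rejects⁻ (suc r) {acc = acc} e κ eq with total-rejects⁻ r _ (κ ∘ suc) eq
... | e≡ , rest = m+n≡0⇒m≡0 (rejects e) e≡ ,
  λ { zero → rejected-∈ {acc zero} (trans (sym (tupleEntry-rejects (κ zero))) (m+n≡0⇒n≡0 (rejects e) e≡)) ; (suc i) → rest i }

total-rejects⁺ : ∀ r {m ρ acc wgt u L} e (κ : Fin r → Vec BitString (suc m)) →
  rejects e ≡ 0 → (∀ i → Vec.head (κ i) ∈ acc i) → rejects (total r ρ acc wgt u L e κ) ≡ 0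
total-rejects⁺ zero    e κ e≡ _  = e≡
total-rejects⁺ (suc r) e κ e≡ ∈acc = total-rejects⁺ r _ (κ ∘ suc)
  (cong₂ _+_ e≡ (trans (tupleEntry-rejects (κ zero)) (∈-rejected (∈acc zero)))) (∈acc ∘ suc)

extend-∈⁻ : ∀ {m} {conv : Vec BitString m → Entry} ts {es e} → e ∈ extend conv ts es →
            ∃[ v ] ∃[ e₀ ] v ∈ ts × e₀ ∈ es × e ≡ e₀ ⊞ conv v
extend-∈⁻ {conv = conv} ts {es} e∈ with find (∈-concatMap⁻ (λ v → map (_⊞ conv v) es) {xs = ts} e∈)
... | v , v∈ , e∈′ with ∈-map⁻ (_⊞ conv v) e∈′
...   | e₀ , e₀∈ , eq = v , e₀ , v∈ , e₀∈ , eq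

extend-∈⁺ : ∀ {m} (conv : Vec BitString m → Entry) {ts es v e} → v ∈ ts → e ∈ es → e ⊞ conv v ∈ extend conv ts es
extend-∈⁺ conv {es = es} {v} v∈ e∈ = ∈-concatMap⁺ (λ v → map (_⊞ conv v) es) (lose v∈ (∈-map⁺ (_⊞ conv v) e∈))

module Generations {N : Set} (deg : N → ℕ) (deg≤2 : ∀ a → deg a ≤ 2) (as : List N) where

  open Phases deg deg≤2 as

  generations-∈⁻ : ∀ r {ρ acc} proc {wgt u L es a e} → e ∈ generations r ρ acc proc wgt u L es a →
    ∃[ κ ] ∃[ e₀ ] (∀ i → κ i ∈ proc i a) × e₀ ∈ es a × e ≡ total r ρ acc wgt u L e₀ κ
  generations-∈⁻ zero    proc {e = e} e∈ = (λ ()) , e , (λ ()) , e∈ , refl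
  generations-∈⁻ (suc r) proc {a = a} e∈ with generations-∈⁻ r (proc ∘ suc) e∈
  ... | κ , e₁ , κ∈ , e₁∈ , refl with extend-∈⁻ (proc zero a) e₁∈
  ...   | v , e₀ , v∈ , e₀∈ , refl =
    (λ { zero → v ; (suc i) → κ i }) , e₀ , (λ { zero → v∈ ; (suc i) → κ∈ i }) , e₀∈ , refl

  generations-∈⁺ : ∀ r {ρ acc proc wgt u L es a} (κ : ∀ i → Vec BitString (suc (deg a))) {e} →
    (∀ i → κ i ∈ proc i a) → e ∈ es a → total r ρ acc wgt u L e κ ∈ generations r ρ acc proc wgt u L es a
  generations-∈⁺ zero    κ κ∈ e∈ = e∈
  generations-∈⁺ (suc r) κ κ∈ e∈ = generations-∈⁺ r (κ ∘ suc) (κ∈ ∘ suc) (extend-∈⁺ _ (κ∈ zero) e∈)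

  -- Every string in the stream is so short that its code fits into one digit.
  concatMap-length : ∀ {A : Set} (g : A → List ℕ) {xs x} → x ∈ xs → length (g x) ≤ length (concatMap g xs)
  concatMap-length g {x ∷ xs} (here refl) = subst (length (g x) ≤_) (sym (length-++ (g x))) (m≤m+n _ _)
  concatMap-length g {y ∷ xs} (there x∈)  =
    ≤-trans (concatMap-length g x∈) (subst (length (concatMap g xs) ≤_) (sym (length-++ (g y))) (m≤n+m _ _))

  streams-length : ∀ r acc proc i a {v w} → a ∈ as → v ∈ proc i a → w ∈ Vec.toList v →
                   suc (length w) ≤ length (streams r acc proc)
  streams-length (suc r) acc proc zero a {v} {w} a∈ v∈ w∈ = begin
    suc (length w)                            ≡⟨ encodeString-length w ⟨
    length (encodeString w)                   ≤⟨ concatMap-length encodeString w∈ ⟩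
    length (encodeTuple v)                    ≤⟨ concatMap-length encodeTuple v∈ ⟩
    length (concatMap encodeTuple (proc zero a)) ≤⟨ m≤m+n _ 1 ⟩
    length (concatMap encodeTuple (proc zero a)) + 1 ≡⟨ length-++ (concatMap encodeTuple (proc zero a)) ⟨
    length (encodeTuples (proc zero a))       ≤⟨ concatMap-length (encodeTuples ∘ proc zero) a∈ ⟩
    length (concatMap (encodeTuples ∘ proc zero) as)   ≤⟨ m≤n+m _ _ ⟩
    length A + length (concatMap (encodeTuples ∘ proc zero) as) ≡⟨ length-++ A ⟨
    length (coreStream (acc zero) (proc zero)) ≤⟨ m≤m+n _ _ ⟩
    length (coreStream (acc zero) (proc zero)) + length (streams r (acc ∘ suc) (proc ∘ suc)) ≡⟨ length-++ (coreStream (acc zero) (proc zero)) ⟨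
    length (streams (suc r) acc proc)         ∎
    where
    open ≤-Reasoning
    A : List ℕ
    A = encodeTuples (map Vec.[_] (acc zero))
  streams-length (suc r) acc proc (suc i) a a∈ v∈ w∈ =
    ≤-trans (streams-length r (acc ∘ suc) (proc ∘ suc) i a a∈ v∈ w∈)
      (subst (length (streams r (acc ∘ suc) (proc ∘ suc)) ≤_) (sym (length-++ (coreStream (acc zero) (proc zero)))) (m≤n+m _ _))

  streams-binary : ∀ r acc proc i a {v w} → a ∈ as → v ∈ proc i a → w ∈ Vec.toList v →
                   binary w < 2 ^ length (streams r acc proc)
  streams-binary r acc proc i a {v} {w} a∈ v∈ w∈ =
    <-≤-trans (binary-< w) (^-monoʳ-≤ 2 (streams-length r acc proc i a a∈ v∈ w∈))

-- Correctness of the table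

-- A table holds 0 for an unreachable value and v + 1 for the maximum v.
IsBest : ℕ → (ℕ → Set) → Set
IsBest v R = (∀ s → R s → s < v) × (v ≡ 0 ⊎ ∃[ s ] v ≡ suc s × R s)

IsBest-map : ∀ {v R R′} → (∀ s → R s → R′ s) → (∀ s → R′ s → R s) → IsBest v R → IsBest v R′
IsBest-map to from (up , inj₁ z)            = (λ s → up s ∘ from s) , inj₁ z
IsBest-map to from (up , inj₂ (s , eq , x)) = (λ s → up s ∘ from s) , inj₂ (s , eq , to s x)

-- Describes the preset cell 0: a missing child allows the contribution 0 and no other.
IsBest-zero : IsBest 1 (_≡ 0)
IsBest-zero = (λ { _ refl → s≤s z≤n }) , inj₂ (0 , refl , refl)

-- The two summands vary independently, so the maximum of the sum is the sum of the maxima.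
combine-best : ∀ {v₁ v₂ R₁ R₂} w → IsBest v₁ R₁ → IsBest v₂ R₂ →
               IsBest (combine v₁ v₂ w) (λ s → ∃[ s₁ ] ∃[ s₂ ] R₁ s₁ × R₂ s₂ × s ≡ s₁ + s₂ + w)
combine-best {zero} w (up , _) _ = (λ { _ (s₁ , _ , x₁ , _) → contradiction (up s₁ x₁) λ () }) , inj₁ refl
combine-best {suc x} {zero} w _ (up , _) = (λ { _ (_ , s₂ , _ , x₂ , _) → contradiction (up s₂ x₂) λ () }) , inj₁ refl
combine-best {suc x} {suc y} w (up₁ , inj₂ (x , refl , r₁)) (up₂ , inj₂ (y , refl , r₂)) =
  (λ { _ (s₁ , s₂ , x₁ , x₂ , refl) → subst (s₁ + s₂ + w <_) (cong (_+ w) (sym (+-suc x y)))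
        (+-monoˡ-≤ w (s≤s (+-mono-≤ (s≤s⁻¹ (up₁ s₁ x₁)) (s≤s⁻¹ (up₂ s₂ x₂))))) }) ,
  inj₂ (x + y + w , cong (_+ w) (+-suc x y) , x , y , r₁ , r₂ , refl)

≤-joinˡ : ∀ a b → a ≤ join a b
≤-joinˡ a b = m≤m+n a (b ∸ a)

≤-joinʳ : ∀ a b → b ≤ join a b
≤-joinʳ a b = m≤n+m∸n b a

join-cases : ∀ a b → join a b ≡ a ⊎ join a b ≡ b
join-cases a b with ≤-total b a
... | inj₁ b≤a = inj₁ (trans (cong (a +_) (m≤n⇒m∸n≡0 b≤a)) (+-identityʳ a))
... | inj₂ a≤b = inj₂ (m+[n∸m]≡n a≤b)

relaxNodes-++ : ∀ F xs {ys} tb → relaxNodes F (xs ++ ys) tb ≡ relaxNodes F ys (relaxNodes F xs tb)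
relaxNodes-++ F []       tb = refl
relaxNodes-++ F (x ∷ xs) tb = relaxNodes-++ F xs (relaxAll F x tb)

finalBest-∷ʳ : ∀ F xs es tb b → finalBest F (xs ++ [ es ]) tb b ≡ bestOf F es (relaxNodes F xs tb) 0
finalBest-∷ʳ F []       es tb b = refl
finalBest-∷ʳ F (x ∷ xs) es tb b = finalBest-∷ʳ F xs es (relaxAll F x tb) _

-- No entry of a node reads a cell that an entry of the same node writes.
Separated : List Entry → Set
Separated es = ∀ {e e′} → e ∈ es → e′ ∈ es → addr e ≢ addr₁ e′ × addr e ≢ addr₂ e′

module _ (F : ℕ → ℕ) where

  value-relaxed : ∀ {e e′ tb} → addr e ≢ addr₁ e′ → addr e ≢ addr₂ e′ → value F (relaxed F tb e) e′ ≡ value F tb e′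
  value-relaxed {e} {e′} {tb} ≢₁ ≢₂ =
    cong₂ (λ x y → combine x y (F (bits e′))) (update-other tb ≢₁) (update-other tb ≢₂)

  relaxAll-other : ∀ es {tb x} → (∀ {e} → e ∈ es → addr e ≢ x) → relaxAll F es tb x ≡ tb x
  relaxAll-other []       _  = refl
  relaxAll-other (e ∷ es) {tb} ne = trans (relaxAll-other es (ne ∘ there)) (update-other tb (ne (here refl)))

  relaxed-≥ : ∀ e tb x → tb x ≤ relaxed F tb e x
  relaxed-≥ e tb x with addr e ≟ x
  ... | yes refl = ≤-trans (≤-joinˡ (tb x) (value F tb e)) (≤-reflexive (sym (update-same tb x)))
  ... | no ≢x    = ≤-reflexive (sym (update-other tb ≢x))

  relaxAll-≥ : ∀ es tb x → tb x ≤ relaxAll F es tb x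
  relaxAll-≥ []       tb x = ≤-refl
  relaxAll-≥ (e ∷ es) tb x = ≤-trans (relaxed-≥ e tb x) (relaxAll-≥ es (relaxed F tb e) x)

  -- None of the cells read by these entries changes in the meantime, so `e` sees the values of the
  -- initial table `tb` when its turn comes. Later joins only raise its cell.
  relaxAll-value : ∀ es {tb e} → Separated es → e ∈ es → value F tb e ≤ relaxAll F es tb (addr e)
  relaxAll-value (e ∷ es) {tb} sep (here refl) =
    ≤-trans (≤-joinʳ (tb (addr e)) (value F tb e)) (≤-trans (≤-reflexive (sym (update-same tb (addr e)))) (relaxAll-≥ es _ (addr e)))
  relaxAll-value (e₀ ∷ es) {tb} {e} sep (there e∈) =
    ≤-trans (≤-reflexive (sym (value-relaxed {e₀} {e} {tb} (proj₁ (sep (here refl) (there e∈))) (proj₂ (sep (here refl) (there e∈))))))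
            (relaxAll-value es (λ p q → sep (there p) (there q)) e∈)

  relaxAll-cases : ∀ es {tb} x → Separated es →
    relaxAll F es tb x ≡ tb x ⊎ ∃[ e ] e ∈ es × addr e ≡ x × relaxAll F es tb x ≡ value F tb e
  relaxAll-cases []        x sep = inj₁ refl
  relaxAll-cases (e₀ ∷ es) {tb} x sep with relaxAll-cases es {relaxed F tb e₀} x (λ p q → sep (there p) (there q))
  ... | inj₂ (e , e∈ , a≡ , eq) = inj₂ (e , there e∈ , a≡ ,
          trans eq (value-relaxed {e₀} {e} {tb} (proj₁ (sep (here refl) (there e∈))) (proj₂ (sep (here refl) (there e∈)))))
  ... | inj₁ eq with addr e₀ ≟ x
  ...   | no ≢x = inj₁ (trans eq (update-other tb ≢x))
  ...   | yes refl with join-cases (tb x) (value F tb e₀)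
  ...     | inj₁ old = inj₁ (trans eq (trans (update-same tb x) old))
  ...     | inj₂ new = inj₂ (e₀ , here refl , refl , trans eq (trans (update-same tb x) new))

  better-≥ : ∀ tb e b → b ≤ better F tb e b
  better-≥ tb e b with rejects e
  ... | zero  = ≤-joinˡ b (value F tb e)
  ... | suc _ = ≤-refl

  bestOf-≥ : ∀ es tb b → b ≤ bestOf F es tb b
  bestOf-≥ []       tb b = ≤-refl
  bestOf-≥ (e ∷ es) tb b = ≤-trans (better-≥ tb e b) (bestOf-≥ es (relaxed F tb e) (better F tb e b))

  bestOf-value : ∀ es {tb b e} → Separated es → e ∈ es → rejects e ≡ 0 → value F tb e ≤ bestOf F es tb b
  bestOf-value (e ∷ es) {tb} {b} sep (here refl) acc =
    ≤-trans (≤-joinʳ b (value F tb e)) (≤-trans (≤-reflexive (sym (better-accepted F tb e acc))) (bestOf-≥ es (relaxed F tb e) (better F tb e b)))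
  bestOf-value (e₀ ∷ es) {tb} {b} {e} sep (there e∈) acc =
    ≤-trans (≤-reflexive (sym (value-relaxed {e₀} {e} {tb} (proj₁ (sep (here refl) (there e∈))) (proj₂ (sep (here refl) (there e∈))))))
            (bestOf-value es (λ p q → sep (there p) (there q)) e∈ acc)

  better-cases : ∀ tb e b → better F tb e b ≡ b ⊎ (rejects e ≡ 0 × better F tb e b ≡ value F tb e)
  better-cases tb e b with rejects e
  ... | suc _ = inj₁ refl
  ... | zero with join-cases b (value F tb e)
  ...   | inj₁ old = inj₁ old
  ...   | inj₂ new = inj₂ (refl , new)

  bestOf-cases : ∀ es {tb b} → Separated es →
    bestOf F es tb b ≡ b ⊎ ∃[ e ] e ∈ es × rejects e ≡ 0 × bestOf F es tb b ≡ value F tb e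
  bestOf-cases []        sep = inj₁ refl
  bestOf-cases (e₀ ∷ es) {tb} {b} sep with bestOf-cases es {relaxed F tb e₀} {better F tb e₀ b} (λ p q → sep (there p) (there q))
  ... | inj₂ (e , e∈ , acc , eq) = inj₂ (e , there e∈ , acc ,
          trans eq (value-relaxed {e₀} {e} {tb} (proj₁ (sep (here refl) (there e∈))) (proj₂ (sep (here refl) (there e∈)))))
  ... | inj₁ eq with better-cases tb e₀ b
  ...   | inj₁ old         = inj₁ (trans eq old)
  ...   | inj₂ (acc , new) = inj₂ (e₀ , here refl , acc , trans eq new)

leafTotal : ∀ {ω} (D : CW ω) → (Node D → ℕ) → ℕ
leafTotal (intro _ _)      h = h root
leafTotal (D₁ ⊕ D₂)        h = leafTotal D₁ (h ∘ inˡ) + leafTotal D₂ (h ∘ inʳ)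
leafTotal (recolor D _ _)  h = leafTotal D (h ∘ inRecolor)
leafTotal (addEdges D _ _) h = leafTotal D (h ∘ inAdd)

∣V∣>0 : ∀ {ω} (D : CW ω) → 1 ≤ ∣V D ∣
∣V∣>0 (intro _ _)      = s≤s z≤n
∣V∣>0 (D₁ ⊕ D₂)        = subst (1 ≤_) (sym (∣⊕∣ D₁ D₂)) (s≤s z≤n)
∣V∣>0 (recolor D a b)  = subst (1 ≤_) (sym (∣recolor∣ D a b)) (s≤s z≤n)
∣V∣>0 (addEdges D a b) = subst (1 ≤_) (sym (∣addEdges∣ D a b)) (s≤s z≤n)

head-∈ : ∀ {A : Set} {m} (v : Vec A (suc m)) → Vec.head v ∈ Vec.toList v
head-∈ (_ ∷ _) = here refl

tail-∈ : ∀ {A : Set} {m} (v : Vec A (suc m)) {w} → w ∈ Vec.toList (Vec.tail v) → w ∈ Vec.toList v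
tail-∈ (_ ∷ _) = there

second : ∀ {A : Set} {m} → Vec A (suc (suc m)) → A
second v = Vec.head (Vec.tail v)

third : ∀ {A : Set} {m} → Vec A (suc (suc (suc m))) → A
third v = second (Vec.tail v)

-- Of the mixed-radix addresses only injectivity on short strings, positivity on nodes and
-- extensionality matter here; extensionality is a premise because keys are functions.
module Table {r : ℕ} (A : ℕ → (Fin r → BitString) → ℕ) (n : ℕ) (Legal : BitString → Set)
  (A-injective : ∀ {k k′ ws ws′} → (∀ i → Legal (ws i)) → (∀ i → Legal (ws′ i)) → k ≤ n → k′ ≤ n →
                 A k ws ≡ A k′ ws′ → k ≡ k′ × (∀ i → ws i ≡ ws′ i))
  (A-positive : ∀ k ws → 1 ≤ k → A k ws ≢ 0)
  (A-cong : ∀ k ws ws′ → (∀ i → ws i ≡ ws′ i) → A k ws ≡ A k ws′)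
  (weight : (Fin r → BitString) → ℕ) (weight-cong : ∀ {ws ws′} → (∀ i → ws i ≡ ws′ i) → weight ws ≡ weight ws′)
  (F : ℕ → ℕ) {ω : ℕ} where

  Keys : Set
  Keys = Fin r → BitString

  kidAddr₁ kidAddr₂ : ∀ {m} → Vec ℕ m → (Fin r → Vec BitString m) → ℕ
  kidAddr₁ []       κ = 0
  kidAddr₁ (k ∷ _)  κ = A k (Vec.head ∘ κ)
  kidAddr₂ []       κ = 0
  kidAddr₂ (_ ∷ ks) κ = kidAddr₁ ks (Vec.tail ∘ κ)

  leafBonus : ℕ → Keys → ℕ
  leafBonus zero    ws = weight ws
  leafBonus (suc _) ws = 0

  record IsEntry {m} (x : ℕ) (kids : Vec ℕ m) (κ : Fin r → Vec BitString (suc m)) (e : Entry) : Set where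
    constructor isEntry
    field
      addr≡  : addr e ≡ A x (Vec.head ∘ κ)
      addr₁≡ : addr₁ e ≡ kidAddr₁ kids (Vec.tail ∘ κ)
      addr₂≡ : addr₂ e ≡ kidAddr₂ kids (Vec.tail ∘ κ)
      bonus≡ : F (bits e) ≡ leafBonus m (Vec.head ∘ κ)

  Family : CW ω → Set
  Family D = Fin r → (t : Node D) → List (Vec BitString (suc (δ t)))

  -- What the table relies on: the entries of a node stand for the choices of one tuple per core,
  -- and all strings involved are legal, so that addresses determine them.
  record Spec {D : CW ω} (k : ℕ) (P : Family D) (E : Node D → List Entry) : Set where
    constructor spec
    field
      to    : ∀ t {e} → e ∈ E t → ∃[ κ ] (∀ i → κ i ∈ P i t) × IsEntry (num k t) (childNums k t) κ e
      from  : ∀ t κ → (∀ i → κ i ∈ P i t) → ∃[ e ] e ∈ E t × IsEntry (num k t) (childNums k t) κ e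
      legal : ∀ i t {v w} → v ∈ P i t → w ∈ Vec.toList v → Legal w

  leafWeight : ∀ (D : CW ω) → (Fin r → Node D → BitString) → ℕ
  leafWeight D α = leafTotal D (λ t → weight (λ i → α i t))

  Processed : ∀ {D} → Family D → (Fin r → Node D → BitString) → Set
  Processed P α = ∀ i t → (α i t ∷ Vec.map (α i) (children t)) ∈ P i t

  -- `Via` fixes the whole tuples at the root, `Reach` below only the states there. The first
  -- describes the value of one entry, the second the content of one cell.
  Via : ∀ {D} → Family D → (Fin r → Vec BitString (suc (arity D))) → ℕ → Set
  Via {D} P κ s = ∃[ α ] (∀ i → α i root ∷ Vec.map (α i) (rootChildren D) ≡ κ i) × Processed P α × leafWeight D α ≡ s

  Reach : ∀ {D} → Family D → Keys → ℕ → Set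
  Reach {D} P ws s = ∃[ α ] (∀ i → α i root ≡ ws i) × Processed P α × leafWeight D α ≡ s

  -- The postorder numbers the nodes of a subtree consecutively, so an interval of numbers describes
  -- the cells that belong to it.
  Outside : ℕ → ℕ → ℕ → Set
  Outside k m x = ∀ j ws → (∀ i → Legal (ws i)) → k < j → j ≤ m → A j ws ≢ x

  Vacant : ℕ → ℕ → (ℕ → ℕ) → Set
  Vacant k m tb = ∀ j ws → (∀ i → Legal (ws i)) → k < j → j ≤ m → tb (A j ws) ≡ 0

  -- The situation just before the entries of the root are treated. Stopping there lets the same
  -- induction serve both the cells of the root, in `solve`, and the maximum over accepting entries,
  -- in `finalBest-best`.
  record Tree (D : CW ω) (k : ℕ) (P : Family D) (E : Node D → List Entry) (tb : ℕ → ℕ) : Set where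
    constructor tree
    field
      prefix : List (List Entry)
      split  : map E (postorder D) ≡ prefix ++ [ E root ]
      kept   : ∀ x → Outside k (k + ∣V D ∣) x → relaxNodes F prefix tb x ≡ tb x
      vacant : ∀ ws → (∀ i → Legal (ws i)) → relaxNodes F prefix tb (A (k + ∣V D ∣) ws) ≡ 0
      values : ∀ {e} κ → (∀ i → κ i ∈ P i root) → IsEntry (k + ∣V D ∣) (childNums k root) κ e →
               IsBest (value F (relaxNodes F prefix tb) e) (Via P κ)

  record Solved (D : CW ω) (k : ℕ) (P : Family D) (tb tb′ : ℕ → ℕ) : Set where
    constructor solved
    field
      kept : ∀ x → Outside k (k + ∣V D ∣) x → tb′ x ≡ tb x
      optimal : ∀ ws → (∀ i → Legal (ws i)) → IsBest (tb′ (A (k + ∣V D ∣) ws)) (Reach P ws)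

  outside-A : ∀ {k m j ws} → (∀ i → Legal (ws i)) → m ≤ n → j ≤ n → j ≤ k ⊎ m < j → Outside k m (A j ws)
  outside-A lg m≤n j≤n far j′ ws′ lg′ k<j′ j′≤m eq with A-injective lg′ lg (≤-trans j′≤m m≤n) j≤n eq
  outside-A lg m≤n j≤n (inj₁ j≤k) j′ ws′ lg′ k<j′ j′≤m eq | refl , _ = <⇒≱ k<j′ j≤k
  outside-A lg m≤n j≤n (inj₂ m<j) j′ ws′ lg′ k<j′ j′≤m eq | refl , _ = <⇒≱ m<j j′≤m

  outside-0 : ∀ {k m} → Outside k m 0
  outside-0 j ws lg k<j j≤m = A-positive _ _ (≤-trans (s≤s z≤n) k<j)

  childNums-< : ∀ (D : CW ω) k {j} → j ∈ Vec.toList (childNums k (root {D = D})) → j < k + ∣V D ∣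
  childNums-< (D₁ ⊕ D₂) k (here refl) rewrite ∣⊕∣ D₁ D₂ = +-monoʳ-< k (s≤s (m≤m+n _ _))
  childNums-< (D₁ ⊕ D₂) k (there (here refl)) rewrite ∣⊕∣ D₁ D₂ =
    ≤-reflexive (trans (cong suc (+-assoc k _ _)) (sym (+-suc k _)))
  childNums-< (recolor D a b)  k (here refl) rewrite ∣recolor∣ D a b = +-monoʳ-< k ≤-refl
  childNums-< (addEdges D a b) k (here refl) rewrite ∣addEdges∣ D a b = +-monoʳ-< k ≤-refl

  kidAddr₁-≢ : ∀ {m} (kids : Vec ℕ m) κ {x ws} → 1 ≤ x → x ≤ n → (∀ i → Legal (ws i)) →
    (∀ {j} → j ∈ Vec.toList kids → j < x) → (∀ i {w} → w ∈ Vec.toList (κ i) → Legal w) → A x ws ≢ kidAddr₁ kids κ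
  kidAddr₁-≢ []       κ 1≤x x≤n lg lt lgκ eq = A-positive _ _ 1≤x eq
  kidAddr₁-≢ (j ∷ _)  κ 1≤x x≤n lg lt lgκ eq =
    <⇒≢ (lt (here refl)) (sym (proj₁ (A-injective lg (λ i → lgκ i (head-∈ (κ i))) x≤n (≤-trans (<⇒≤ (lt (here refl))) x≤n) eq)))

  kidAddr₂-≢ : ∀ {m} (kids : Vec ℕ m) κ {x ws} → 1 ≤ x → x ≤ n → (∀ i → Legal (ws i)) →
    (∀ {j} → j ∈ Vec.toList kids → j < x) → (∀ i {w} → w ∈ Vec.toList (κ i) → Legal w) → A x ws ≢ kidAddr₂ kids κ
  kidAddr₂-≢ []       κ 1≤x x≤n lg lt lgκ eq = A-positive _ _ 1≤x eq
  kidAddr₂-≢ (_ ∷ ks) κ 1≤x x≤n lg lt lgκ    = kidAddr₁-≢ ks (Vec.tail ∘ κ) 1≤x x≤n lg (lt ∘ there) (λ i → lgκ i ∘ tail-∈ (κ i))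

  module _ {D : CW ω} {k : ℕ} {P : Family D} {E : Node D → List Entry} (S : Spec k P E) (le : k + ∣V D ∣ ≤ n) where

    open Spec S

    headLegal : ∀ t (κ : Fin r → Vec BitString (suc (δ t))) → (∀ i → κ i ∈ P i t) → ∀ i → Legal (Vec.head (κ i))
    headLegal t κ κ∈ i = legal i t (κ∈ i) (head-∈ (κ i))

    tailLegal : ∀ t (κ : Fin r → Vec BitString (suc (δ t))) → (∀ i → κ i ∈ P i t) → ∀ i {w} → w ∈ Vec.toList (Vec.tail (κ i)) → Legal w
    tailLegal t κ κ∈ i w∈ = legal i t (κ∈ i) (tail-∈ (κ i) w∈)

    root≥1 : 1 ≤ k + ∣V D ∣
    root≥1 = ≤-trans (∣V∣>0 D) (m≤n+m _ k)

    -- The entries write cells with the number of the root, and read cells with smaller numbers or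
    -- cell 0.
    separated : Separated (E root)
    separated {e} {e′} e∈ e′∈ with to root e∈ | to root e′∈
    ... | κ , κ∈ , isEntry a _ _ _ | κ′ , κ′∈ , isEntry _ a₁ a₂ _ =
      (λ eq → kidAddr₁-≢ (childNums k root) (Vec.tail ∘ κ′) root≥1 le (headLegal root κ κ∈) (childNums-< D k)
                (tailLegal root κ′ κ′∈) (trans (sym a) (trans eq a₁))) ,
      (λ eq → kidAddr₂-≢ (childNums k root) (Vec.tail ∘ κ′) root≥1 le (headLegal root κ κ∈) (childNums-< D k)
                (tailLegal root κ′ κ′∈) (trans (sym a) (trans eq a₂)))

    -- A family is counted by the entry made of its tuples at the root. Conversely, an entry that
    -- determines a cell belongs to just the states of this cell, because addresses are injective.
    solve : ∀ {tb} → Tree D k P E tb → Solved D k P tb (relaxNodes F (map E (postorder D)) tb)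
    solve {tb} T = solved
      (λ x o → trans (cong (λ h → h x) table≡) (trans (relaxAll-other F (E root) λ e∈ → away x o (to root e∈)) (kept x o)))
      (λ ws lg → subst (λ v → IsBest v (Reach P ws)) (sym (cong (λ h → h (A (k + ∣V D ∣) ws)) table≡))
        ((λ s R → upper ws lg s R) , lower ws lg))
      where
      open Tree T
      tb₂ : ℕ → ℕ
      tb₂ = relaxNodes F prefix tb
      table≡ : relaxNodes F (map E (postorder D)) tb ≡ relaxAll F (E root) tb₂
      table≡ = trans (cong (λ es → relaxNodes F es tb) split) (relaxNodes-++ F prefix tb)
      away : ∀ x → Outside k (k + ∣V D ∣) x → ∀ {e} →
             ∃[ κ ] (∀ i → κ i ∈ P i root) × IsEntry (k + ∣V D ∣) (childNums k root) κ e → addr e ≢ x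
      away x o (κ , κ∈ , isEntry a _ _ _) eq =
        o (k + ∣V D ∣) (Vec.head ∘ κ) (headLegal root κ κ∈) (m<m+n k (∣V∣>0 D)) ≤-refl (trans (sym a) eq)
      upper : ∀ ws → (∀ i → Legal (ws i)) → ∀ s → Reach P ws s → s < relaxAll F (E root) tb₂ (A (k + ∣V D ∣) ws)
      upper ws lg s (α , α≡ , pr , sum≡) with from root (λ i → α i root ∷ Vec.map (α i) (rootChildren D)) (λ i → pr i root)
      ... | e , e∈ , is = <-≤-trans (proj₁ (values _ (λ i → pr i root) is) s (α , (λ _ → refl) , pr , sum≡))
              (≤-trans (relaxAll-value F (E root) separated e∈)
                (≤-reflexive (cong (relaxAll F (E root) tb₂) (trans (IsEntry.addr≡ is) (A-cong _ _ _ α≡)))))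
      lower : ∀ ws → (∀ i → Legal (ws i)) → relaxAll F (E root) tb₂ (A (k + ∣V D ∣) ws) ≡ 0 ⊎
              ∃[ s ] relaxAll F (E root) tb₂ (A (k + ∣V D ∣) ws) ≡ suc s × Reach P ws s
      lower ws lg with relaxAll-cases F (E root) {tb₂} (A (k + ∣V D ∣) ws) separated
      -- The cell has kept its old content, the 0 of a vacant cell.
      ... | inj₁ eq = inj₁ (trans eq (vacant ws lg))
      ... | inj₂ (e , e∈ , a≡ , eq) with to root e∈
      ...   | κ , κ∈ , is with values κ κ∈ is
      ...     | _ , inj₁ z = inj₁ (trans eq z)
      ...     | _ , inj₂ (s , eq′ , α , α≡ , pr , sum≡) = inj₂ (s , trans eq eq′ , α ,
                  (λ i → trans (cong Vec.head (α≡ i)) (proj₂ (A-injective (headLegal root κ κ∈) lg le le (trans (sym (IsEntry.addr≡ is)) a≡)) i)) ,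
                  pr , sum≡)

  Spec-inˡ : ∀ {D₁ D₂ k P E} → Spec {D₁ ⊕ D₂} k P E → Spec {D₁} k (λ i → P i ∘ inˡ) (E ∘ inˡ)
  Spec-inˡ {k = k} (spec to from legal) = spec
    (λ t e∈ → let κ , κ∈ , is = to (inˡ t) e∈ in κ , κ∈ , subst (λ c → IsEntry _ c κ _) (sym (Vec.map-∘ (num k) inˡ (children t))) is)
    (λ t κ κ∈ → let e , e∈ , is = from (inˡ t) κ κ∈ in e , e∈ , subst (λ c → IsEntry _ c κ _) (sym (Vec.map-∘ (num k) inˡ (children t))) is)
    (λ i t → legal i (inˡ t))

  Spec-inʳ : ∀ {D₁ D₂ k P E} → Spec {D₁ ⊕ D₂} k P E → Spec {D₂} (k + ∣V D₁ ∣) (λ i → P i ∘ inʳ) (E ∘ inʳ)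
  Spec-inʳ {D₁} {k = k} (spec to from legal) = spec
    (λ t e∈ → let κ , κ∈ , is = to (inʳ t) e∈ in κ , κ∈ , subst (λ c → IsEntry (num (k + ∣V D₁ ∣) t) c κ _) (sym (Vec.map-∘ (num k) inʳ (children t))) is)
    (λ t κ κ∈ → let e , e∈ , is = from (inʳ t) κ κ∈ in e , e∈ , subst (λ c → IsEntry (num (k + ∣V D₁ ∣) t) c κ _) (sym (Vec.map-∘ (num k) inʳ (children t))) is)
    (λ i t → legal i (inʳ t))

  Spec-inRecolor : ∀ {D a b k P E} → Spec {recolor D a b} k P E → Spec {D} k (λ i → P i ∘ inRecolor) (E ∘ inRecolor)
  Spec-inRecolor {k = k} (spec to from legal) = spec
    (λ t e∈ → let κ , κ∈ , is = to (inRecolor t) e∈ in κ , κ∈ , subst (λ c → IsEntry _ c κ _) (sym (Vec.map-∘ (num k) inRecolor (children t))) is)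
    (λ t κ κ∈ → let e , e∈ , is = from (inRecolor t) κ κ∈ in e , e∈ , subst (λ c → IsEntry _ c κ _) (sym (Vec.map-∘ (num k) inRecolor (children t))) is)
    (λ i t → legal i (inRecolor t))

  Spec-inAdd : ∀ {D a b k P E} → Spec {addEdges D a b} k P E → Spec {D} k (λ i → P i ∘ inAdd) (E ∘ inAdd)
  Spec-inAdd {k = k} (spec to from legal) = spec
    (λ t e∈ → let κ , κ∈ , is = to (inAdd t) e∈ in κ , κ∈ , subst (λ c → IsEntry _ c κ _) (sym (Vec.map-∘ (num k) inAdd (children t))) is)
    (λ t κ κ∈ → let e , e∈ , is = from (inAdd t) κ κ∈ in e , e∈ , subst (λ c → IsEntry _ c κ _) (sym (Vec.map-∘ (num k) inAdd (children t))) is)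
    (λ i t → legal i (inAdd t))

  entry-value : ∀ tb {m x} {kids : Vec ℕ m} {κ e} → IsEntry x kids κ e →
    value F tb e ≡ combine (tb (kidAddr₁ kids (Vec.tail ∘ κ))) (tb (kidAddr₂ kids (Vec.tail ∘ κ))) (leafBonus m (Vec.head ∘ κ))
  entry-value tb (isEntry _ a₁ a₂ b) rewrite a₁ | a₂ | b = refl

  η₁ : ∀ (v : Vec BitString 1) → Vec.head v ∷ [] ≡ v
  η₁ (_ ∷ []) = refl

  η₂ : ∀ (v : Vec BitString 2) → Vec.head v ∷ second v ∷ [] ≡ v
  η₂ (_ ∷ _ ∷ []) = refl

  η₃ : ∀ (v : Vec BitString 3) → Vec.head v ∷ second v ∷ third v ∷ [] ≡ v
  η₃ (_ ∷ _ ∷ _ ∷ []) = refl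

  via-leaf : ∀ {v a} {P : Family (intro v a)} κ → (∀ i → κ i ∈ P i root) → IsBest (suc (weight (Vec.head ∘ κ))) (Via P κ)
  via-leaf {P = P} κ κ∈ =
    (λ { s (α , α≡ , _ , refl) → s≤s (≤-reflexive (weight-cong (λ i → cong Vec.head (α≡ i)))) }) ,
    inj₂ (_ , refl , (λ i _ → Vec.head (κ i)) , (λ i → η₁ (κ i)) ,
      (λ { i root → subst (_∈ P i root) (sym (η₁ (κ i))) (κ∈ i) }) , refl)

  join⊕ : ∀ {D₁ D₂ : CW ω} → BitString → (Node D₁ → BitString) → (Node D₂ → BitString) → Node (D₁ ⊕ D₂) → BitString
  join⊕ w α₁ α₂ root    = w
  join⊕ w α₁ α₂ (inˡ t) = α₁ t
  join⊕ w α₁ α₂ (inʳ t) = α₂ t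

  -- Once the tuples at the root fix the states of both children, the families below are
  -- independent: any two of them can be joined, and every family splits into two.
  via-⊕ : ∀ {D₁ D₂} {P : Family (D₁ ⊕ D₂)} {v₁ v₂} κ → (∀ i → κ i ∈ P i root) →
    IsBest v₁ (Reach (λ i → P i ∘ inˡ) (second ∘ κ)) →
    IsBest v₂ (Reach (λ i → P i ∘ inʳ) (third ∘ κ)) →
    IsBest (combine v₁ v₂ 0) (Via P κ)
  via-⊕ {D₁} {D₂} {P} κ κ∈ b₁ b₂ = IsBest-map
    (λ { s (s₁ , s₂ , (α₁ , r₁ , p₁ , refl) , (α₂ , r₂ , p₂ , refl) , refl) →
      let α : ∀ i → Node (D₁ ⊕ D₂) → BitString
          α i = join⊕ (Vec.head (κ i)) (α₁ i) (α₂ i)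
          root≡ : ∀ i → Vec.head (κ i) ∷ α₁ i root ∷ α₂ i root ∷ [] ≡ κ i
          root≡ i = trans (cong₂ (λ x y → Vec.head (κ i) ∷ x ∷ y ∷ []) (r₁ i) (r₂ i)) (η₃ (κ i))
      in α , root≡ ,
         (λ { i root    → subst (_∈ P i root) (sym (root≡ i)) (κ∈ i)
            ; i (inˡ t) → subst (λ c → (α₁ i t ∷ c) ∈ P i (inˡ t)) (Vec.map-∘ (α i) inˡ (children t)) (p₁ i t)
            ; i (inʳ t) → subst (λ c → (α₂ i t ∷ c) ∈ P i (inʳ t)) (Vec.map-∘ (α i) inʳ (children t)) (p₂ i t) }) ,
         sym (+-identityʳ _) })
    (λ { s (α , α≡ , p , refl) → _ , _ ,
         ((λ i → α i ∘ inˡ) , (λ i → cong second (α≡ i)) ,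
           (λ i t → subst (λ c → (α i (inˡ t) ∷ c) ∈ P i (inˡ t)) (sym (Vec.map-∘ (α i) inˡ (children t))) (p i (inˡ t))) , refl) ,
         ((λ i → α i ∘ inʳ) , (λ i → cong third (α≡ i)) ,
           (λ i t → subst (λ c → (α i (inʳ t) ∷ c) ∈ P i (inʳ t)) (sym (Vec.map-∘ (α i) inʳ (children t))) (p i (inʳ t))) , refl) ,
         sym (+-identityʳ _) })
    (combine-best 0 b₁ b₂)

  joinRecolor : ∀ {D : CW ω} {a b} → BitString → (Node D → BitString) → Node (recolor D a b) → BitString
  joinRecolor w α root          = w
  joinRecolor w α (inRecolor t) = α t

  joinAdd : ∀ {D : CW ω} {a b} → BitString → (Node D → BitString) → Node (addEdges D a b) → BitString
  joinAdd w α root      = w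
  joinAdd w α (inAdd t) = α t

  -- The 1 is the content of cell 0, read in place of a second child; it turns the binary formula
  -- into the unary one.
  via-recolor : ∀ {D a b} {P : Family (recolor D a b)} {v₁} κ → (∀ i → κ i ∈ P i root) →
    IsBest v₁ (Reach (λ i → P i ∘ inRecolor) (second ∘ κ)) → IsBest (combine v₁ 1 0) (Via P κ)
  via-recolor {D} {P = P} κ κ∈ b₁ = IsBest-map
    (λ { s (s₁ , _ , (α₁ , r₁ , p₁ , refl) , refl , refl) →
      let α = λ i → joinRecolor (Vec.head (κ i)) (α₁ i)
          root≡ : ∀ i → Vec.head (κ i) ∷ α₁ i root ∷ [] ≡ κ i
          root≡ i = trans (cong (λ x → Vec.head (κ i) ∷ x ∷ []) (r₁ i)) (η₂ (κ i))
      in α , root≡ ,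
         (λ { i root          → subst (_∈ P i root) (sym (root≡ i)) (κ∈ i)
            ; i (inRecolor t) → subst (λ c → (α₁ i t ∷ c) ∈ P i (inRecolor t)) (Vec.map-∘ (α i) inRecolor (children t)) (p₁ i t) }) ,
         sym (trans (+-identityʳ _) (+-identityʳ _)) })
    (λ { s (α , α≡ , p , refl) → _ , 0 ,
         ((λ i → α i ∘ inRecolor) , (λ i → cong second (α≡ i)) ,
           (λ i t → subst (λ c → (α i (inRecolor t) ∷ c) ∈ P i (inRecolor t)) (sym (Vec.map-∘ (α i) inRecolor (children t))) (p i (inRecolor t))) , refl) ,
         refl , sym (trans (+-identityʳ _) (+-identityʳ _)) })
    (combine-best 0 b₁ IsBest-zero)

  via-add : ∀ {D a b} {P : Family (addEdges D a b)} {v₁} κ → (∀ i → κ i ∈ P i root) →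
    IsBest v₁ (Reach (λ i → P i ∘ inAdd) (second ∘ κ)) → IsBest (combine v₁ 1 0) (Via P κ)
  via-add {D} {P = P} κ κ∈ b₁ = IsBest-map
    (λ { s (s₁ , _ , (α₁ , r₁ , p₁ , refl) , refl , refl) →
      let α = λ i → joinAdd (Vec.head (κ i)) (α₁ i)
          root≡ : ∀ i → Vec.head (κ i) ∷ α₁ i root ∷ [] ≡ κ i
          root≡ i = trans (cong (λ x → Vec.head (κ i) ∷ x ∷ []) (r₁ i)) (η₂ (κ i))
      in α , root≡ ,
         (λ { i root      → subst (_∈ P i root) (sym (root≡ i)) (κ∈ i)
            ; i (inAdd t) → subst (λ c → (α₁ i t ∷ c) ∈ P i (inAdd t)) (Vec.map-∘ (α i) inAdd (children t)) (p₁ i t) }) ,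
         sym (trans (+-identityʳ _) (+-identityʳ _)) })
    (λ { s (α , α≡ , p , refl) → _ , 0 ,
         ((λ i → α i ∘ inAdd) , (λ i → cong second (α≡ i)) ,
           (λ i t → subst (λ c → (α i (inAdd t) ∷ c) ∈ P i (inAdd t)) (sym (Vec.map-∘ (α i) inAdd (children t))) (p i (inAdd t))) , refl) ,
         refl , sym (trans (+-identityʳ _) (+-identityʳ _)) })
    (combine-best 0 b₁ IsBest-zero)

  -- Written for both unary operations, whose nodes have different constructors; the last premise
  -- receives the step from the child to the root.
  build-unary : ∀ {D D′ : CW ω} {k P E tb} {P₁ : Family D} {E₁} → Spec {D} k P₁ E₁ → Tree D k P₁ E₁ tb →
    ∣V D′ ∣ ≡ suc ∣V D ∣ → k + ∣V D′ ∣ ≤ n → tb 0 ≡ 1 → Vacant k (k + ∣V D′ ∣) tb →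
    map E (postorder D′) ≡ map E₁ (postorder D) ++ [ E root ] →
    (∀ tb₁ {e} κ → (∀ i → κ i ∈ P i root) → IsEntry (k + ∣V D′ ∣) (childNums k root) κ e → tb₁ 0 ≡ 1 →
       (∀ ws → (∀ i → Legal (ws i)) → IsBest (tb₁ (A (k + ∣V D ∣) ws)) (Reach P₁ ws)) → IsBest (value F tb₁ e) (Via P κ)) →
    Tree D′ k P E tb
  build-unary {D} {D′} {k} {tb = tb} {E₁ = E₁} S₁ T size≡ le tb0 vac split values = tree (map E₁ (postorder D)) split
    (λ x o → kept x (λ j ws lg k<j j≤ → o j ws lg k<j (≤-trans j≤ (<⇒≤ k₁<))))
    (λ ws lg → trans (kept _ (outside-A lg k₁≤n le (inj₂ k₁<))) (vac _ ws lg (m<m+n k (∣V∣>0 D′)) ≤-refl))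
    (λ κ κ∈ is → values (relaxNodes F (map E₁ (postorder D)) tb) κ κ∈ is (trans (kept 0 outside-0) tb0) optimal)
    where
    k₁< : k + ∣V D ∣ < k + ∣V D′ ∣
    k₁< = +-monoʳ-< k (≤-reflexive (sym size≡))
    k₁≤n : k + ∣V D ∣ ≤ n
    k₁≤n = ≤-trans (<⇒≤ k₁<) le
    open Solved (solve S₁ k₁≤n T)

  -- The induction works because a subtree changes its own cells only: cell 0 keeps its 1, the right
  -- subtree finds its cells vacant, and the results of the left one survive.
  build : ∀ (D : CW ω) {k P E tb} → Spec {D} k P E → k + ∣V D ∣ ≤ n → tb 0 ≡ 1 → Vacant k (k + ∣V D ∣) tb → Tree D k P E tb
  build (intro v a) {k} {P} {E} {tb} S le tb0 vac = tree [] refl (λ _ _ → refl)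
    (λ ws lg → vac (k + 1) ws lg (m<m+n k (s≤s z≤n)) ≤-refl)
    -- Both children are missing and read the 1 in cell 0, and `combine 1 1 w` is `suc w`.
    (λ {e} κ κ∈ is → subst (λ x → IsBest x (Via P κ))
      (sym (trans (entry-value tb is) (cong (λ x → combine x x (weight (Vec.head ∘ κ))) tb0))) (via-leaf κ κ∈))
  build (D₁ ⊕ D₂) {k} {P} {E} {tb} S le tb0 vac = tree (map (E ∘ inˡ) (postorder D₁) ++ map (E ∘ inʳ) (postorder D₂))
    (trans (map-++ E (map inˡ (postorder D₁)) _) (trans (cong₂ _++_ (sym (map-∘ (postorder D₁)))
      (trans (map-++ E (map inʳ (postorder D₂)) _) (cong (_++ [ E root ]) (sym (map-∘ (postorder D₂))))))
      (sym (++-assoc (map (E ∘ inˡ) (postorder D₁)) _ _))))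
    (λ x o → trans (cong (λ h → h x) tb₂≡) (trans (S₂.kept x (narrowʳ o)) (S₁.kept x (narrowˡ o))))
    (λ ws lg → trans (cong (λ h → h (A (k + ∣V D₁ ⊕ D₂ ∣) ws)) tb₂≡)
      (trans (S₂.kept _ (outside-A lg k₂≤n le (inj₂ k₂<)))
        (trans (S₁.kept _ (outside-A lg k₁≤n le (inj₂ (≤-<-trans (m≤m+n _ _) k₂<))))
          (vac _ ws lg (m<m+n k (∣V∣>0 (D₁ ⊕ D₂))) ≤-refl))))
    (λ {e} κ κ∈ is → subst (λ x → IsBest x (Via P κ))
      (sym (trans (entry-value (relaxNodes F (map (E ∘ inˡ) (postorder D₁) ++ map (E ∘ inʳ) (postorder D₂)) tb) is) (cong (λ h → combine (h (A k₁ (second ∘ κ)))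
                                              (h (A k₂ (third ∘ κ))) 0) tb₂≡)))
      (via-⊕ {P = P} κ κ∈
        (subst (λ x → IsBest x (Reach (λ i → P i ∘ inˡ) (second ∘ κ)))
          -- The right subtree leaves the cells of the left root unchanged.
          (sym (S₂.kept _ (outside-A (λ i → lg₁ κ κ∈ i) k₂≤n k₁≤n (inj₁ ≤-refl))))
          (S₁.optimal _ (lg₁ κ κ∈)))
        (S₂.optimal _ (lg₂ κ κ∈))))
    where
    k₁ k₂ : ℕ
    k₁ = k + ∣V D₁ ∣
    k₂ = k₁ + ∣V D₂ ∣
    size≡ : suc k₂ ≡ k + ∣V D₁ ⊕ D₂ ∣
    size≡ = trans (trans (cong suc (+-assoc k _ _)) (sym (+-suc k _))) (cong (k +_) (sym (∣⊕∣ D₁ D₂)))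
    k₂< : k₂ < k + ∣V D₁ ⊕ D₂ ∣
    k₂< = ≤-reflexive size≡
    k₂≤n : k₂ ≤ n
    k₂≤n = ≤-trans (<⇒≤ k₂<) le
    k₁≤n : k₁ ≤ n
    k₁≤n = ≤-trans (m≤m+n k₁ _) k₂≤n
    tb₁ : ℕ → ℕ
    tb₁ = relaxNodes F (map (E ∘ inˡ) (postorder D₁)) tb
    tb₂≡ : relaxNodes F (map (E ∘ inˡ) (postorder D₁) ++ map (E ∘ inʳ) (postorder D₂)) tb
           ≡ relaxNodes F (map (E ∘ inʳ) (postorder D₂)) tb₁
    tb₂≡ = relaxNodes-++ F (map (E ∘ inˡ) (postorder D₁)) tb
    T₁ : Tree D₁ k (λ i → P i ∘ inˡ) (E ∘ inˡ) tb
    T₁ = build D₁ (Spec-inˡ S) k₁≤n tb0 (λ j ws lg k<j j≤ → vac j ws lg k<j (≤-trans j≤ (≤-trans (m≤m+n k₁ _) (<⇒≤ k₂<))))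
    module S₁ = Solved (solve (Spec-inˡ S) k₁≤n T₁)
    T₂ : Tree D₂ k₁ (λ i → P i ∘ inʳ) (E ∘ inʳ) tb₁
    T₂ = build D₂ (Spec-inʳ S) k₂≤n (trans (S₁.kept 0 outside-0) tb0)
      (λ j ws lg k₁<j j≤ → trans (S₁.kept _ (outside-A lg k₁≤n (≤-trans j≤ k₂≤n) (inj₂ k₁<j)))
        (vac j ws lg (≤-<-trans (m≤m+n k _) k₁<j) (≤-trans j≤ (<⇒≤ k₂<))))
    module S₂ = Solved (solve (Spec-inʳ S) k₂≤n T₂)
    narrowˡ : ∀ {x} → Outside k (k + ∣V D₁ ⊕ D₂ ∣) x → Outside k k₁ x
    narrowˡ o j ws lg k<j j≤ = o j ws lg k<j (≤-trans j≤ (≤-trans (m≤m+n k₁ _) (<⇒≤ k₂<)))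
    narrowʳ : ∀ {x} → Outside k (k + ∣V D₁ ⊕ D₂ ∣) x → Outside k₁ k₂ x
    narrowʳ o j ws lg k₁<j j≤ = o j ws lg (≤-<-trans (m≤m+n k _) k₁<j) (≤-trans j≤ (<⇒≤ k₂<))
    lg₁ : ∀ (κ : Fin r → Vec BitString 3) → (∀ i → κ i ∈ P i root) → ∀ i → Legal (second (κ i))
    lg₁ κ κ∈ i = tailLegal S le root κ κ∈ i (head-∈ (Vec.tail (κ i)))
    lg₂ : ∀ (κ : Fin r → Vec BitString 3) → (∀ i → κ i ∈ P i root) → ∀ i → Legal (third (κ i))
    lg₂ κ κ∈ i = tailLegal S le root κ κ∈ i (tail-∈ (Vec.tail (κ i)) (head-∈ (Vec.tail (Vec.tail (κ i)))))
  build (recolor D a b) {k} {P} {E} {tb} S le tb0 vac = build-unary (Spec-inRecolor S)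
    (build D (Spec-inRecolor S) (≤-trans k≤ le) tb0 (λ j ws lg k<j j≤ → vac j ws lg k<j (≤-trans j≤ k≤)))
    (∣recolor∣ D a b) le tb0 vac
    (trans (map-++ E (map inRecolor (postorder D)) _) (cong (_++ [ E root ]) (sym (map-∘ (postorder D)))))
    (λ tb₁ κ κ∈ is tb₁0 best₁ → subst (λ x → IsBest x (Via P κ))
      (sym (trans (entry-value tb₁ is) (cong (λ y → combine (tb₁ (A (k + ∣V D ∣) (second ∘ κ))) y 0) tb₁0)))
      (via-recolor {P = P} κ κ∈ (best₁ _ (λ i → tailLegal S le root κ κ∈ i (head-∈ (Vec.tail (κ i)))))))
    where
    k≤ : k + ∣V D ∣ ≤ k + ∣V recolor D a b ∣
    k≤ = +-monoʳ-≤ k (≤-trans (n≤1+n _) (≤-reflexive (sym (∣recolor∣ D a b))))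
  build (addEdges D a b) {k} {P} {E} {tb} S le tb0 vac = build-unary (Spec-inAdd S)
    (build D (Spec-inAdd S) (≤-trans k≤ le) tb0 (λ j ws lg k<j j≤ → vac j ws lg k<j (≤-trans j≤ k≤)))
    (∣addEdges∣ D a b) le tb0 vac
    (trans (map-++ E (map inAdd (postorder D)) _) (cong (_++ [ E root ]) (sym (map-∘ (postorder D)))))
    (λ tb₁ κ κ∈ is tb₁0 best₁ → subst (λ x → IsBest x (Via P κ))
      (sym (trans (entry-value tb₁ is) (cong (λ y → combine (tb₁ (A (k + ∣V D ∣) (second ∘ κ))) y 0) tb₁0)))
      (via-add {P = P} κ κ∈ (best₁ _ (λ i → tailLegal S le root κ κ∈ i (head-∈ (Vec.tail (κ i)))))))
    where
    k≤ : k + ∣V D ∣ ≤ k + ∣V addEdges D a b ∣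
    k≤ = +-monoʳ-≤ k (≤-trans (n≤1+n _) (≤-reflexive (sym (∣addEdges∣ D a b))))

  -- At the root the maximum runs over the entries without rejected states instead of those of one
  -- cell; `Good` expresses acceptance by the single cores.
  finalBest-best : ∀ {D k P E tb} (S : Spec {D} k P E) → k + ∣V D ∣ ≤ n → tb 0 ≡ 1 → Vacant k (k + ∣V D ∣) tb →
    (Good : BitString → Fin r → Set) →
    (∀ {e} → e ∈ E root → rejects e ≡ 0 → Σ[ κ ∈ (Fin r → Vec BitString (suc (arity D))) ] (∀ i → κ i ∈ P i root) × (∀ i → Good (Vec.head (κ i)) i) ×
       IsEntry (k + ∣V D ∣) (childNums k root) κ e) →
    (∀ (κ : Fin r → Vec BitString (suc (arity D))) → (∀ i → κ i ∈ P i root) → (∀ i → Good (Vec.head (κ i)) i) →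
       ∃[ e ] e ∈ E root × rejects e ≡ 0 × IsEntry (k + ∣V D ∣) (childNums k root) κ e) →
    ∀ {b} → IsBest (finalBest F (map E (postorder D)) tb b)
              (λ s → ∃[ α ] Processed P α × (∀ i → Good (α i root) i) × leafWeight D α ≡ s)
  finalBest-best {D} {k} {P} {E} {tb} S le tb0 vac Good to from {b} =
    subst (λ v → IsBest v _) (sym (trans (cong (λ es → finalBest F es tb b) T.split) (finalBest-∷ʳ F T.prefix (E root) tb b)))
      (upper , lower)
    where
    module T = Tree (build D {tb = tb} S le tb0 vac)
    tb₂ : ℕ → ℕ
    tb₂ = relaxNodes F T.prefix tb
    R : ℕ → Set
    R s = ∃[ α ] Processed P α × (∀ i → Good (α i root) i) × leafWeight D α ≡ s
    upper : ∀ s → R s → s < bestOf F (E root) tb₂ 0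
    upper s (α , pr , gd , sum≡) with from _ (λ i → pr i root) gd
    ... | e , e∈ , acc , is = <-≤-trans (proj₁ (T.values _ (λ i → pr i root) is) s (α , (λ _ → refl) , pr , sum≡))
            (bestOf-value F (E root) (separated S le) e∈ acc)
    lower : bestOf F (E root) tb₂ 0 ≡ 0 ⊎ ∃[ s ] bestOf F (E root) tb₂ 0 ≡ suc s × R s
    lower with bestOf-cases F (E root) {tb₂} {0} (separated S le)
    ... | inj₁ z = inj₁ z
    ... | inj₂ (e , e∈ , acc , eq) with to e∈ acc
    ...   | κ , κ∈ , gd , is with T.values κ κ∈ is
    ...     | _ , inj₁ z = inj₁ (trans eq z)
    ...     | _ , inj₂ (s , eq′ , α , α≡ , pr , sum≡) =
                inj₂ (s , trans eq eq′ , α , pr , (λ i → subst (λ v → Good (Vec.head v) i) (sym (α≡ i)) (gd i)) , sum≡)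

-- Vertices and leaves

leaves : ∀ {ω} (D : CW ω) → List (Node D)
leaves (intro _ _)      = [ root ]
leaves (D₁ ⊕ D₂)        = map inˡ (leaves D₁) ++ map inʳ (leaves D₂)
leaves (recolor D _ _)  = map inRecolor (leaves D)
leaves (addEdges D _ _) = map inAdd (leaves D)

leafTotal-sum : ∀ {ω} (D : CW ω) h → sum (map h (leaves D)) ≡ leafTotal D h
leafTotal-sum (intro _ _)      h = +-identityʳ _
leafTotal-sum (D₁ ⊕ D₂)        h = trans (cong sum (map-++ h (map inˡ (leaves D₁)) _)) (trans (sum-++ (map h (map inˡ (leaves D₁))) _)
  (cong₂ _+_ (trans (cong sum (sym (map-∘ (leaves D₁)))) (leafTotal-sum D₁ (h ∘ inˡ)))
             (trans (cong sum (sym (map-∘ (leaves D₂)))) (leafTotal-sum D₂ (h ∘ inʳ)))))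
leafTotal-sum (recolor D _ _)  h = trans (cong sum (sym (map-∘ (leaves D)))) (leafTotal-sum D (h ∘ inRecolor))
leafTotal-sum (addEdges D _ _) h = trans (cong sum (sym (map-∘ (leaves D)))) (leafTotal-sum D (h ∘ inAdd))

-- A left inverse of `leaf`, which shows that different vertices have different leaves; 0 is a
-- default at inner nodes.
nameOf : ∀ {ω} {D : CW ω} → Node D → ℕ
nameOf {D = intro v _}      root = v
nameOf {D = _ ⊕ _}          root = 0
nameOf {D = recolor _ _ _}  root = 0
nameOf {D = addEdges _ _ _} root = 0
nameOf (inˡ t)       = nameOf t
nameOf (inʳ t)       = nameOf t
nameOf (inRecolor t) = nameOf t
nameOf (inAdd t)     = nameOf t

nameOf-leaf : ∀ {ω} (D : CW ω) {x} (p : Vertex D x) → nameOf (leaf D p) ≡ x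
nameOf-leaf (intro _ _)      p        = sym p
nameOf-leaf (D₁ ⊕ D₂)        (inj₁ p) = nameOf-leaf D₁ p
nameOf-leaf (D₁ ⊕ D₂)        (inj₂ p) = nameOf-leaf D₂ p
nameOf-leaf (recolor D _ _)  p        = nameOf-leaf D p
nameOf-leaf (addEdges D _ _) p        = nameOf-leaf D p

leaf-∈ : ∀ {ω} (D : CW ω) {x} (p : Vertex D x) → leaf D p ∈ leaves D
leaf-∈ (intro _ _)      p        = here refl
leaf-∈ (D₁ ⊕ D₂)        (inj₁ p) = ∈-++⁺ˡ (∈-map⁺ inˡ (leaf-∈ D₁ p))
leaf-∈ (D₁ ⊕ D₂)        (inj₂ p) = ∈-++⁺ʳ (map inˡ (leaves D₁)) (∈-map⁺ inʳ (leaf-∈ D₂ p))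
leaf-∈ (recolor D _ _)  p        = ∈-map⁺ inRecolor (leaf-∈ D p)
leaf-∈ (addEdges D _ _) p        = ∈-map⁺ inAdd (leaf-∈ D p)

∈-leaves : ∀ {ω} (D : CW ω) {t} → t ∈ leaves D → ∃[ x ] Σ[ p ∈ Vertex D x ] leaf D p ≡ t
∈-leaves (intro v _) (here refl) = v , refl , refl
∈-leaves (D₁ ⊕ D₂) t∈ with ∈-++⁻ (map inˡ (leaves D₁)) t∈
... | inj₁ t∈₁ with ∈-map⁻ inˡ t∈₁
...   | t , t∈′ , refl with ∈-leaves D₁ t∈′
...     | x , p , refl = x , inj₁ p , refl
∈-leaves (D₁ ⊕ D₂) t∈ | inj₂ t∈₂ with ∈-map⁻ inʳ t∈₂
...   | t , t∈′ , refl with ∈-leaves D₂ t∈′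
...     | x , p , refl = x , inj₂ p , refl
∈-leaves (recolor D _ _) t∈ with ∈-map⁻ inRecolor t∈
... | t , t∈′ , refl with ∈-leaves D t∈′
...   | x , p , refl = x , p , refl
∈-leaves (addEdges D _ _) t∈ with ∈-map⁻ inAdd t∈
... | t , t∈′ , refl with ∈-leaves D t∈′
...   | x , p , refl = x , p , refl

-- A proof of `Vertex D x` is a path to a leaf. Two paths to the same vertex cannot part at a union,
-- since its sides are disjoint.
leaf-unique : ∀ {ω} (D : CW ω) → WellFormed D → ∀ {x} (p q : Vertex D x) → leaf D p ≡ leaf D q
leaf-unique (intro _ _)      _             p        q        = refl
leaf-unique (D₁ ⊕ D₂)        (w₁ , _ , _)  (inj₁ p) (inj₁ q) = cong inˡ (leaf-unique D₁ w₁ p q)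
leaf-unique (D₁ ⊕ D₂)        (_ , _ , dis) (inj₁ p) (inj₂ q) = contradiction q (dis _ p)
leaf-unique (D₁ ⊕ D₂)        (_ , _ , dis) (inj₂ p) (inj₁ q) = contradiction p (dis _ q)
leaf-unique (D₁ ⊕ D₂)        (_ , w₂ , _)  (inj₂ p) (inj₂ q) = cong inʳ (leaf-unique D₂ w₂ p q)
leaf-unique (recolor D _ _)  w             p        q        = cong inRecolor (leaf-unique D w p q)
leaf-unique (addEdges D _ _) w             p        q        = cong inAdd (leaf-unique D w p q)

leaves-unique : ∀ {ω} (D : CW ω) → Unique (leaves D)
leaves-unique (intro _ _) = [] ∷ []
leaves-unique (D₁ ⊕ D₂)   = Unique.++⁺ (Unique.map⁺ (λ { refl → refl }) (leaves-unique D₁)) (Unique.map⁺ (λ { refl → refl }) (leaves-unique D₂))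
  λ { (p , q) → case (∈-map⁻ inˡ p , ∈-map⁻ inʳ q) of λ { ((_ , _ , refl) , (_ , _ , ())) } }
leaves-unique (recolor D _ _)  = Unique.map⁺ (λ { refl → refl }) (leaves-unique D)
leaves-unique (addEdges D _ _) = Unique.map⁺ (λ { refl → refl }) (leaves-unique D)

module _ {ω} {D : CW ω} {G : Graph} (iso : D DecompositionOf G) where

  open _DecompositionOf_ iso

  leafOf-injective : ∀ {u v} → leafOf iso u ≡ leafOf iso v → u ≡ v
  leafOf-injective {u} {v} eq = injective (trans (sym (nameOf-leaf D (introduced u)))
    (trans (cong nameOf eq) (nameOf-leaf D (introduced v))))

  -- Duplicate-free lists with the same elements are permutations of each other. This turns a sum
  -- over the vertices of the graph into a sum over the leaves of the tree.
  leaves-↭ : tabulate (leafOf iso) ↭ leaves D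
  leaves-↭ = ∼bag⇒↭ (unique∧set⇒bag (Unique.tabulate⁺ leafOf-injective) (leaves-unique D)
    (mk⇔ (λ t∈ → case ∈-tabulate⁻ t∈ of λ { (v , refl) → leaf-∈ D (introduced v) }) (λ t∈ → back (∈-leaves D t∈))))
    where
    back : ∀ {t} → ∃[ x ] Σ[ p ∈ Vertex D x ] leaf D p ≡ t → t ∈ tabulate (leafOf iso)
    back (x , p , refl) with surjective x p
    ... | v , refl = subst (_∈ tabulate (leafOf iso)) (leaf-unique D wellFormed (introduced v) p) (∈-tabulate⁺ v)

  vertex-sum : ∀ h → sum (tabulate (h ∘ leafOf iso)) ≡ leafTotal D h
  vertex-sum h = trans (cong sum (sym (map-tabulate (leafOf iso) h)))
    (trans (sum-↭ (↭.map⁺ h leaves-↭)) (leafTotal-sum D h))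

-- Bounds by running times and sizes

output-length : ∀ {p σ t σ′} → ⟨ p , σ ⟩⇓[ t ] σ′ → length (output σ′) ≤ length (output σ) + t
output-length ⇓skip   = m≤m+n _ 1
output-length ⇓const  = m≤m+n _ 1
output-length ⇓add    = m≤m+n _ 1
output-length ⇓sub    = m≤m+n _ 1
output-length ⇓load   = m≤m+n _ 1
output-length ⇓store  = m≤m+n _ 1
output-length ⇓read[] = m≤m+n _ 1
output-length ⇓read∷  = m≤m+n _ 1
output-length (⇓write {σ}) = ≤-reflexive (length-++ (output σ))
output-length (⇓⨾ {σ = σ} {s = s} {t} e f) = ≤-trans (output-length f)
  (≤-trans (+-monoˡ-≤ t (output-length e)) (≤-reflexive (+-assoc (length (output σ)) s t)))
output-length (⇓if≢0 {σ = σ} _ e) = ≤-trans (output-length e) (+-monoʳ-≤ (length (output σ)) (n≤1+n _))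
output-length (⇓if≡0 {σ = σ} _ e) = ≤-trans (output-length e) (+-monoʳ-≤ (length (output σ)) (n≤1+n _))
output-length (⇓while≢0 {σ = σ} {s = s} {t} _ e f) = ≤-trans (output-length f)
  (≤-trans (+-monoˡ-≤ t (output-length e)) (≤-trans (≤-reflexive (+-assoc (length (output σ)) s t))
    (+-monoʳ-≤ (length (output σ)) (n≤1+n _))))
output-length (⇓while≡0 _) = m≤m+n _ 1

≤-sum : ∀ {r} (x : Fin r → ℕ) i → x i ≤ sum (tabulate x)
≤-sum x zero    = m≤m+n _ _
≤-sum x (suc i) = ≤-trans (≤-sum (x ∘ suc) i) (m≤n+m _ _)

product-mono : ∀ {r} {x y : Fin r → ℕ} → (∀ i → x i ≤ y i) → product (tabulate x) ≤ product (tabulate y)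
product-mono {zero}  le = ≤-refl
product-mono {suc r} le = *-mono-≤ (le zero) (product-mono (le ∘ suc))

length-≤-Size : ∀ (C : Core) {ω} (D : CW ω) t → length (Process C D t) ≤ Size C D
length-≤-Size C D t = All.lookup (xs≤max 0 (map (λ t → length (Process C D t)) (postorder D))) (∈-map⁺ (λ t → length (Process C D t)) (∈-postorder t))

-- The verdict and the assembly of the decision procedure

exceeds-bit : ∀ b d → exceeds b d ≡ bit (d <ᵇ b)
exceeds-bit zero    zero    = refl
exceeds-bit (suc b) zero    = refl
exceeds-bit zero    (suc d) = refl
exceeds-bit (suc b) (suc d) = exceeds-bit b d

guarded : ∀ {r} → (Vec Bool r → ℕ) → Vec Bool (suc r) → ℕ
guarded f (false ∷ v) = f v
guarded f (true ∷ v)  = 0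

module Main (r : ℕ) (C : Fin r → Core) (ρ : Fin r → BitString → Bool)
  (q : Fin r → Program) (K : Fin r → ℕ) (ev : ∀ i → Evaluates (ρ i) (q i) (K i))
  (f : Vec Bool r → ℕ) (d : ℕ) {ω : ℕ} (D : CW ω) (wf : WellFormed D) where

  open Decision D r
  module Gen = Generations (δ {D = D}) (λ a → δ≤2 (subtree a)) nodes
  module Sc = Scan (δ {D = D}) (λ a → δ≤2 (subtree a)) nodes

  acc : Fin r → List BitString
  acc i = Accept (C i) D

  proc : Fin r → Transitions
  proc i = Process (C i) D

  X B : ℕ
  X = timeBound C D
  B = product (tabulate λ i → Size (C i) D)

  L : ℕ
  L = length (outputs acc proc)

  computes : ∀ i → Computes (Core.program (C i)) (encodeCW D) (coreStream (acc i) (proc i)) (τ (C i) D)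
  computes i = Core.computes (C i) D wf

  -- A step writes at most one number, so the running time of a core pays for everything that is
  -- later parsed from its output.
  stream≤τ : ∀ i → length (coreStream (acc i) (proc i)) ≤ τ (C i) D
  stream≤τ i with computes i
  ... | _ , e , eq = subst (λ ys → length ys ≤ τ (C i) D) eq (output-length e)

  streams≤ : ∀ r (acc : Fin r → List BitString) (proc : Fin r → Transitions) {x : Fin r → ℕ} →
             (∀ i → length (coreStream (acc i) (proc i)) ≤ x i) → length (streams r acc proc) ≤ sum (tabulate x)
  streams≤ zero    acc proc le = z≤n
  streams≤ (suc r) acc proc le = ≤-trans (≤-reflexive (length-++ (coreStream (acc zero) (proc zero))))
    (+-mono-≤ (le zero) (streams≤ r (acc ∘ suc) (proc ∘ suc) (le ∘ suc)))

  outs≤X : L ≤ X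
  outs≤X = ≤-trans (streams≤ r acc proc stream≤τ) (m≤m+n _ _)

  τ≤X : ∀ i → τ (C i) D ≤ X
  τ≤X i = ≤-trans (≤-sum (λ i → τ (C i) D) i) (m≤m+n _ _)

  nB≤X : ∣V D ∣ * B ≤ X
  nB≤X = m≤n+m _ _

  blocks-length : ∀ (proc : Transitions) as → length as ≤ length (concatMap (encodeTuples ∘ proc) as)
  blocks-length proc []       = z≤n
  blocks-length proc (a ∷ as) = ≤-trans (+-mono-≤ (≤-trans (m≤n+m 1 _) (≤-reflexive (sym (length-++ (concatMap encodeTuple (proc a))))))
    (blocks-length proc as)) (≤-reflexive (sym (length-++ (encodeTuples (proc a)))))

  -- The product of the sizes may be 0, so it cannot give this bound. But every node adds at least
  -- the terminator 3 to the output of the first core; without cores the empty product is 1.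
  n≤X : ∣V D ∣ ≤ X
  n≤X = bound r C stream≤τ
    where
    bound : ∀ r (C : Fin r → Core) → (∀ i → length (coreStream (Accept (C i) D) (Process (C i) D)) ≤ τ (C i) D) →
            ∣V D ∣ ≤ timeBound C D
    bound zero    C le = ≤-reflexive (sym (*-identityʳ _))
    bound (suc r) C le = ≤-trans (blocks-length (Process (C zero) D) nodes)
      (≤-trans (≤-trans (m≤n+m _ (length (encodeTuples (map Vec.[_] (Accept (C zero) D))))) (≤-reflexive (sym (length-++ (encodeTuples (map Vec.[_] (Accept (C zero) D)))))))
        (≤-trans (le zero) (≤-trans (≤-sum (λ i → τ (C i) D) zero) (m≤m+n _ _))))

  1≤X : 1 ≤ X
  1≤X = ≤-trans (∣V∣>0 D) n≤X

  weight : (Fin r → BitString) → ℕ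
  weight ws = f (Vec.tabulate λ i → ρ i (ws i))

  entries : Node D → List Entry
  entries = generations r ρ acc proc 2 (suc ∣V D ∣) L (λ a → [ starting 0 a ])

  totalOf : ∀ (t : Node D) → (Fin r → Vec BitString (suc (δ t))) → Entry
  totalOf t = total r ρ acc 2 (suc ∣V D ∣) L (starting 0 t)

  module _ {F : ℕ → ℕ} (F≡ : ∀ v → F (index v) ≡ guarded f v) where

    A : ℕ → (Fin r → BitString) → ℕ
    A = address r (suc ∣V D ∣) L

    Legal : BitString → Set
    Legal w = binary w < 2 ^ L

    A-injective : ∀ {k k′ ws ws′} → (∀ i → Legal (ws i)) → (∀ i → Legal (ws′ i)) → k ≤ ∣V D ∣ → k′ ≤ ∣V D ∣ →
                  A k ws ≡ A k′ ws′ → k ≡ k′ × (∀ i → ws i ≡ ws′ i)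
    A-injective lg lg′ k≤ k′≤ = address-injective r lg lg′ (s≤s k≤) (s≤s k′≤)

    A-positive : ∀ k ws → 1 ≤ k → A k ws ≢ 0
    A-positive (suc k) ws _ ()

    A-cong : ∀ k ws ws′ → (∀ i → ws i ≡ ws′ i) → A k ws ≡ A k ws′
    A-cong k _ _ eq = cong (k +_) (place-cong r λ i u → cong (codeOf u) (eq i))

    weight-cong : ∀ {ws ws′} → (∀ i → ws i ≡ ws′ i) → weight ws ≡ weight ws′
    weight-cong eq = cong f (Vec.tabulate-cong λ i → cong (ρ i) (eq i))

    open Table A ∣V D ∣ Legal A-injective A-positive A-cong weight weight-cong F {ω} public

    -- For a missing child every core contributes 0, so the sum is the reserved address 0.
    child₁-place : ∀ {m} (kids : Vec ℕ m) (κ : Fin r → Vec BitString m) →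
      kid₁ kids + place r (suc ∣V D ∣) L (λ i u → child₁ u (κ i)) ≡ kidAddr₁ kids κ
    child₁-place []       κ = trans (place-cong r (λ i u → none u (κ i))) (place-zero r {suc ∣V D ∣} {L})
      where
      none : ∀ u (v : Vec BitString 0) → child₁ u v ≡ 0
      none u [] = refl
    child₁-place (k ∷ _)  κ = cong (k +_) (place-cong r (λ i u → some u (κ i)))
      where
      some : ∀ {m} u (v : Vec BitString (suc m)) → child₁ u v ≡ codeOf u (Vec.head v)
      some u (_ ∷ _) = refl

    child₂-place : ∀ {m} (kids : Vec ℕ m) (κ : Fin r → Vec BitString m) →
      kid₂ kids + place r (suc ∣V D ∣) L (λ i u → child₂ u (κ i)) ≡ kidAddr₂ kids κ
    child₂-place []       κ = trans (place-cong r (λ i u → none u (κ i))) (place-zero r {suc ∣V D ∣} {L})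
      where
      none : ∀ u (v : Vec BitString 0) → child₂ u v ≡ 0
      none u [] = refl
    child₂-place (_ ∷ ks) κ = trans (cong (kid₁ ks +_) (place-cong r (λ i u → some u (κ i)))) (child₁-place ks (Vec.tail ∘ κ))
      where
      some : ∀ {m} u (v : Vec BitString (suc m)) → child₂ u v ≡ child₁ u (Vec.tail v)
      some u (_ ∷ _) = refl

    bonus : ∀ m ws → F (nonleaf m + 2 * index (Vec.tabulate λ i → ρ i (ws i))) ≡ leafBonus m ws
    bonus zero    ws = F≡ (false ∷ _)
    bonus (suc m) ws = F≡ (true ∷ Vec.tabulate λ i → ρ i (ws i))

    total-entry : ∀ t κ → IsEntry (num 0 t) (childNums 0 t) κ (totalOf t κ)
    total-entry t κ = isEntry
      (total-addr r (starting 0 t) κ)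
      (trans (total-addr₁ r (starting 0 t) κ) (child₁-place (childNums 0 t) (Vec.tail ∘ κ)))
      (trans (total-addr₂ r (starting 0 t) κ) (child₂-place (childNums 0 t) (Vec.tail ∘ κ)))
      (trans (cong F (total-bits r (starting 0 t) κ)) (bonus (δ t) (Vec.head ∘ κ)))

    entries-spec : Spec {D} 0 proc entries
    entries-spec = spec
      (λ t e∈ → case Gen.generations-∈⁻ r proc e∈ of λ { (κ , _ , κ∈ , here refl , refl) → κ , κ∈ , total-entry t κ })
      (λ t κ κ∈ → _ , Gen.generations-∈⁺ r κ κ∈ (here refl) , total-entry t κ)
      (λ i t v∈ w∈ → Gen.streams-binary r acc proc i t (∈-postorder t) v∈ w∈)

    Optimum : ℕ → Set
    Optimum s = ∃[ α ] Processed proc α × (∀ i → α i root ∈ acc i) × leafWeight D α ≡ s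

    table-correct : ∀ {tb} → (∀ x → tb x ≡ 0) → IsBest (finalBest F (map entries nodes) (tb [ 0 ↦ 1 ]) 0) Optimum
    table-correct {tb} tb0 = finalBest-best entries-spec ≤-refl (update-same tb 0)
      -- Addresses of nodes are positive, so presetting cell 0 leaves all their cells vacant.
      (λ { (suc j) ws lg _ _ → trans (update-other tb {0} {A (suc j) ws} {1} (λ ())) (tb0 _) ; zero ws lg () _ })
      (λ w i → w ∈ acc i)
      (λ e∈ rej → case Gen.generations-∈⁻ r proc e∈ of λ { (κ , _ , κ∈ , here refl , refl) →
         κ , κ∈ , proj₂ (total-rejects⁻ r (starting 0 root) κ rej) , total-entry root κ })
      (λ κ κ∈ ∈acc → _ , Gen.generations-∈⁺ r κ κ∈ (here refl) , total-rejects⁺ r (starting 0 root) κ refl ∈acc , total-entry root κ)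

  -- Formulated on the decomposition alone: the correctness of the program then involves no graph,
  -- and sets of vertices enter only in the theorem.
  Solution : Set
  Solution = Σ[ w ∈ (∀ i → Witness (C i) D) ] d ≤ leafTotal D (λ t → weight (λ i → Witness.α (w i) t))

  program : Program
  program = decide r (Core.program ∘ C) q (guarded f) d

  Cost : ℕ
  Cost = (prepareCost r + searchCost r K + 3) * X

  Prefix : Set
  Prefix = Run (prepare r (Core.program ∘ C) (guarded f)) (initial (encodeCW D)) (prepareCost r * X)
             (Prepared (guarded f) (outputs acc proc))

  reject : Prefix → ∀ i → acc i ≡ [] ⊎ ∃[ a ] proc i a ≡ [] → scanned 0 0 (outputs acc proc) ≡ 1 →
           Decides program D Solution Cost
  reject (ran {σ₁} e₁ le₁ pr) i empty marked = false , _ ,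
    (_ , ⇓⨾ e₁ (⇓if≢0 (λ z → case trans (sym marked) (trans (sym (Prepared.bad≡ pr)) z) of λ ())
                 (straight-⇓ (const v 0 ⨾ write v) refl)) , cong (_∷ʳ 0) (Prepared.silent pr)) ,
    ≤-trans (+-monoˡ-≤ 3 le₁) bound ,
    mk⇔ (λ ()) (λ { (w , _) → contradiction w (impossible empty) })
    where
    impossible : acc i ≡ [] ⊎ ∃[ a ] proc i a ≡ [] → ¬ (∀ i → Witness (C i) D)
    impossible (inj₁ eq) w = case subst (Witness.α (w i) root ∈_) eq (Witness.accepted (w i)) of λ ()
    impossible (inj₂ (a , eq)) w =
      case subst ((Witness.α (w i) a ∷ Vec.map (Witness.α (w i)) (children a)) ∈_) eq (Witness.processed (w i) a) of λ ()
    bound : prepareCost r * X + 3 ≤ Cost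
    bound = begin
      prepareCost r * X + 3 * 1                          ≤⟨ +-monoʳ-≤ (prepareCost r * X) (*-monoʳ-≤ 3 1≤X) ⟩
      prepareCost r * X + 3 * X                          ≤⟨ m≤m+n _ (searchCost r K * X) ⟩
      prepareCost r * X + 3 * X + searchCost r K * X     ≡⟨ lemma (prepareCost r) (searchCost r K) X ⟩
      (prepareCost r + searchCost r K + 3) * X           ∎
      where
      open ≤-Reasoning
      lemma : ∀ P S X → P * X + 3 * X + S * X ≡ (P + S + 3) * X
      lemma = solve-∀

  verdict-correct : ∀ {b} {R : ℕ → Set} → IsBest b R → (d <ᵇ b) ≡ true → ∃[ s ] d ≤ s × R s
  verdict-correct {b} (_ , optimum) eq with <ᵇ⇒< d b (subst T (sym eq) tt) | optimum
  ... | d<b | inj₁ refl            = contradiction d<b λ ()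
  ... | d<b | inj₂ (s , refl , Rs) = s , s≤s⁻¹ d<b , Rs

  answer : Prefix → (∀ i → All (λ a → proc i a ≢ []) nodes) → scanned 0 0 (outputs acc proc) ≡ 0 →
           Decides program D Solution Cost
  answer (ran {σ₁} e₁ le₁ pr) nonempty clear = conclude (search-run {q} {ρ} {K} ev (starting 0)
      (λ S → trans (cong (λ ms → startEntries ms (stack S 0 0)) (sym (map-∘ nodes))) (Pushes.entries (startEntries-tree D S 0 0)))
      {B} {X} (λ i a → All.lookup (nonempty i) (∈-postorder a))
      (λ a → product-mono (λ i → length-≤-Size (C i) D a)) n≤X nB≤X outs≤X 1≤X d pr)
    where
    bound : prepareCost r * X + suc (searchCost r K * X) ≤ Cost
    bound = begin
      prepareCost r * X + (1 + searchCost r K * X)           ≤⟨ +-monoʳ-≤ (prepareCost r * X) (+-monoˡ-≤ _ 1≤X) ⟩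
      prepareCost r * X + (X + searchCost r K * X)           ≤⟨ m≤m+n _ (2 * X) ⟩
      prepareCost r * X + (X + searchCost r K * X) + 2 * X   ≡⟨ lemma (prepareCost r) (searchCost r K) X ⟩
      (prepareCost r + searchCost r K + 3) * X               ∎
      where
      open ≤-Reasoning
      lemma : ∀ P S X → P * X + (X + S * X) + 2 * X ≡ (P + S + 3) * X
      lemma = solve-∀
    conclude : Run (search r q d) σ₁ (searchCost r K * X) (λ σ′ → ∃[ F ] ∃[ tb ]
        (∀ v → F (index v) ≡ guarded f v) × (∀ x → tb x ≡ 0) ×
        output σ′ ≡ [ exceeds (finalBest F (map entries nodes) (tb [ 0 ↦ 1 ]) 0) d ]) →
      Decides program D Solution Cost
    conclude (ran e₂ le₂ (F , tb , F≡ , tb0 , out≡)) = (d <ᵇ b) , _ ,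
      (_ , ⇓⨾ e₁ (⇓if≡0 (trans (Prepared.bad≡ pr) clear) e₂) , trans out≡ (cong [_] (exceeds-bit b d))) ,
      ≤-trans (+-mono-≤ le₁ (s≤s le₂)) bound ,
      mk⇔ sound complete
      where
      b : ℕ
      b = finalBest F (map entries nodes) (tb [ 0 ↦ 1 ]) 0
      correct : IsBest b (Optimum {F} F≡)
      correct = table-correct {F} F≡ tb0
      sound : (d <ᵇ b) ≡ true → Solution
      sound eq = case verdict-correct correct eq of λ { (s , d≤s , α , pr , ∈acc , sum≡) →
        (λ i → record { α = α i ; processed = pr i ; accepted = ∈acc i }) , subst (d ≤_) (sym sum≡) d≤s }
      complete : Solution → (d <ᵇ b) ≡ true
      complete (w , d≤) = dec-true (d <? b) (≤-<-trans d≤ (proj₁ correct _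
        ((λ i → Witness.α (w i)) , (λ i → Witness.processed (w i)) , (λ i → Witness.accepted (w i)) , refl)))

  decides : Decides program D Solution Cost
  decides = choose (Sc.scanned-streams r acc proc)
    where
    prefix-run : Prefix
    prefix-run = prepare-run computes τ≤X n≤X outs≤X 1≤X
    choose : _ ⊎ _ → Decides program D Solution Cost
    choose (inj₁ ((i , empty) , marked)) = reject prefix-run i empty marked
    choose (inj₂ (nonempty , clear))     = answer prefix-run nonempty clear

theorem5 : ∀ (r : ℕ) (P : Fin r → VertexProblem) (C : Fin r → Core) (ρ : Fin r → BitString → Bool) →
    (∀ i → Solves (C i) (ρ i) (P i)) →
    (∀ i → LinearTime (ρ i)) →
    ∃[ c ] ∀ (f : Vec Bool r → ℕ) (d : ℕ) →
    ∃[ p ] ∀ (G : Graph) {ω : ℕ} (D : CW ω) → D DecompositionOf G →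
    Decides p D (∃[ S ] DiverseProblem (venn f) d P G S) (c * timeBound C D)
theorem5 r P C ρ solves linear =
  -- The constant is made of `r` and the constants `K` of the membership functions, so it can be
  -- chosen before `f` and `d`.
  prepareCost r + searchCost r K + 3 , λ f d → decide r (Core.program ∘ C) q (guarded f) d ,
  λ G D iso →
    let module M = Main r C ρ q K ev f d D (_DecompositionOf_.wellFormed iso)
        b , t , comp , t≤ , iff = M.decides
    in b , t , comp , t≤ , mk⇔ (to-sets f d G D iso ∘ Equivalence.to iff) (Equivalence.from iff ∘ from-sets f d G D iso)
  where
  q : Fin r → Program
  q i = proj₁ (linear i)
  K : Fin r → ℕ
  K i = proj₁ (proj₂ (linear i))
  ev : ∀ i → Evaluates (ρ i) (q i) (K i)
  ev i = record { evaluates = proj₂ (proj₂ (linear i)) }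
  Solution : (f : Vec Bool r → ℕ) (d : ℕ) {ω : ℕ} (D : CW ω) → Set
  Solution f d D = Σ[ w ∈ (∀ i → Witness (C i) D) ] d ≤ leafTotal D (λ t → f (Vec.tabulate λ i → ρ i (Witness.α (w i) t)))
  -- The sets are read off the states at the leaves, so they meet the membership condition in
  -- `Solves` by construction; `vertex-sum` then identifies their diversity with the sum over the
  -- leaves.
  to-sets : ∀ f d G {ω} (D : CW ω) → D DecompositionOf G → Solution f d D → ∃[ S ] DiverseProblem (venn f) d P G S
  to-sets f d G D iso (w , d≤) = S ,
    (λ i → Equivalence.from (solves i G D iso (S i)) (w i , Vec.lookup∘tabulate (member i))) ,
    subst (d ≤_) (sym (trans (cong sum (tabulate-cong λ v → cong f (Vec.tabulate-cong λ i → Vec.lookup∘tabulate (member i) v)))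
      (vertex-sum iso (λ t → f (Vec.tabulate λ i → ρ i (Witness.α (w i) t)))))) d≤
    where
    member : Fin r → Fin (order G) → Bool
    member i v = ρ i (Witness.α (w i) (leafOf iso v))
    S : Fin r → Vec Bool (order G)
    S i = Vec.tabulate (member i)
  from-sets : ∀ f d G {ω} (D : CW ω) → D DecompositionOf G → ∃[ S ] DiverseProblem (venn f) d P G S → Solution f d D
  from-sets f d G D iso (S , PS , d≤) = (λ i → proj₁ (sol i)) ,
    subst (d ≤_) (trans (cong sum (tabulate-cong λ v → cong f (Vec.tabulate-cong λ i → proj₂ (sol i) v)))
      (vertex-sum iso (λ t → f (Vec.tabulate λ i → ρ i (Witness.α (proj₁ (sol i)) t))))) d≤
    where
    sol : ∀ i → Σ (Witness (C i) D) λ w → ∀ v → Vec.lookup (S i) v ≡ ρ i (Witness.α w (leafOf iso v))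
    sol i = Equivalence.to (solves i G D iso (S i)) (PS i)
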